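{- Let $q$ be a prime power, $\chi$ a multiplicative character of $\mathbb{F}_q^*$ and $\lambda$ an additive character of $\mathbb{F}_q$. Then, as formal power series in $u$, \[ 1+\sum_{n=1}^{\infty}\frac{u^n}{|GL(n,q)|}\sum_{g\in GL(n,q)}\chi(\det g)\,\lambda(\operatorname{tr} g) = \begin{cases} \dfrac{1}{1-u} & \text{if } \lambda,\chi \text{ are both trivial},\\[1mm] 1 & \text{if } \lambda \text{ is trivial and } \chi \text{ nontrivial},\\[1mm] \prod_{i\ge 1}\left(1+\dfrac{u\,G(\chi,\lambda)}{q^i}\right) & \text{if } \lambda \text{ is nontrivial}.\end{cases}\]
   Context: $GL(n,q)$ is the group of invertible $n\times n$ matrices over $\mathbb{F}_q$. The Gauss sum is $G(\chi,\lambda)=\sum_{x\in\mathbb{F}_q^*}\chi(x)\lambda(x)$. -}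

module Defs where

open import Level using (0ℓ)
open import Algebra.Bundles using (CommutativeRing)
open import Algebra.Bundles.Raw using (RawMonoid; RawRing)
import Algebra.Definitions.RawMonoid as RawMonoidDefs
open import Algebra.Morphism.Structures using (module MonoidMorphisms)
import Algebra.Properties.CommutativeSemigroup as CommutativeSemigroupProperties
import Algebra.Properties.Ring as RingProperties
open import Algebra.Structures using (IsCommutativeRing)
open import Data.Fin.Base as Fin using (Fin; toℕ; punchIn)
open import Data.Fin.Properties using () renaming (_≟_ to _≟ᶠ_)
open import Data.List.Base as List using (List; []; _∷_; allFin; cartesianProductWith; filter; foldr; length; mapMaybe)
open import Data.List.Membership.Propositional using (_∈_; lose)
open import Data.List.Membership.Propositional.Properties using (∈-allFin; ∈-map⁺; ∈-cartesianProductWith⁺)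
open import Data.List.Relation.Unary.Any as Any using (Any; here; any?)
open import Data.Maybe.Base using (Maybe; just; nothing)
open import Data.Nat.Base as ℕ using (ℕ; zero; suc; _∸_; _^_)
import Data.Nat.Properties as ℕP
open import Data.Nat.Primality using (Prime)
open import Data.Integer.Base using (+_)
open import Data.Product using (Σ-syntax; ∃; ∃-syntax; ∃₂; _×_; _,_; proj₁; proj₂)
open import Data.Rational.Base as ℚ using (ℚ; 0ℚ; 1ℚ; ½)
import Data.Rational.Properties as ℚP
open import Data.Vec.Base as Vec using (Vec; []; _∷_; lookup; tabulate)
open import Data.Vec.Properties using (≡-dec)
open import Function.Base using (_∘_; const)
open import Function.Bundles using (_↔_; Inverse)
open import Function.Properties.Inverse using (Inverse⇒Injection; ↔-sym)
open import Relation.Binary.Definitions using (DecidableEquality)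
open import Relation.Binary.PropositionalEquality using (_≡_; _≢_; refl; sym; trans; cong; cong₂; subst)
open import Relation.Nullary using (Dec; yes; no)
open import Relation.Nullary.Decidable using (_×-dec_; map′; via-injection)

-- Real numbers are Cauchy sequences of rationals with a modulus, up to _≈ᴿ_.

Eventually : (ℕ → Set) → Set
Eventually P = ∃[ N ] (∀ n → N ℕ.≤ n → P n)

IsCauchy : (ℕ → ℚ) → Set
IsCauchy x = ∀ ε → 0ℚ ℚ.< ε →
  ∃[ N ] (∀ m n → N ℕ.≤ m → N ℕ.≤ n → ℚ.∣ x m ℚ.- x n ∣ ℚ.< ε)

record ℝ : Set where
  constructor mkℝ
  field
    seq    : ℕ → ℚ
    cauchy : IsCauchy seq

open ℝ public

infix 4 _≈ᴿ_ _≤ᴿ_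

_≈ᴿ_ : ℝ → ℝ → Set
x ≈ᴿ y = ∀ ε → 0ℚ ℚ.< ε → Eventually (λ n → ℚ.∣ seq x n ℚ.- seq y n ∣ ℚ.< ε)

_≤ᴿ_ : ℝ → ℝ → Set
x ≤ᴿ y = ∀ ε → 0ℚ ℚ.< ε → Eventually (λ n → seq x n ℚ.< seq y n ℚ.+ ε)

half-pos : ∀ {ε} → 0ℚ ℚ.< ε → 0ℚ ℚ.< ½ ℚ.* ε
half-pos {ε} ε>0 =
  ℚP.positive⁻¹ (½ ℚ.* ε) {{ℚP.pos*pos⇒pos ½ ε {{ℚ.positive ε>0}}}}

half+half : ∀ ε → ½ ℚ.* ε ℚ.+ ½ ℚ.* ε ≡ ε
half+half ε =
  trans (sym (ℚP.*-distribʳ-+ ε ½ ½)) (ℚP.*-identityˡ ε)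

+-difference : ∀ a b c d → (a ℚ.+ b) ℚ.- (c ℚ.+ d) ≡ (a ℚ.- c) ℚ.+ (b ℚ.- d)
+-difference a b c d =
  trans (cong (a ℚ.+ b ℚ.+_) (ℚP.neg-distrib-+ c d))
        (CommutativeSemigroupProperties.interchange
          (CommutativeRing.+-commutativeSemigroup ℚP.+-*-commutativeRing) a b (ℚ.- c) (ℚ.- d))

neg-difference : ∀ a b → a ℚ.- b ≡ ℚ.- b ℚ.- (ℚ.- a)
neg-difference a b =
  trans (ℚP.+-comm a (ℚ.- b)) (cong (ℚ._+_ (ℚ.- b)) (sym (RingProperties.-‿involutive (CommutativeRing.ring ℚP.+-*-commutativeRing) a)))

[p-q]+q≡p : ∀ p q → (p ℚ.- q) ℚ.+ q ≡ p
[p-q]+q≡p p q =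
  trans (ℚP.+-assoc p (ℚ.- q) q) (trans (cong (p ℚ.+_) (ℚP.+-inverseˡ q)) (ℚP.+-identityʳ p))

p+[q-p]≡q : ∀ p q → p ℚ.+ (q ℚ.- p) ≡ q
p+[q-p]≡q p q = trans (ℚP.+-comm p (q ℚ.- p)) ([p-q]+q≡p q p)

*-difference : ∀ a b c d →
  a ℚ.* b ℚ.- c ℚ.* d ≡ a ℚ.* (b ℚ.- d) ℚ.+ d ℚ.* (a ℚ.- c)
*-difference a b c d = sym (trans
  (cong₂ ℚ._+_ (x[y-z]≈xy-xz a b d)
               (trans (ℚP.*-comm d (a ℚ.- c)) ([y-z]x≈yx-zx d a c)))
  (trans (sym (ℚP.+-assoc (a ℚ.* b ℚ.- a ℚ.* d) (a ℚ.* d) (ℚ.- (c ℚ.* d))))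
         (cong (ℚ._- c ℚ.* d) ([p-q]+q≡p (a ℚ.* b) (a ℚ.* d)))))
  where open RingProperties (CommutativeRing.ring ℚP.+-*-commutativeRing)

const-cauchy : ∀ r → IsCauchy (const r)
const-cauchy r ε ε>0 =
  0 , λ _ _ _ _ → subst (ℚ._< ε) (cong ℚ.∣_∣ (sym (ℚP.+-inverseʳ r))) ε>0

+-cauchy : ∀ x y → IsCauchy x → IsCauchy y → IsCauchy (λ n → x n ℚ.+ y n)
+-cauchy x y cx cy ε ε>0
  with cx (½ ℚ.* ε) (half-pos ε>0) | cy (½ ℚ.* ε) (half-pos ε>0)
... | M , p | N , q = M ℕ.⊔ N , λ m n m≥ n≥ → begin-strict
    ℚ.∣ (x m ℚ.+ y m) ℚ.- (x n ℚ.+ y n) ∣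
      ≡⟨ cong ℚ.∣_∣ (+-difference (x m) (y m) (x n) (y n)) ⟩
    ℚ.∣ (x m ℚ.- x n) ℚ.+ (y m ℚ.- y n) ∣
      ≤⟨ ℚP.∣p+q∣≤∣p∣+∣q∣ (x m ℚ.- x n) (y m ℚ.- y n) ⟩
    ℚ.∣ x m ℚ.- x n ∣ ℚ.+ ℚ.∣ y m ℚ.- y n ∣
      <⟨ ℚP.+-mono-< (p m n (ℕP.m⊔n≤o⇒m≤o M N m≥) (ℕP.m⊔n≤o⇒m≤o M N n≥))
                     (q m n (ℕP.m⊔n≤o⇒n≤o M N m≥) (ℕP.m⊔n≤o⇒n≤o M N n≥)) ⟩
    ½ ℚ.* ε ℚ.+ ½ ℚ.* ε
      ≡⟨ half+half ε ⟩
    ε ∎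
  where
  open ℚP.≤-Reasoning

neg-cauchy : ∀ x → IsCauchy x → IsCauchy (λ n → ℚ.- x n)
neg-cauchy x cx ε ε>0 with cx ε ε>0
... | N , p = N , λ m n m≥ n≥ →
    subst (ℚ._< ε) (cong ℚ.∣_∣ (neg-difference (x n) (x m))) (p n m n≥ m≥)

eventually-bounded : ∀ x → IsCauchy x →
  ∃[ B ] (0ℚ ℚ.< B × Eventually (λ n → ℚ.∣ x n ∣ ℚ.≤ B))
eventually-bounded x cx with cx 1ℚ (ℚP.positive⁻¹ 1ℚ)
... | N , p = ℚ.∣ x N ∣ ℚ.+ 1ℚ
            , ℚP.+-mono-≤-< (ℚP.0≤∣p∣ (x N)) (ℚP.positive⁻¹ 1ℚ)
            , N , λ n n≥ → begin
    ℚ.∣ x n ∣                           ≡⟨ cong ℚ.∣_∣ (sym (p+[q-p]≡q (x N) (x n))) ⟩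
    ℚ.∣ x N ℚ.+ (x n ℚ.- x N) ∣         ≤⟨ ℚP.∣p+q∣≤∣p∣+∣q∣ (x N) (x n ℚ.- x N) ⟩
    ℚ.∣ x N ∣ ℚ.+ ℚ.∣ x n ℚ.- x N ∣     ≤⟨ ℚP.+-monoʳ-≤ ℚ.∣ x N ∣ (ℚP.<⇒≤ (p n N n≥ ℕP.≤-refl)) ⟩
    ℚ.∣ x N ∣ ℚ.+ 1ℚ                    ∎
  where
  open ℚP.≤-Reasoning

*-cauchy : ∀ x y → IsCauchy x → IsCauchy y → IsCauchy (λ n → x n ℚ.* y n)
*-cauchy x y cx cy ε ε>0
  with eventually-bounded x cx | eventually-bounded y cy
... | B , B>0 , K , bx | C , C>0 , L , by = main
  where
  open ℚP.≤-Reasoning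

  D : ℚ
  D = B ℚ.+ C

  D>0 : 0ℚ ℚ.< D
  D>0 = ℚP.+-mono-< B>0 C>0

  B≤D : B ℚ.≤ D
  B≤D = subst (ℚ._≤ D) (ℚP.+-identityʳ B) (ℚP.+-monoʳ-≤ B (ℚP.<⇒≤ C>0))

  C≤D : C ℚ.≤ D
  C≤D = subst (ℚ._≤ D) (ℚP.+-identityˡ C) (ℚP.+-monoˡ-≤ C (ℚP.<⇒≤ B>0))

  instance
    D-pos : ℚ.Positive D
    D-pos = ℚ.positive D>0
    D-nonZero : ℚ.NonZero D
    D-nonZero = ℚP.pos⇒nonZero D
    D-nonNeg : ℚ.NonNegative D
    D-nonNeg = ℚP.pos⇒nonNeg D

  δ : ℚ
  δ = ℚ.1/ D ℚ.* (½ ℚ.* ε)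

  δ>0 : 0ℚ ℚ.< δ
  δ>0 = ℚP.positive⁻¹ δ
    {{ℚP.pos*pos⇒pos (ℚ.1/ D) {{ℚP.1/pos⇒pos D}} (½ ℚ.* ε) {{ℚ.positive (half-pos ε>0)}}}}

  Dδ : D ℚ.* δ ≡ ½ ℚ.* ε
  Dδ = trans (sym (ℚP.*-assoc D (ℚ.1/ D) (½ ℚ.* ε)))
             (trans (cong (ℚ._* (½ ℚ.* ε)) (ℚP.*-inverseʳ D)) (ℚP.*-identityˡ (½ ℚ.* ε)))

  small : ∀ a d → ℚ.∣ a ∣ ℚ.≤ D → ℚ.∣ d ∣ ℚ.< δ → ℚ.∣ a ℚ.* d ∣ ℚ.< ½ ℚ.* ε
  small a d a≤ d< = begin-strict
    ℚ.∣ a ℚ.* d ∣          ≡⟨ ℚP.∣p*q∣≡∣p∣*∣q∣ a d ⟩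
    ℚ.∣ a ∣ ℚ.* ℚ.∣ d ∣    ≤⟨ ℚP.*-monoʳ-≤-nonNeg ℚ.∣ d ∣ {{ℚ.nonNegative (ℚP.0≤∣p∣ d)}} a≤ ⟩
    D ℚ.* ℚ.∣ d ∣          <⟨ ℚP.*-monoʳ-<-pos D d< ⟩
    D ℚ.* δ                ≡⟨ Dδ ⟩
    ½ ℚ.* ε                ∎

  main : ∃[ N ] (∀ m n → N ℕ.≤ m → N ℕ.≤ n →
                 ℚ.∣ x m ℚ.* y m ℚ.- x n ℚ.* y n ∣ ℚ.< ε)
  main with cx δ δ>0 | cy δ δ>0
  ... | M , p | N , q = (K ℕ.⊔ L) ℕ.⊔ (M ℕ.⊔ N) , λ m n m≥ n≥ →
    let KL≤ : ∀ {i} → (K ℕ.⊔ L) ℕ.⊔ (M ℕ.⊔ N) ℕ.≤ i → K ℕ.⊔ L ℕ.≤ i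
        KL≤ = ℕP.m⊔n≤o⇒m≤o (K ℕ.⊔ L) (M ℕ.⊔ N)
        MN≤ : ∀ {i} → (K ℕ.⊔ L) ℕ.⊔ (M ℕ.⊔ N) ℕ.≤ i → M ℕ.⊔ N ℕ.≤ i
        MN≤ = ℕP.m⊔n≤o⇒n≤o (K ℕ.⊔ L) (M ℕ.⊔ N)
    in begin-strict
    ℚ.∣ x m ℚ.* y m ℚ.- x n ℚ.* y n ∣
      ≡⟨ cong ℚ.∣_∣ (*-difference (x m) (y m) (x n) (y n)) ⟩
    ℚ.∣ x m ℚ.* (y m ℚ.- y n) ℚ.+ y n ℚ.* (x m ℚ.- x n) ∣
      ≤⟨ ℚP.∣p+q∣≤∣p∣+∣q∣ (x m ℚ.* (y m ℚ.- y n)) (y n ℚ.* (x m ℚ.- x n)) ⟩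
    ℚ.∣ x m ℚ.* (y m ℚ.- y n) ∣ ℚ.+ ℚ.∣ y n ℚ.* (x m ℚ.- x n) ∣
      <⟨ ℚP.+-mono-<
           (small (x m) (y m ℚ.- y n)
             (ℚP.≤-trans (bx m (ℕP.m⊔n≤o⇒m≤o K L (KL≤ m≥))) B≤D)
             (q m n (ℕP.m⊔n≤o⇒n≤o M N (MN≤ m≥)) (ℕP.m⊔n≤o⇒n≤o M N (MN≤ n≥))))
           (small (y n) (x m ℚ.- x n)
             (ℚP.≤-trans (by n (ℕP.m⊔n≤o⇒n≤o K L (KL≤ n≥))) C≤D)
             (p m n (ℕP.m⊔n≤o⇒m≤o M N (MN≤ m≥)) (ℕP.m⊔n≤o⇒m≤o M N (MN≤ n≥)))) ⟩
    ½ ℚ.* ε ℚ.+ ½ ℚ.* ε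
      ≡⟨ half+half ε ⟩
    ε ∎

infixl 6 _+ᴿ_
infixl 7 _*ᴿ_
infix  8 -ᴿ_

fromℚ : ℚ → ℝ
fromℚ r = mkℝ (const r) (const-cauchy r)

_+ᴿ_ _*ᴿ_ : ℝ → ℝ → ℝ
x +ᴿ y = mkℝ (λ n → seq x n ℚ.+ seq y n) (+-cauchy (seq x) (seq y) (cauchy x) (cauchy y))
x *ᴿ y = mkℝ (λ n → seq x n ℚ.* seq y n) (*-cauchy (seq x) (seq y) (cauchy x) (cauchy y))

-ᴿ_ : ℝ → ℝ
-ᴿ x = mkℝ (λ n → ℚ.- seq x n) (neg-cauchy (seq x) (cauchy x))

record ℂ : Set where
  constructor _+i_
  field
    re im : ℝ

open ℂ public

infix  4 _≈ᶜ_
infixl 6 _+ᶜ_ _-ᶜ_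
infixl 7 _*ᶜ_
infix  8 -ᶜ_

_≈ᶜ_ : ℂ → ℂ → Set
z ≈ᶜ w = re z ≈ᴿ re w × im z ≈ᴿ im w

_+ᶜ_ _*ᶜ_ : ℂ → ℂ → ℂ
z +ᶜ w = (re z +ᴿ re w) +i (im z +ᴿ im w)
z *ᶜ w = (re z *ᴿ re w +ᴿ -ᴿ (im z *ᴿ im w)) +i (re z *ᴿ im w +ᴿ im z *ᴿ re w)

-ᶜ_ : ℂ → ℂ
-ᶜ z = (-ᴿ re z) +i (-ᴿ im z)

_-ᶜ_ : ℂ → ℂ → ℂ
z -ᶜ w = z +ᶜ (-ᶜ w)

ℚ→ℂ : ℚ → ℂ
ℚ→ℂ r = fromℚ r +i fromℚ 0ℚ

0ᶜ 1ᶜ : ℂ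
0ᶜ = ℚ→ℂ 0ℚ
1ᶜ = ℚ→ℂ 1ℚ

ℂ-rawRing : RawRing 0ℓ 0ℓ
ℂ-rawRing = record
  { Carrier = ℂ ; _≈_ = _≈ᶜ_ ; _+_ = _+ᶜ_ ; _*_ = _*ᶜ_ ; -_ = -ᶜ_ ; 0# = 0ᶜ ; 1# = 1ᶜ }

∣_∣² : ℂ → ℝ
∣ z ∣² = re z *ᴿ re z +ᴿ im z *ᴿ im z

-- ∣ z n - l ∣ ≤ ε is expressed as ∣ z n - l ∣² ≤ ε².
infix 4 _⟶_
_⟶_ : (ℕ → ℂ) → ℂ → Set
z ⟶ l = ∀ ε → 0ℚ ℚ.< ε → Eventually (λ n → ∣ z n -ᶜ l ∣² ≤ᴿ fromℚ (ε ℚ.* ε))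

-- The value at 0 is junk: it is only used at q ^ i and ∣GL(n,q)∣, which are positive.
recip : ℕ → ℂ
recip zero    = 0ᶜ
recip (suc n) = ℚ→ℂ (+ 1 ℚ./ suc n)

sumList : {A : Set} → List A → (A → ℂ) → ℂ
sumList xs f = foldr _+ᶜ_ 0ᶜ (List.map f xs)

PowerSeries : Set
PowerSeries = ℕ → ℂ

infix  4 _≈ᵖ_ _≈1/_ _≈∏_
infixl 6 _+ᵖ_ _-ᵖ_
infixl 7 _*ᵖ_ _·ᵖ_

_≈ᵖ_ : PowerSeries → PowerSeries → Set
f ≈ᵖ g = ∀ n → f n ≈ᶜ g n

1ᵖ u : PowerSeries
1ᵖ zero    = 1ᶜ
1ᵖ (suc _) = 0ᶜ
u zero          = 0ᶜ
u (suc zero)    = 1ᶜ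
u (suc (suc _)) = 0ᶜ

_+ᵖ_ _-ᵖ_ _*ᵖ_ : PowerSeries → PowerSeries → PowerSeries
(f +ᵖ g) n = f n +ᶜ g n
(f -ᵖ g) n = f n -ᶜ g n
(f *ᵖ g) n = sum (λ (k : Fin (suc n)) → f (toℕ k) *ᶜ g (n ∸ toℕ k))
  where open RawMonoidDefs (RawRing.+-rawMonoid ℂ-rawRing) using (sum)

_·ᵖ_ : ℂ → PowerSeries → PowerSeries
(c ·ᵖ f) n = c *ᶜ f n

_≈1/_ : PowerSeries → PowerSeries → Set
f ≈1/ g = g *ᵖ f ≈ᵖ 1ᵖ

∏[1⋯_] : ℕ → (ℕ → PowerSeries) → PowerSeries
∏[1⋯ zero ]  p = 1ᵖ
∏[1⋯ suc N ] p = ∏[1⋯ N ] p *ᵖ p (suc N)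

-- f is the infinite product of the p i over i ≥ 1: the coefficients of the partial
-- products converge in ℂ.  Convergence in the u-adic topology would be too strong
-- for factors such as 1 + c u / q ^ i.
_≈∏_ : PowerSeries → (ℕ → PowerSeries) → Set
f ≈∏ p = ∀ n → (λ N → ∏[1⋯ N ] p n) ⟶ f n

IsPrimePower : ℕ → Set
IsPrimePower q = ∃₂ λ p k → Prime p × q ≡ p ^ suc k

record FiniteField (q : ℕ) : Set₁ where
  infixl 6 _+_
  infixl 7 _*_
  infix  8 -_
  field
    Carrier           : Set
    _+_ _*_           : Carrier → Carrier → Carrier
    -_                : Carrier → Carrier
    0# 1#             : Carrier
    isCommutativeRing : IsCommutativeRing _≡_ _+_ _*_ -_ 0# 1#
    0≢1               : 0# ≢ 1#
    inverse           : ∀ x → x ≢ 0# → ∃[ y ] x * y ≡ 1#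
    enumeration       : Fin q ↔ Carrier

  commutativeRing : CommutativeRing 0ℓ 0ℓ
  commutativeRing = record { isCommutativeRing = isCommutativeRing }

  open CommutativeRing commutativeRing public
    using (rawRing; +-rawMonoid; *-assoc; *-comm; *-identityʳ; zeroˡ)

  infix 4 _≟_
  _≟_ : DecidableEquality Carrier
  _≟_ = via-injection (Inverse⇒Injection (↔-sym enumeration)) _≟ᶠ_

  elements : List Carrier
  elements = List.map (Inverse.to enumeration) (allFin q)

  ∈-elements : ∀ x → x ∈ elements
  ∈-elements x =
    subst (_∈ elements) (Inverse.strictlyInverseˡ enumeration x)
      (∈-map⁺ (Inverse.to enumeration) (∈-allFin (Inverse.from enumeration x)))

  -- Proofs of _≢_ are definitionally irrelevant, so equality of units is
  -- equality of the underlying elements.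
  Unit : Set
  Unit = Σ[ x ∈ Carrier ] x ≢ 0#

  1ᵘ : Unit
  1ᵘ = 1# , 0≢1 ∘ sym

  _*ᵘ_ : Unit → Unit → Unit
  (x , x≢0) *ᵘ (y , y≢0) = x * y , λ xy≡0 → x≢0 (x≡0 xy≡0)
    where
    x≡0 : x * y ≡ 0# → x ≡ 0#
    x≡0 xy≡0 with inverse y y≢0
    ... | z , yz≡1 = trans (sym (*-identityʳ x)) (trans (cong (x *_) (sym yz≡1))
                       (trans (sym (*-assoc x y z)) (trans (cong (_* z) xy≡0) (zeroˡ z))))

  *ᵘ-rawMonoid : RawMonoid 0ℓ 0ℓ
  *ᵘ-rawMonoid = record { Carrier = Unit ; _≈_ = _≡_ ; _∙_ = _*ᵘ_ ; ε = 1ᵘ }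

  toUnit : Carrier → Maybe Unit
  toUnit x with x ≟ 0#
  ... | yes _  = nothing
  ... | no x≢0 = just (x , x≢0)

  units : List Unit
  units = mapMaybe toUnit elements

module _ {q} (F : FiniteField q) where
  open FiniteField F
  open RawMonoidDefs +-rawMonoid using (sum)

  Mat : ℕ → Set
  Mat n = Vec (Vec Carrier n) n

  entry : ∀ {n} → Mat n → Fin n → Fin n → Carrier
  entry A i j = lookup (lookup A i) j

  fromEntries : ∀ {n} → (Fin n → Fin n → Carrier) → Mat n
  fromEntries a = tabulate λ i → tabulate λ j → a i j

  δ : ∀ {n} → Fin n → Fin n → Carrier
  δ i j with i ≟ᶠ j
  ... | yes _ = 1#
  ... | no  _ = 0#

  idMat : ∀ {n} → Mat n
  idMat = fromEntries δ

  _*ᴹ_ : ∀ {n} → Mat n → Mat n → Mat n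
  A *ᴹ B = fromEntries λ i j → sum λ k → entry A i k * entry B k j

  tr : ∀ {n} → Mat n → Carrier
  tr A = sum λ i → entry A i i

  -- alternating a = a 0 - a 1 + a 2 - ⋯
  alternating : ∀ {n} → (Fin n → Carrier) → Carrier
  alternating {zero}  a = 0#
  alternating {suc n} a = a Fin.zero + - alternating (a ∘ Fin.suc)

  -- Laplace expansion along the first row.
  detEntries : ∀ {n} → (Fin n → Fin n → Carrier) → Carrier
  detEntries {zero}  a = 1#
  detEntries {suc n} a = alternating λ j →
    a Fin.zero j * detEntries (λ i k → a (Fin.suc i) (punchIn j k))

  det : ∀ {n} → Mat n → Carrier
  det A = detEntries (entry A)

  Invertible : ∀ {n} → Mat n → Set
  Invertible A = ∃[ B ] (A *ᴹ B ≡ idMat × B *ᴹ A ≡ idMat)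

  allVecs : {A : Set} → List A → ∀ n → List (Vec A n)
  allVecs xs zero    = [] ∷ []
  allVecs xs (suc n) = cartesianProductWith _∷_ xs (allVecs xs n)

  ∈-allVecs : {A : Set} {xs : List A} → (∀ x → x ∈ xs) →
              ∀ {n} (v : Vec A n) → v ∈ allVecs xs n
  ∈-allVecs all []      = here refl
  ∈-allVecs all (x ∷ v) = ∈-cartesianProductWith⁺ _∷_ (all x) (∈-allVecs all v)

  matrices : ∀ n → List (Mat n)
  matrices n = allVecs (allVecs elements n) n

  ∈-matrices : ∀ {n} (A : Mat n) → A ∈ matrices n
  ∈-matrices = ∈-allVecs (∈-allVecs ∈-elements)

  invertible? : ∀ {n} (A : Mat n) → Dec (Invertible A)
  invertible? {n} A =
    map′ Any.satisfied (λ (B , AB≡1 , BA≡1) → lose (∈-matrices B) (AB≡1 , BA≡1))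
         (any? (λ B → (A *ᴹ B) ≟ᴹ idMat ×-dec (B *ᴹ A) ≟ᴹ idMat) (matrices n))
    where
    _≟ᴹ_ : DecidableEquality (Mat n)
    _≟ᴹ_ = ≡-dec (≡-dec _≟_)

  -- Every invertible matrix is listed exactly once.
  GL : ∀ n → List (Mat n)
  GL n = filter invertible? (matrices n)

  -- A homomorphism from a group into the monoid (ℂ, ·) takes values in ℂ*.
  IsMultiplicativeCharacter : (Unit → ℂ) → Set
  IsMultiplicativeCharacter =
    MonoidMorphisms.IsMonoidHomomorphism *ᵘ-rawMonoid (RawRing.*-rawMonoid ℂ-rawRing)

  IsAdditiveCharacter : (Carrier → ℂ) → Set
  IsAdditiveCharacter =
    MonoidMorphisms.IsMonoidHomomorphism +-rawMonoid (RawRing.*-rawMonoid ℂ-rawRing)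

  gaussSum : (Unit → ℂ) → (Carrier → ℂ) → ℂ
  gaussSum χ ψ = sumList units (λ x → χ x *ᶜ ψ (proj₁ x))

  -- χ evaluated at a field element.  The value at 0 is junk: the theorem uses it
  -- only at determinants of invertible matrices.
  onElement : (Unit → ℂ) → Carrier → ℂ
  onElement χ x with x ≟ 0#
  ... | yes _  = 0ᶜ
  ... | no x≢0 = χ (x , x≢0)

  glSum : (Unit → ℂ) → (Carrier → ℂ) → ℕ → ℂ
  glSum χ ψ n = sumList (GL n) (λ g → onElement χ (det g) *ᶜ ψ (tr g))

  glSeries : (Unit → ℂ) → (Carrier → ℂ) → PowerSeries
  glSeries χ ψ zero      = 1ᶜ
  glSeries χ ψ n@(suc _) = recip (length (GL n)) *ᶜ glSum χ ψ n

IsTrivial : {A : Set} → (A → ℂ) → Set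
IsTrivial φ = ∀ x → φ x ≈ᶜ 1ᶜ

{-# OPTIONS --safe #-}

-- Split g in GL(n+1,q) by its first row (a , b).  If b ≠ 0, adding multiples of a column
-- k + 1 with b k ≠ 0 to the first column fixes det g and moves tr g through all of the
-- field, so for nontrivial ψ these g contribute nothing; if b = 0, then g is block
-- triangular, and the sum T n over GL(n,q) satisfies T (n + 1) = q ^ n G T n.  Column
-- operations also show that all nonzero first rows occur equally often, whence
-- ∣GL(n+1,q)∣ = (q ^ (n + 1) - 1) q ^ n ∣GL(n,q)∣, and the coefficients c n of the series
-- satisfy c n G = c (n + 1) (q ^ (n + 1) - 1).  By this recurrence the coefficient of uⁿ in
-- the product of the first N factors is c n (1 - s) (1 - q s) ⋯ (1 - q ^ (n - 1) s) with
-- s = 1 / q ^ N, which tends to c n.  If ψ is trivial, scaling the first row by x multiplies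
-- the sum by χ x.  An element z of ℂ fixed by all values of a nontrivial character vanishes:
-- z ≈ 0 is stable under double negation and ℂ has no zero divisors.

module Submission where

open import Defs
open import Data.Nat.Base using (ℕ; _^_)
open import Data.Product using (_×_)
open import Relation.Nullary using (¬_)

open import Level using (0ℓ)
open import Algebra.Bundles using (CommutativeRing)
import Algebra.Definitions.RawMonoid as RawMonoidDefs
open import Algebra.Morphism.Structures using (module MonoidMorphisms)
import Algebra.Properties.CommutativeSemigroup as CommutativeSemigroupProperties
import Algebra.Properties.Group as GroupProperties
import Algebra.Properties.Ring as RingProperties
import Algebra.Properties.Semiring.Mult as SemiringMult
import Algebra.Properties.Semiring.Sum as SemiringSum
open import Data.Bool.Base using (if_then_else_)
open import Data.Fin.Base as Fin using (Fin; zero; suc; inject₁; punchIn; punchOut; toℕ)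
open import Data.Fin.Induction using (<-weakInduction)
import Data.Fin.Properties as FinP
import Data.Integer.Base as ℤ
import Data.Integer.Properties as ℤP
open import Data.List.Base as List using (List; []; _∷_; _++_; allFin; cartesianProduct; cartesianProductWith; filter; foldr; length; mapMaybe)
open import Data.List.Membership.Propositional using (_∈_)
open import Data.List.Membership.Propositional.Properties using (∈-allFin; ∈-cartesianProduct⁺; ∈-filter⁺; ∈-length; ∈-map⁺)
open import Data.List.Membership.Propositional.Properties.WithK using (unique∧set⇒bag)
import Data.List.Properties as ListP
open import Data.List.Relation.Binary.BagAndSetEquality using (∼bag⇒↭)
import Data.List.Relation.Binary.Permutation.Homogeneous as Homogeneous
open import Data.List.Relation.Binary.Permutation.Propositional using (_↭_; ↭⇒↭ₛ)
import Data.List.Relation.Binary.Permutation.Propositional.Properties as ↭P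
import Data.List.Relation.Binary.Permutation.Setoid.Properties as ↭ₛP
open import Data.List.Relation.Unary.All as All using ([]; _∷_)
open import Data.List.Relation.Unary.AllPairs using ([]; _∷_)
open import Data.List.Relation.Unary.Any using (here; there)
open import Data.List.Relation.Unary.Unique.Propositional using (Unique)
import Data.List.Relation.Unary.Unique.Propositional.Properties as Unique
open import Data.Nat.Base as ℕ using (zero; suc; _∸_)
open import Data.Nat.Primality using (prime⇒nonTrivial)
import Data.Nat.Properties as ℕP
open import Data.Product using (_,_; proj₁; proj₂; ∃-syntax; uncurry)
open import Data.Rational.Base as ℚ using (ℚ; 0ℚ; 1ℚ; ½)
import Data.Rational.Properties as ℚP
open import Data.Rational.Solver using (module +-*-Solver)
import Data.Rational.Unnormalised.Base as ℚᵘ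
import Data.Rational.Unnormalised.Properties as ℚᵘP
open import Data.Sum.Base using (_⊎_; inj₁; inj₂; [_,_]′)
open import Data.Vec.Base as Vec using (Vec; []; _∷_; lookup; updateAt; replicate; zipWith)
import Data.Vec.Properties as VecP
open import Function.Base using (_∘_; id; flip)
open import Function.Bundles using (Inverse; mk⇔)
open import Relation.Binary.Definitions using (tri<; tri≈; tri>)
open import Relation.Binary.PropositionalEquality as ≡ using (_≡_; _≢_)
import Relation.Binary.Reasoning.Setoid as SetoidReasoning
open import Relation.Nullary using (Dec; yes; no; does; contradiction)
open import Relation.Unary using (Decidable)

-- Finite sums

-- A negated triviality assumption provides no element at which the character differs from 1, so
-- there is no factor ψ x - 1 to divide by. The sums are therefore computed in an arbitrary
-- commutative ring, where nontriviality takes the form of a cancellation principle: an element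
-- fixed by all values of the character vanishes. ℂ supplies this principle afterwards.
--
-- Invertibility means having an inverse matrix, while the determinant is a Laplace expansion.
-- Column operations connect the two: they are right multiplications by elementary matrices, and
-- they fix the determinant because it is linear and alternating in the columns. The operations
-- combine the first column with an arbitrary other one, so alternation is required for all pairs of
-- columns and not only for adjacent ones.
--
-- The recurrence is that of c n = Gⁿ / ((q - 1) (q² - 1) ⋯ (qⁿ - 1)), the coefficients in Euler's
-- expansion of the infinite product. The formula for N factors is exact, so the passage to the
-- limit concerns a single rational factor.

record IsEnumeration {A : Set} (xs : List A) : Set where
  constructor enumerates
  field
    unique   : Unique xs
    complete : ∀ x → x ∈ xs

open IsEnumeration

-- Duplicate-free lists with the same members agree as bags. Hence a sum over a finite type does not
-- depend on the order of listing, which is what every change of variables below relies on.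
enumeration-↭ : {A : Set} {xs ys : List A} → IsEnumeration xs → IsEnumeration ys → xs ↭ ys
enumeration-↭ xs! ys! = ∼bag⇒↭ (unique∧set⇒bag (unique xs!) (unique ys!)
  (mk⇔ (λ _ → complete ys! _) (λ _ → complete xs! _)))

map-enumeration : {A B : Set} {xs : List A} (to : A → B) (from : B → A) →
  (∀ x → from (to x) ≡ x) → (∀ y → to (from y) ≡ y) →
  IsEnumeration xs → IsEnumeration (List.map to xs)
map-enumeration {xs = xs} to from from∘to to∘from xs! = enumerates
  (Unique.map⁺ (λ {x} {y} tx≡ty →
    ≡.trans (≡.sym (from∘to x)) (≡.trans (≡.cong from tx≡ty) (from∘to y))) (unique xs!))
  (λ y → ≡.subst (_∈ List.map to xs) (to∘from y) (∈-map⁺ to (complete xs! (from y))))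

module FiniteSums (R : CommutativeRing 0ℓ 0ℓ) where
  open CommutativeRing R
  open SetoidReasoning setoid
  open SemiringMult semiring using () renaming (_×_ to _·ℕ_)

  Σ⟨_⟩ : {A : Set} → List A → (A → Carrier) → Carrier
  Σ⟨ xs ⟩ f = foldr _+_ 0# (List.map f xs)

  ι : ℕ → Carrier
  ι n = n ·ℕ 1#

  module _ {A : Set} where

    Σ-cong-∈ : (xs : List A) {f g : A → Carrier} → (∀ x → x ∈ xs → f x ≈ g x) → Σ⟨ xs ⟩ f ≈ Σ⟨ xs ⟩ g
    Σ-cong-∈ []       f≈g = refl
    Σ-cong-∈ (x ∷ xs) f≈g = +-cong (f≈g x (here ≡.refl)) (Σ-cong-∈ xs λ y y∈ → f≈g y (there y∈))

    Σ-cong : (xs : List A) {f g : A → Carrier} → (∀ x → f x ≈ g x) → Σ⟨ xs ⟩ f ≈ Σ⟨ xs ⟩ g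
    Σ-cong xs f≈g = Σ-cong-∈ xs λ x _ → f≈g x

    Σ-const : (xs : List A) (c : Carrier) → Σ⟨ xs ⟩ (λ _ → c) ≈ ι (length xs) * c
    Σ-const []       c = sym (zeroˡ c)
    Σ-const (x ∷ xs) c = begin
      c + Σ⟨ xs ⟩ (λ _ → c)          ≈⟨ +-cong (sym (*-identityˡ c)) (Σ-const xs c) ⟩
      1# * c + ι (length xs) * c     ≈⟨ distribʳ c 1# _ ⟨
      (1# + ι (length xs)) * c       ∎

    Σ-zero : (xs : List A) {f : A → Carrier} → (∀ x → x ∈ xs → f x ≈ 0#) → Σ⟨ xs ⟩ f ≈ 0#
    Σ-zero xs f≈0 = trans (Σ-cong-∈ xs f≈0) (trans (Σ-const xs 0#) (zeroʳ _))

    Σ-*ˡ : (xs : List A) (c : Carrier) (f : A → Carrier) → c * Σ⟨ xs ⟩ f ≈ Σ⟨ xs ⟩ (λ x → c * f x)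
    Σ-*ˡ []       c f = zeroʳ c
    Σ-*ˡ (x ∷ xs) c f = trans (distribˡ c (f x) _) (+-congˡ (Σ-*ˡ xs c f))

    Σ-*ʳ : (xs : List A) (f : A → Carrier) (c : Carrier) → Σ⟨ xs ⟩ f * c ≈ Σ⟨ xs ⟩ (λ x → f x * c)
    Σ-*ʳ xs f c = trans (*-comm _ c) (trans (Σ-*ˡ xs c f) (Σ-cong xs λ x → *-comm c (f x)))

    Σ-+ : (xs : List A) (f g : A → Carrier) → Σ⟨ xs ⟩ f + Σ⟨ xs ⟩ g ≈ Σ⟨ xs ⟩ (λ x → f x + g x)
    Σ-+ []       f g = +-identityˡ 0#
    Σ-+ (x ∷ xs) f g = trans (interchange (f x) _ (g x) _) (+-congˡ (Σ-+ xs f g))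
      where open CommutativeSemigroupProperties +-commutativeSemigroup using (interchange)

    Σ-++ : (xs ys : List A) (f : A → Carrier) → Σ⟨ xs ++ ys ⟩ f ≈ Σ⟨ xs ⟩ f + Σ⟨ ys ⟩ f
    Σ-++ []       ys f = sym (+-identityˡ _)
    Σ-++ (x ∷ xs) ys f = trans (+-congˡ (Σ-++ xs ys f)) (sym (+-assoc (f x) _ _))

    Σ-↭ : {xs ys : List A} (f : A → Carrier) → xs ↭ ys → Σ⟨ xs ⟩ f ≈ Σ⟨ ys ⟩ f
    Σ-↭ f xs↭ys = ↭ₛP.foldr-commMonoid setoid +-isCommutativeMonoid
      (Homogeneous.map reflexive (↭⇒↭ₛ (↭P.map⁺ f xs↭ys)))

  Σ-map : {A B : Set} (g : A → B) (xs : List A) (f : B → Carrier) →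
    Σ⟨ List.map g xs ⟩ f ≡ Σ⟨ xs ⟩ (f ∘ g)
  Σ-map g xs f = ≡.cong (foldr _+_ 0#) (≡.sym (ListP.map-∘ xs))

  Σ-cartesianProductWith : {A B C : Set} (h : A → B → C) (xs : List A) (ys : List B) (f : C → Carrier) →
    Σ⟨ cartesianProductWith h xs ys ⟩ f ≈ Σ⟨ xs ⟩ λ x → Σ⟨ ys ⟩ λ y → f (h x y)
  Σ-cartesianProductWith h []       ys f = refl
  Σ-cartesianProductWith h (x ∷ xs) ys f = begin
    Σ⟨ List.map (h x) ys ++ cartesianProductWith h xs ys ⟩ f
      ≈⟨ Σ-++ (List.map (h x) ys) _ f ⟩
    Σ⟨ List.map (h x) ys ⟩ f + Σ⟨ cartesianProductWith h xs ys ⟩ f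
      ≈⟨ +-cong (reflexive (Σ-map (h x) ys f)) (Σ-cartesianProductWith h xs ys f) ⟩
    Σ⟨ ys ⟩ (f ∘ h x) + Σ⟨ xs ⟩ (λ x′ → Σ⟨ ys ⟩ λ y → f (h x′ y))
      ∎

  Σ-comm : {A B : Set} (xs : List A) (ys : List B) (f : A → B → Carrier) →
    (Σ⟨ xs ⟩ λ x → Σ⟨ ys ⟩ λ y → f x y) ≈ (Σ⟨ ys ⟩ λ y → Σ⟨ xs ⟩ λ x → f x y)
  Σ-comm []       ys f = sym (Σ-zero ys λ _ _ → refl)
  Σ-comm (x ∷ xs) ys f = trans (+-congˡ (Σ-comm xs ys f)) (Σ-+ ys (f x) _)

  Σ-reindex : {A B : Set} {xs : List A} {ys : List B} (to : A → B) (from : B → A) →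
    (∀ x → from (to x) ≡ x) → (∀ y → to (from y) ≡ y) →
    IsEnumeration xs → IsEnumeration ys →
    (f : B → Carrier) → Σ⟨ xs ⟩ (f ∘ to) ≈ Σ⟨ ys ⟩ f
  Σ-reindex {xs = xs} to from from∘to to∘from xs! ys! f =
    trans (reflexive (≡.sym (Σ-map to xs f)))
          (Σ-↭ f (enumeration-↭ (map-enumeration to from from∘to to∘from xs!) ys!))

  Σ-point : {A : Set} {xs : List A} → IsEnumeration xs → (a : A) (f : A → Carrier) →
    (∀ x → x ≢ a → f x ≈ 0#) → Σ⟨ xs ⟩ f ≈ f a
  Σ-point {A} {xs} (enumerates xs! xs∋) a f f≈0 = go xs xs! (xs∋ a)
    where
    go : (ys : List A) → Unique ys → a ∈ ys → Σ⟨ ys ⟩ f ≈ f a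
    go (y ∷ ys) (y∉ ∷ _) (here ≡.refl) =
      trans (+-congˡ (Σ-zero ys λ x x∈ → f≈0 x λ x≡a → All.lookup y∉ x∈ (≡.sym x≡a)))
            (+-identityʳ (f a))
    go (y ∷ ys) (y∉ ∷ ys!) (there a∈) =
      trans (+-cong (f≈0 y (All.lookup y∉ a∈)) (go ys ys! a∈)) (+-identityˡ (f a))

  -- Invertibility becomes a factor of the summand: the set of all matrices splits into independent
  -- choices of first row, first column and remainder, whereas GL(n,q) does not.
  [_]_ : {P : Set} → Dec P → Carrier → Carrier
  [ P? ] c = if does P? then c else 0#

  []-yes : {P : Set} (P? : Dec P) {c : Carrier} → P → [ P? ] c ≡ c
  []-yes (yes _) p = ≡.refl
  []-yes (no ¬p) p = contradiction p ¬p

  []-no : {P : Set} (P? : Dec P) {c : Carrier} → ¬ P → [ P? ] c ≡ 0#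
  []-no (yes p) ¬p = contradiction p ¬p
  []-no (no _)  ¬p = ≡.refl

  []-cong : {P Q : Set} (P? : Dec P) (Q? : Dec Q) {c d : Carrier} →
    (P → Q) → (Q → P) → (P → c ≈ d) → [ P? ] c ≈ [ Q? ] d
  []-cong (yes p) Q? P⇒Q Q⇒P c≈d = trans (c≈d p) (reflexive (≡.sym ([]-yes Q? (P⇒Q p))))
  []-cong (no ¬p) Q? P⇒Q Q⇒P c≈d = reflexive (≡.sym ([]-no Q? (¬p ∘ Q⇒P)))

  []-*ˡ : {P : Set} (P? : Dec P) (c d : Carrier) → c * [ P? ] d ≈ [ P? ] (c * d)
  []-*ˡ (yes _) c d = refl
  []-*ˡ (no _)  c d = zeroʳ c

  Σ-filter : {A : Set} {P : A → Set} (P? : Decidable P) (xs : List A) (f : A → Carrier) →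
    Σ⟨ filter P? xs ⟩ f ≈ Σ⟨ xs ⟩ (λ x → [ P? x ] f x)
  Σ-filter P? []       f = refl
  Σ-filter P? (x ∷ xs) f with P? x
  ... | yes _ = +-congˡ (Σ-filter P? xs f)
  ... | no  _ = trans (Σ-filter P? xs f) (sym (+-identityˡ _))

-- Determinants and column operations

module Matrices {q} (F : FiniteField q) where
  open FiniteField F renaming (Carrier to K)
  open CommutativeRing commutativeRing public
    using (ring; semiring; +-assoc; +-comm; +-identityˡ; +-identityʳ; -‿inverseˡ; -‿inverseʳ; *-identityˡ; zeroʳ; distribˡ; distribʳ; +-commutativeSemigroup; *-commutativeSemigroup)
  open RingProperties ring using (-‿distribˡ-*; -‿distribʳ-*; -‿+-comm; -0#≈0#; -1*x≈-x)
  open RawMonoidDefs +-rawMonoid using (sum)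
  open ≡ using (refl; sym; trans; cong; cong₂; subst)
  open ≡.≡-Reasoning
  private
    module +-CS = CommutativeSemigroupProperties +-commutativeSemigroup
    module *-CS = CommutativeSemigroupProperties *-commutativeSemigroup

  Entries : ℕ → Set
  Entries n = Fin n → Fin n → K

  minor : ∀ {n} → Entries (suc n) → Fin (suc n) → Entries n
  minor a j i k = a (suc i) (punchIn j k)

  alternating-cong : ∀ {n} {f g : Fin n → K} → (∀ i → f i ≡ g i) → alternating F f ≡ alternating F g
  alternating-cong {zero}  f≗g = refl
  alternating-cong {suc n} f≗g = cong₂ _+_ (f≗g zero) (cong -_ (alternating-cong (f≗g ∘ suc)))

  alternating-zero : ∀ {n} {f : Fin n → K} → (∀ i → f i ≡ 0#) → alternating F f ≡ 0#
  alternating-zero {zero}  f≗0 = refl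
  alternating-zero {suc n} f≗0 =
    trans (cong₂ _+_ (f≗0 zero) (trans (cong -_ (alternating-zero (f≗0 ∘ suc))) -0#≈0#)) (+-identityˡ 0#)

  alternating-linear : ∀ {n} (s t : K) (f g : Fin n → K) →
    alternating F (λ i → s * f i + t * g i) ≡ s * alternating F f + t * alternating F g
  alternating-linear {zero}  s t f g = sym (trans (cong₂ _+_ (zeroʳ s) (zeroʳ t)) (+-identityˡ 0#))
  alternating-linear {suc n} s t f g = begin
    (s * f zero + t * g zero) + - alternating F (λ i → s * f (suc i) + t * g (suc i))
      ≡⟨ cong (λ x → (s * f zero + t * g zero) + - x) (alternating-linear s t (f ∘ suc) (g ∘ suc)) ⟩
    (s * f zero + t * g zero) + - (s * f⁺ + t * g⁺)
      ≡⟨ cong ((s * f zero + t * g zero) +_) (sym (-‿+-comm (s * f⁺) (t * g⁺))) ⟩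
    (s * f zero + t * g zero) + (- (s * f⁺) + - (t * g⁺))
      ≡⟨ cong ((s * f zero + t * g zero) +_) (cong₂ _+_ (-‿distribʳ-* s f⁺) (-‿distribʳ-* t g⁺)) ⟩
    (s * f zero + t * g zero) + (s * - f⁺ + t * - g⁺)
      ≡⟨ +-CS.interchange (s * f zero) (t * g zero) (s * - f⁺) (t * - g⁺) ⟩
    (s * f zero + s * - f⁺) + (t * g zero + t * - g⁺)
      ≡⟨ cong₂ _+_ (sym (distribˡ s (f zero) (- f⁺))) (sym (distribˡ t (g zero) (- g⁺))) ⟩
    s * (f zero + - f⁺) + t * (g zero + - g⁺) ∎
    where
    f⁺ = alternating F (f ∘ suc)
    g⁺ = alternating F (g ∘ suc)

  -- Neighbouring positions carry opposite signs, so the two surviving terms cancel.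
  alternating-pair : ∀ {n} (i : Fin n) (f : Fin (suc n) → K) →
    (∀ j → j ≢ inject₁ i → j ≢ suc i → f j ≡ 0#) → f (inject₁ i) ≡ f (suc i) → alternating F f ≡ 0#
  alternating-pair zero f f≡0 eq = begin
    f zero + - (f (suc zero) + - alternating F (λ i → f (suc (suc i))))
      ≡⟨ cong (λ x → f zero + - (f (suc zero) + x))
           (trans (cong -_ (alternating-zero λ j → f≡0 (suc (suc j)) (λ ()) (λ ()))) -0#≈0#) ⟩
    f zero + - (f (suc zero) + 0#)
      ≡⟨ cong₂ (λ x y → x + - y) eq (+-identityʳ (f (suc zero))) ⟩
    f (suc zero) + - f (suc zero)
      ≡⟨ -‿inverseʳ (f (suc zero)) ⟩
    0# ∎
  alternating-pair (suc i) f f≡0 eq = begin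
    f zero + - alternating F (f ∘ suc)
      ≡⟨ cong₂ (λ x y → x + - y) (f≡0 zero (λ ()) (λ ()))
           (alternating-pair i (f ∘ suc)
             (λ j j≢ j≢′ → f≡0 (suc j) (j≢ ∘ FinP.suc-injective) (j≢′ ∘ FinP.suc-injective)) eq) ⟩
    0# + - 0#   ≡⟨ -‿inverseʳ 0# ⟩
    0#          ∎

  det-cong : ∀ {n} {a b : Entries n} → (∀ i j → a i j ≡ b i j) → detEntries F a ≡ detEntries F b
  det-cong {zero}  a≗b = refl
  det-cong {suc n} a≗b = alternating-cong λ j →
    cong₂ _*_ (a≗b zero j) (det-cong λ i k → a≗b (suc i) (punchIn j k))

  det-lower-block : ∀ {n} (a : Entries (suc n)) → (∀ j → a zero (suc j) ≡ 0#) →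
    detEntries F a ≡ a zero zero * detEntries F (minor a zero)
  det-lower-block a a₀≡0 = begin
    a zero zero * detEntries F (minor a zero) + - alternating F (λ j → a zero (suc j) * detEntries F (minor a (suc j)))
      ≡⟨ cong (λ x → a zero zero * detEntries F (minor a zero) + - x)
           (alternating-zero λ j → trans (cong (_* detEntries F (minor a (suc j))) (a₀≡0 j)) (zeroˡ _)) ⟩
    a zero zero * detEntries F (minor a zero) + - 0#
      ≡⟨ cong (a zero zero * detEntries F (minor a zero) +_) -0#≈0# ⟩
    a zero zero * detEntries F (minor a zero) + 0#
      ≡⟨ +-identityʳ _ ⟩
    a zero zero * detEntries F (minor a zero) ∎

  -- Induction along the Laplace expansion. In the term for j = i the entry splits and the minor
  -- omits column i; in every other term the entry is shared and column i sits in the minor at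
  -- position `punchOut j≢i`.
  det-linear : ∀ {n} (i : Fin n) (s t : K) (a b c : Entries n) →
    (∀ r k → k ≢ i → a r k ≡ b r k) → (∀ r k → k ≢ i → a r k ≡ c r k) →
    (∀ r → a r i ≡ s * b r i + t * c r i) →
    detEntries F a ≡ s * detEntries F b + t * detEntries F c
  det-linear {suc n} i s t a b c a≡b a≡c a≡b+c =
    trans (alternating-cong term) (alternating-linear s t (λ j → b zero j * B j) (λ j → c zero j * C j))
    where
    B C : Fin (suc n) → K
    B j = detEntries F (minor b j)
    C j = detEntries F (minor c j)

    term : ∀ j → a zero j * detEntries F (minor a j) ≡ s * (b zero j * B j) + t * (c zero j * C j)
    term j with j FinP.≟ i
    ... | yes refl = begin
      a zero j * detEntries F (minor a j)
        ≡⟨ cong (_* detEntries F (minor a j)) (a≡b+c zero) ⟩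
      (s * b zero j + t * c zero j) * detEntries F (minor a j)
        ≡⟨ distribʳ _ (s * b zero j) (t * c zero j) ⟩
      s * b zero j * detEntries F (minor a j) + t * c zero j * detEntries F (minor a j)
        ≡⟨ cong₂ _+_ (cong (s * b zero j *_) (det-cong λ r k → a≡b (suc r) (punchIn j k) (FinP.punchInᵢ≢i j k)))
                     (cong (t * c zero j *_) (det-cong λ r k → a≡c (suc r) (punchIn j k) (FinP.punchInᵢ≢i j k))) ⟩
      s * b zero j * B j + t * c zero j * C j
        ≡⟨ cong₂ _+_ (*-assoc s (b zero j) (B j)) (*-assoc t (c zero j) (C j)) ⟩
      s * (b zero j * B j) + t * (c zero j * C j) ∎
    ... | no j≢i = begin
      a zero j * detEntries F (minor a j)
        ≡⟨ cong (a zero j *_) (det-linear (punchOut j≢i) s t (minor a j) (minor b j) (minor c j)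
             (λ r k k≢ → a≡b (suc r) (punchIn j k) (k≢ ∘ off k))
             (λ r k k≢ → a≡c (suc r) (punchIn j k) (k≢ ∘ off k))
             (λ r → subst (λ k → a (suc r) k ≡ s * b (suc r) k + t * c (suc r) k)
                          (sym (FinP.punchIn-punchOut j≢i)) (a≡b+c (suc r)))) ⟩
      a zero j * (s * B j + t * C j)
        ≡⟨ distribˡ (a zero j) (s * B j) (t * C j) ⟩
      a zero j * (s * B j) + a zero j * (t * C j)
        ≡⟨ cong₂ _+_ (*-CS.x∙yz≈y∙xz (a zero j) s (B j)) (*-CS.x∙yz≈y∙xz (a zero j) t (C j)) ⟩
      s * (a zero j * B j) + t * (a zero j * C j)
        ≡⟨ cong₂ (λ x y → s * (x * B j) + t * (y * C j)) (a≡b zero j j≢i) (a≡c zero j j≢i) ⟩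
      s * (b zero j * B j) + t * (c zero j * C j) ∎
      where
      off : ∀ k → punchIn j k ≡ i → k ≡ punchOut j≢i
      off k eq = FinP.punchIn-injective j k _ (trans eq (sym (FinP.punchIn-punchOut j≢i)))

  -- The minors that omit column i and column i + 1 differ in at most one place, where one reads
  -- column i + 1 and the other column i. If these columns are equal, so are the minors.
  punchIn-adjacent : ∀ {n} (i : Fin n) (k : Fin n) →
    punchIn (inject₁ i) k ≡ punchIn (suc i) k
    ⊎ punchIn (inject₁ i) k ≡ suc i × punchIn (suc i) k ≡ inject₁ i
  punchIn-adjacent zero    zero    = inj₂ (refl , refl)
  punchIn-adjacent zero    (suc k) = inj₁ refl
  punchIn-adjacent (suc i) zero    = inj₁ refl
  punchIn-adjacent (suc i) (suc k) with punchIn-adjacent i k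
  ... | inj₁ eq        = inj₁ (cong suc eq)
  ... | inj₂ (eq , eq′) = inj₂ (cong suc eq , cong suc eq′)

  -- Omitting any third column leaves the two columns adjacent, which keeps the induction in
  -- `det-adjacent` within adjacent pairs.
  punchIn⁻¹-adjacent : ∀ {n} (i : Fin (suc n)) (j : Fin (suc (suc n))) → j ≢ inject₁ i → j ≢ suc i →
    ∃[ k ] punchIn j (inject₁ k) ≡ inject₁ i × punchIn j (suc k) ≡ suc i
  punchIn⁻¹-adjacent         zero    zero          j≢ j≢′ = contradiction refl j≢
  punchIn⁻¹-adjacent         zero    (suc zero)    j≢ j≢′ = contradiction refl j≢′
  punchIn⁻¹-adjacent {suc n} zero    (suc (suc j)) j≢ j≢′ = zero , refl , refl
  punchIn⁻¹-adjacent         (suc i) zero          j≢ j≢′ = i , refl , refl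
  punchIn⁻¹-adjacent {suc n} (suc i) (suc j)       j≢ j≢′
    with punchIn⁻¹-adjacent i j (j≢ ∘ cong suc) (j≢′ ∘ cong suc)
  ... | k , eq , eq′ = suc k , cong suc eq , cong suc eq′

  -- Minors that keep both columns vanish by induction. The two remaining terms have equal entries
  -- and equal minors, and cancel by `alternating-pair`.
  det-adjacent : ∀ {n} (i : Fin n) (a : Entries (suc n)) →
    (∀ r → a r (inject₁ i) ≡ a r (suc i)) → detEntries F a ≡ 0#
  det-adjacent {suc n} i a eq = alternating-pair i _
    (λ j j≢ j≢′ → let k , k≡ , k≡′ = punchIn⁻¹-adjacent i j j≢ j≢′ in
      trans (cong (a zero j *_) (det-adjacent k (minor a j) λ r →
               trans (cong (a (suc r)) k≡) (trans (eq (suc r)) (cong (a (suc r)) (sym k≡′)))))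
            (zeroʳ (a zero j)))
    (cong₂ _*_ (eq zero) (det-cong λ r k →
      [ cong (a (suc r))
      , (λ (k≡ , k≡′) → trans (cong (a (suc r)) k≡) (trans (sym (eq (suc r))) (cong (a (suc r)) (sym k≡′)))) ]′
      (punchIn-adjacent i k)))

  setColumn : ∀ {n} → Fin n → (Fin n → K) → Entries n → Entries n
  setColumn i v a r k with k FinP.≟ i
  ... | yes _ = v r
  ... | no  _ = a r k

  setColumn-at : ∀ {n} (i : Fin n) v (a : Entries n) r → setColumn i v a r i ≡ v r
  setColumn-at i v a r with i FinP.≟ i
  ... | yes _  = refl
  ... | no i≢i = contradiction refl i≢i

  setColumn-off : ∀ {n} (i : Fin n) v (a : Entries n) r {k} → k ≢ i → setColumn i v a r k ≡ a r k
  setColumn-off i v a r {k} k≢i with k FinP.≟ i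
  ... | yes k≡i = contradiction k≡i k≢i
  ... | no  _   = refl

  det-setColumn-+ : ∀ {n} (i : Fin n) (t : K) u v (a : Entries n) →
    detEntries F (setColumn i (λ r → u r + t * v r) a)
      ≡ detEntries F (setColumn i u a) + t * detEntries F (setColumn i v a)
  det-setColumn-+ i t u v a = trans
    (det-linear i 1# t _ _ _
      (λ r k k≢i → trans (setColumn-off i _ a r k≢i) (sym (setColumn-off i u a r k≢i)))
      (λ r k k≢i → trans (setColumn-off i _ a r k≢i) (sym (setColumn-off i v a r k≢i)))
      (λ r → begin
        setColumn i (λ r → u r + t * v r) a r i   ≡⟨ setColumn-at i _ a r ⟩
        u r + t * v r                             ≡⟨ cong₂ _+_ (sym (trans (*-identityˡ _) (setColumn-at i u a r)))
                                                               (cong (t *_) (sym (setColumn-at i v a r))) ⟩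
        1# * setColumn i u a r i + t * setColumn i v a r i ∎))
    (cong (_+ _) (*-identityˡ _))

  det-setColumn-self : ∀ {n} (i : Fin n) (a : Entries n) →
    detEntries F (setColumn i (flip a i) a) ≡ detEntries F a
  det-setColumn-self i a = det-cong λ r k → helper r k
    where
    helper : ∀ r k → setColumn i (flip a i) a r k ≡ a r k
    helper r k with k FinP.≟ i
    ... | yes refl = refl
    ... | no  _    = refl

  IsAlternatingAt : ∀ {n} → Fin n → Fin n → Set
  IsAlternatingAt {n} i j = (a : Entries n) → (∀ r → a r i ≡ a r j) → detEntries F a ≡ 0#

  -- By linearity the change is t times a determinant with two equal columns. Alternation is assumed
  -- for the given pair only, because the adjacent case of this lemma is used to prove alternation
  -- for distant pairs.
  det-addColumn : ∀ {n} (i j : Fin n) → IsAlternatingAt i j → i ≢ j → (t : K) (a : Entries n) →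
    detEntries F (setColumn i (λ r → a r i + t * a r j) a) ≡ detEntries F a
  det-addColumn i j alt i≢j t a = begin
    detEntries F (setColumn i (λ r → a r i + t * a r j) a)
      ≡⟨ det-setColumn-+ i t (flip a i) (flip a j) a ⟩
    detEntries F (setColumn i (flip a i) a) + t * detEntries F (setColumn i (flip a j) a)
      ≡⟨ cong₂ (λ x y → x + t * y) (det-setColumn-self i a)
           (alt _ λ r → trans (setColumn-at i _ a r) (sym (setColumn-off i _ a r (i≢j ∘ sym)))) ⟩
    detEntries F a + t * 0#
      ≡⟨ trans (cong (detEntries F a +_) (zeroʳ t)) (+-identityʳ _) ⟩
    detEntries F a ∎

  alternating-sym : ∀ {n} {i j : Fin n} → IsAlternatingAt i j → IsAlternatingAt j i
  alternating-sym alt a eq = alt a (sym ∘ eq)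

  -- By adjacent column operations, columns (x , y) at (j , j + 1) become (y , - x).
  det-alternating-< : ∀ {n} (i j : Fin (suc n)) → i Fin.< j → IsAlternatingAt i j
  det-alternating-< i = <-weakInduction (λ j → i Fin.< j → IsAlternatingAt i j) (λ ()) step
    where
    step : ∀ j → (i Fin.< inject₁ j → IsAlternatingAt i (inject₁ j)) → i Fin.< suc j → IsAlternatingAt i (suc j)
    step j ih i<1+j a eq with i FinP.≟ inject₁ j
    ... | yes refl = det-adjacent j a eq
    ... | no i≢j   = begin
      detEntries F a    ≡⟨ sym (det-addColumn p p′ (det-adjacent j) p≢p′ 1# a) ⟩
      detEntries F a₁   ≡⟨ sym (det-addColumn p′ p (alternating-sym (det-adjacent j)) (p≢p′ ∘ sym) (- 1#) a₁) ⟩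
      detEntries F a₂   ≡⟨ sym (det-addColumn p p′ (det-adjacent j) p≢p′ 1# a₂) ⟩
      detEntries F a₃   ≡⟨ ih i<j a₃ a₃-col ⟩
      0#                ∎
      where
      p p′ : Fin _
      p  = inject₁ j
      p′ = suc j

      p≢p′ : p ≢ p′
      p≢p′ eq = ℕP.1+n≢n (trans (sym (cong Fin.toℕ eq)) (FinP.toℕ-inject₁ j))

      i<j : i Fin.< p
      i<j = FinP.≤∧≢⇒< (subst (Fin.toℕ i ℕ.≤_) (sym (FinP.toℕ-inject₁ j)) (ℕP.≤-pred i<1+j)) i≢j

      i≢p′ : i ≢ p′
      i≢p′ refl = ℕP.<-irrefl refl i<1+j

      a₁ a₂ a₃ : Entries _
      a₁ = setColumn p  (λ r → a r p + 1# * a r p′) a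
      a₂ = setColumn p′ (λ r → a₁ r p′ + - 1# * a₁ r p) a₁
      a₃ = setColumn p  (λ r → a₂ r p + 1# * a₂ r p′) a₂

      a₃-col : ∀ r → a₃ r i ≡ a₃ r p
      a₃-col r = trans a₃ri (trans (eq r) (sym a₃rp))
        where
        a₃ri : a₃ r i ≡ a r i
        a₃ri = trans (setColumn-off p _ a₂ r i≢j) (trans (setColumn-off p′ _ a₁ r i≢p′) (setColumn-off p _ a r i≢j))

        a₃rp : a₃ r p ≡ a r p′
        a₃rp = begin
          a₃ r p                        ≡⟨ setColumn-at p _ a₂ r ⟩
          a₂ r p + 1# * a₂ r p′         ≡⟨ cong₂ _+_ (setColumn-off p′ _ a₁ r p≢p′) (trans (*-identityˡ _) (setColumn-at p′ _ a₁ r)) ⟩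
          a₁ r p + (a₁ r p′ + - 1# * a₁ r p)
            ≡⟨ cong (a₁ r p +_) (cong₂ _+_ (setColumn-off p _ a r (p≢p′ ∘ sym)) (-1*x≈-x (a₁ r p))) ⟩
          a₁ r p + (a r p′ + - a₁ r p)  ≡⟨ +-CS.x∙yz≈y∙xz (a₁ r p) (a r p′) _ ⟩
          a r p′ + (a₁ r p + - a₁ r p)  ≡⟨ trans (cong (a r p′ +_) (-‿inverseʳ _)) (+-identityʳ _) ⟩
          a r p′                        ∎

  det-alternating : ∀ {n} (i j : Fin n) → i ≢ j → IsAlternatingAt i j
  det-alternating {suc n} i j i≢j with FinP.<-cmp i j
  ... | tri< i<j _ _ = det-alternating-< i j i<j
  ... | tri≈ _ i≡j _ = contradiction i≡j i≢j
  ... | tri> _ _ i>j = alternating-sym (det-alternating-< j i i>j)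

  -- A column operation acts on each row separately. Stated for one row and mapped over the others,
  -- it applies to the first row, to the rows below it and to the full matrix alike.
  addEntry : ∀ {n} (i j : Fin n) → K → Vec K n → Vec K n
  addEntry i j t v = updateAt v i (_+ t * lookup v j)

  addEntry-inverse : ∀ {n} (i j : Fin n) → i ≢ j → ∀ {s t} → s + t ≡ 0# → ∀ v →
    addEntry i j s (addEntry i j t v) ≡ v
  addEntry-inverse i j i≢j {s} {t} s+t≡0 v = begin
    updateAt (addEntry i j t v) i (_+ s * lookup (addEntry i j t v) j)
      ≡⟨ cong (λ x → updateAt (addEntry i j t v) i (_+ s * x)) (VecP.lookup∘updateAt′ j i (i≢j ∘ sym) v) ⟩
    updateAt (updateAt v i (_+ t * lookup v j)) i (_+ s * lookup v j)
      ≡⟨ VecP.updateAt-updateAt i v ⟩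
    updateAt v i (λ x → (x + t * lookup v j) + s * lookup v j)
      ≡⟨ VecP.updateAt-cong i (λ x → begin
           (x + t * lookup v j) + s * lookup v j   ≡⟨ +-assoc x _ _ ⟩
           x + (t * lookup v j + s * lookup v j)   ≡⟨ cong (x +_) (sym (distribʳ (lookup v j) t s)) ⟩
           x + (t + s) * lookup v j                ≡⟨ cong (λ y → x + y * lookup v j) (trans (+-comm t s) s+t≡0) ⟩
           x + 0# * lookup v j                     ≡⟨ trans (cong (x +_) (zeroˡ _)) (+-identityʳ x) ⟩
           x                                       ∎) v ⟩
    updateAt v i id
      ≡⟨ VecP.updateAt-id i v ⟩
    v ∎

  det-addEntry : ∀ {n} (i j : Fin n) → i ≢ j → (t : K) (A : Mat F n) →
    det F (Vec.map (addEntry i j t) A) ≡ det F A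
  det-addEntry i j i≢j t A = trans (det-cong entries)
    (det-addColumn i j (det-alternating i j i≢j) i≢j t (entry F A))
    where
    entries : ∀ r k → entry F (Vec.map (addEntry i j t) A) r k
                    ≡ setColumn i (λ r → entry F A r i + t * entry F A r j) (entry F A) r k
    entries r k with k FinP.≟ i
    ... | yes refl = trans (cong (flip lookup k) (VecP.lookup-map r (addEntry i j t) A)) (VecP.lookup∘updateAt k (lookup A r))
    ... | no k≢i   = trans (cong (flip lookup k) (VecP.lookup-map r (addEntry i j t) A)) (VecP.lookup∘updateAt′ k i k≢i (lookup A r))

  -- Matrix products, inverses and elementary matrices

  open SemiringSum semiring using (sum-cong-≗; sum-replicate-zero; *-distribˡ-sum; *-distribʳ-sum; ∑-comm; ∑-distrib-+)

  sum-zero : ∀ {n} {f : Fin n → K} → (∀ i → f i ≡ 0#) → sum f ≡ 0#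
  sum-zero {n} f≗0 = trans (sum-cong-≗ f≗0) (sum-replicate-zero n)

  sum-point : ∀ {n} (i : Fin n) (f : Fin n → K) → (∀ j → j ≢ i → f j ≡ 0#) → sum f ≡ f i
  sum-point zero    f f≡0 = trans (cong (f zero +_) (sum-zero λ j → f≡0 (suc j) λ ())) (+-identityʳ _)
  sum-point (suc i) f f≡0 =
    trans (cong₂ _+_ (f≡0 zero λ ()) (sum-point i (f ∘ suc) λ j j≢i → f≡0 (suc j) (j≢i ∘ FinP.suc-injective)))
          (+-identityˡ _)

  δ-refl : ∀ {n} (i : Fin n) → δ F i i ≡ 1#
  δ-refl i with i FinP.≟ i
  ... | yes _  = refl
  ... | no i≢i = contradiction refl i≢i

  δ-≢ : ∀ {n} {i j : Fin n} → i ≢ j → δ F i j ≡ 0#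
  δ-≢ {i = i} {j} i≢j with i FinP.≟ j
  ... | yes i≡j = contradiction i≡j i≢j
  ... | no _    = refl

  δ-suc : ∀ {n} (i j : Fin n) → δ F (suc i) (suc j) ≡ δ F i j
  δ-suc i j with i FinP.≟ j
  ... | yes _ = refl
  ... | no  _ = refl

  sum-*-assoc : ∀ {m n} (u : Fin m → K) (b : Fin m → Fin n → K) (v : Fin n → K) →
    sum (λ k → u k * sum λ l → b k l * v l) ≡ sum (λ l → sum (λ k → u k * b k l) * v l)
  sum-*-assoc u b v = begin
    sum (λ k → u k * sum λ l → b k l * v l)
      ≡⟨ sum-cong-≗ (λ k → *-distribˡ-sum (u k) (λ l → b k l * v l)) ⟩
    sum (λ k → sum λ l → u k * (b k l * v l))
      ≡⟨ sum-cong-≗ (λ k → sum-cong-≗ λ l → sym (*-assoc (u k) (b k l) (v l))) ⟩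
    sum (λ k → sum λ l → u k * b k l * v l)
      ≡⟨ ∑-comm (λ k l → u k * b k l * v l) ⟩
    sum (λ l → sum λ k → u k * b k l * v l)
      ≡⟨ sum-cong-≗ (λ l → sym (*-distribʳ-sum (v l) (λ k → u k * b k l))) ⟩
    sum (λ l → sum (λ k → u k * b k l) * v l) ∎

  infix  4 _≗₂_
  infixl 7 _⊛_

  _≗₂_ : ∀ {n} → Entries n → Entries n → Set
  a ≗₂ b = ∀ i j → a i j ≡ b i j

  _⊛_ : ∀ {n} → Entries n → Entries n → Entries n
  (a ⊛ b) i j = sum λ k → a i k * b k j

  ⊛-congʳ : ∀ {n} {a a′ : Entries n} (b : Entries n) → a ≗₂ a′ → a ⊛ b ≗₂ a′ ⊛ b
  ⊛-congʳ b a≗a′ i j = sum-cong-≗ λ k → cong (_* b k j) (a≗a′ i k)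

  ⊛-congˡ : ∀ {n} (a : Entries n) {b b′ : Entries n} → b ≗₂ b′ → a ⊛ b ≗₂ a ⊛ b′
  ⊛-congˡ a b≗b′ i j = sum-cong-≗ λ k → cong (a i k *_) (b≗b′ k j)

  ⊛-assoc : ∀ {n} (a b c : Entries n) → a ⊛ (b ⊛ c) ≗₂ a ⊛ b ⊛ c
  ⊛-assoc a b c i j = sum-*-assoc (a i) b (flip c j)

  ⊛-identityˡ : ∀ {n} (a : Entries n) → δ F ⊛ a ≗₂ a
  ⊛-identityˡ a i j = trans
    (sum-point i _ λ k k≢i → trans (cong (_* a k j) (δ-≢ (k≢i ∘ sym))) (zeroˡ _))
    (trans (cong (_* a i j) (δ-refl i)) (*-identityˡ _))

  -- Inverses are taken up to pointwise equality of entries, so that products can be compared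
  -- without function extensionality; vectors return only in `Invertible`.
  IsInverse : ∀ {n} → Entries n → Entries n → Set
  IsInverse a b = a ⊛ b ≗₂ δ F × b ⊛ a ≗₂ δ F

  HasInverse : ∀ {n} → Entries n → Set
  HasInverse a = ∃[ b ] IsInverse a b

  ⊛-inverse : ∀ {n} (a b a′ b′ : Entries n) → a ⊛ a′ ≗₂ δ F → b ⊛ b′ ≗₂ δ F → a ⊛ b ⊛ (b′ ⊛ a′) ≗₂ δ F
  ⊛-inverse a b a′ b′ aa′ bb′ i j = begin
    (a ⊛ b ⊛ (b′ ⊛ a′)) i j     ≡⟨ ⊛-assoc a b (b′ ⊛ a′) i j ⟨
    (a ⊛ (b ⊛ (b′ ⊛ a′))) i j   ≡⟨ ⊛-congˡ a (⊛-assoc b b′ a′) i j ⟩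
    (a ⊛ (b ⊛ b′ ⊛ a′)) i j     ≡⟨ ⊛-congˡ a (⊛-congʳ a′ bb′) i j ⟩
    (a ⊛ (δ F ⊛ a′)) i j        ≡⟨ ⊛-congˡ a (⊛-identityˡ a′) i j ⟩
    (a ⊛ a′) i j                ≡⟨ aa′ i j ⟩
    δ F i j                     ∎

  ⊛-hasInverse : ∀ {n} (a b : Entries n) → HasInverse a → HasInverse b → HasInverse (a ⊛ b)
  ⊛-hasInverse a b (a′ , aa′ , a′a) (b′ , bb′ , b′b) =
    b′ ⊛ a′ , ⊛-inverse a b a′ b′ aa′ bb′ , ⊛-inverse b′ a′ b a b′b a′a

  hasInverse-cong : ∀ {n} {a b : Entries n} → a ≗₂ b → HasInverse a → HasInverse b
  hasInverse-cong {a = a} {b} a≗b (a′ , aa′ , a′a) = a′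
    , (λ i j → trans (⊛-congʳ a′ (λ i j → sym (a≗b i j)) i j) (aa′ i j))
    , (λ i j → trans (⊛-congˡ a′ (λ i j → sym (a≗b i j)) i j) (a′a i j))

  entry-fromEntries : ∀ {n} (a : Entries n) → entry F (fromEntries F a) ≗₂ a
  entry-fromEntries a i j = trans (cong (flip lookup j) (VecP.lookup∘tabulate _ i)) (VecP.lookup∘tabulate (a i) j)

  fromEntries-cong : ∀ {n} {a b : Entries n} → a ≗₂ b → fromEntries F a ≡ fromEntries F b
  fromEntries-cong a≗b = VecP.tabulate-cong λ i → VecP.tabulate-cong (a≗b i)

  invertible⇒hasInverse : ∀ {n} (A : Mat F n) → Invertible F A → HasInverse (entry F A)
  invertible⇒hasInverse A (B , AB , BA) = entry F B , entries A B AB , entries B A BA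
    where
    entries : ∀ A B → _*ᴹ_ F A B ≡ idMat F → entry F A ⊛ entry F B ≗₂ δ F
    entries A B AB≡1 i j =
      trans (sym (entry-fromEntries (entry F A ⊛ entry F B) i j))
            (trans (cong (λ M → entry F M i j) AB≡1) (entry-fromEntries (δ F) i j))

  hasInverse⇒invertible : ∀ {n} (A : Mat F n) → HasInverse (entry F A) → Invertible F A
  hasInverse⇒invertible A (b , ab , ba) = fromEntries F b
    , fromEntries-cong (λ i j → trans (⊛-congˡ (entry F A) (entry-fromEntries b) i j) (ab i j))
    , fromEntries-cong (λ i j → trans (⊛-congʳ (entry F A) (entry-fromEntries b) i j) (ba i j))

  -- The elementary matrix 1 + t E with E the matrix unit in row j and column i. Multiplication by
  -- it on the right adds t times column j to column i.
  transvection : ∀ {n} → Fin n → Fin n → K → Entries n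
  transvection i j t k l = δ F k l + t * (δ F k j * δ F l i)

  ⊛-transvection : ∀ {n} (i j : Fin n) (t : K) (a : Entries n) (k l : Fin n) →
    (a ⊛ transvection i j t) k l ≡ a k l + t * (a k j * δ F l i)
  ⊛-transvection i j t a k l = begin
    sum (λ m → a k m * (δ F m l + t * (δ F m j * δ F l i)))
      ≡⟨ sum-cong-≗ (λ m → distribˡ (a k m) _ _) ⟩
    sum (λ m → a k m * δ F m l + a k m * (t * (δ F m j * δ F l i)))
      ≡⟨ ∑-distrib-+ (λ m → a k m * δ F m l) (λ m → a k m * (t * (δ F m j * δ F l i))) ⟩
    sum (λ m → a k m * δ F m l) + sum (λ m → a k m * (t * (δ F m j * δ F l i)))
      ≡⟨ cong₂ _+_
           (trans (sum-point l _ λ m m≢l → trans (cong (a k m *_) (δ-≢ m≢l)) (zeroʳ _))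
                  (trans (cong (a k l *_) (δ-refl l)) (*-identityʳ _)))
           (trans (sum-point j _ λ m m≢j → trans (cong (λ x → a k m * (t * (x * δ F l i))) (δ-≢ m≢j))
                    (trans (cong (λ x → a k m * (t * x)) (zeroˡ _)) (trans (cong (a k m *_) (zeroʳ t)) (zeroʳ _))))
                  (trans (cong (λ x → a k j * (t * (x * δ F l i))) (δ-refl j))
                    (trans (cong (λ x → a k j * (t * x)) (*-identityˡ _)) (*-CS.x∙yz≈y∙xz (a k j) t _)))) ⟩
    a k l + t * (a k j * δ F l i) ∎

  -- For i ≠ j the matrix unit squares to zero, so the parameters of a product add up.
  transvection-inverse : ∀ {n} (i j : Fin n) → i ≢ j → ∀ {s t} → s + t ≡ 0# →
    transvection i j s ⊛ transvection i j t ≗₂ δ F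
  transvection-inverse i j i≢j {s} {t} s+t≡0 k l = begin
    (transvection i j s ⊛ transvection i j t) k l
      ≡⟨ ⊛-transvection i j t (transvection i j s) k l ⟩
    (δ F k l + s * e) + t * ((δ F k j + s * (δ F k j * δ F j i)) * δ F l i)
      ≡⟨ cong (λ x → (δ F k l + s * e) + t * (x * δ F l i))
           (trans (cong (δ F k j +_) (trans (cong (λ x → s * (δ F k j * x)) (δ-≢ (i≢j ∘ sym)))
                    (trans (cong (s *_) (zeroʳ _)) (zeroʳ s)))) (+-identityʳ _)) ⟩
    (δ F k l + s * e) + t * e   ≡⟨ +-assoc (δ F k l) (s * e) (t * e) ⟩
    δ F k l + (s * e + t * e)   ≡⟨ cong (δ F k l +_) (sym (distribʳ e s t)) ⟩
    δ F k l + (s + t) * e       ≡⟨ cong (λ x → δ F k l + x * e) s+t≡0 ⟩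
    δ F k l + 0# * e            ≡⟨ trans (cong (δ F k l +_) (zeroˡ e)) (+-identityʳ _) ⟩
    δ F k l                     ∎
    where
    e = δ F k j * δ F l i

  transvection-hasInverse : ∀ {n} (i j : Fin n) → i ≢ j → ∀ t → HasInverse (transvection i j t)
  transvection-hasInverse i j i≢j t = transvection i j (- t)
    , transvection-inverse i j i≢j (-‿inverseʳ t)
    , transvection-inverse i j i≢j (-‿inverseˡ t)

  addEntry-entries : ∀ {n} (i j : Fin n) (t : K) (A : Mat F n) →
    entry F A ⊛ transvection i j t ≗₂ entry F (Vec.map (addEntry i j t) A)
  addEntry-entries i j t A k l = trans (⊛-transvection i j t (entry F A) k l)
    (trans entries (cong (flip lookup l) (sym (VecP.lookup-map k (addEntry i j t) A))))
    where
    v = lookup A k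

    entries : lookup v l + t * (lookup v j * δ F l i) ≡ lookup (addEntry i j t v) l
    entries with l FinP.≟ i
    ... | yes refl = trans (cong (λ x → lookup v l + t * x) (*-identityʳ _)) (sym (VecP.lookup∘updateAt l v))
    ... | no l≢i   = trans (cong (lookup v l +_) (trans (cong (t *_) (zeroʳ _)) (zeroʳ t)))
                       (trans (+-identityʳ _) (sym (VecP.lookup∘updateAt′ l i l≢i v)))

  map-addEntry-inverse : ∀ {m n} (i j : Fin n) → i ≢ j → ∀ {s t} → s + t ≡ 0# → (M : Vec (Vec K n) m) →
    Vec.map (addEntry i j s) (Vec.map (addEntry i j t) M) ≡ M
  map-addEntry-inverse i j i≢j s+t≡0 M = trans (sym (VecP.map-∘ _ _ M))
    (trans (VecP.map-cong (addEntry-inverse i j i≢j s+t≡0) M) (VecP.map-id M))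

  addEntry-invertible : ∀ {n} (i j : Fin n) → i ≢ j → ∀ t (A : Mat F n) →
    Invertible F A → Invertible F (Vec.map (addEntry i j t) A)
  addEntry-invertible i j i≢j t A inv = hasInverse⇒invertible (Vec.map (addEntry i j t) A)
    (hasInverse-cong (addEntry-entries i j t A)
      (⊛-hasInverse (entry F A) (transvection i j t) (invertible⇒hasInverse A inv) (transvection-hasInverse i j i≢j t)))

  addEntry-invertible⁻ : ∀ {n} (i j : Fin n) → i ≢ j → ∀ t (A : Mat F n) →
    Invertible F (Vec.map (addEntry i j t) A) → Invertible F A
  addEntry-invertible⁻ i j i≢j t A inv = subst (Invertible F)
    (map-addEntry-inverse i j i≢j (-‿inverseˡ t) A)
    (addEntry-invertible i j i≢j (- t) (Vec.map (addEntry i j t) A) inv)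

  module _ {n} (a : Entries (suc n)) (a₀≡0 : ∀ j → a zero (suc j) ≡ 0#) where

    -- The first row of a b = 1 reads a₀₀ b₀ⱼ = δ₀ⱼ. Hence a₀₀ is a unit, the inverse b is lower
    -- block triangular too, and the lower right blocks multiply separately.
    lower-block-inverse⁻ : HasInverse a → a zero zero ≢ 0# × HasInverse (minor a zero)
    lower-block-inverse⁻ (b , ab , ba) = a₀₀≢0 , minor b zero , ab′ , ba′
      where
      ab₀ : ∀ j → a zero zero * b zero j ≡ δ F zero j
      ab₀ j = trans (sym (+-identityʳ _)) (trans
        (cong (a zero zero * b zero j +_) (sym (sum-zero λ k → trans (cong (_* b (suc k) j) (a₀≡0 k)) (zeroˡ _))))
        (ab zero j))

      a₀₀≢0 : a zero zero ≢ 0#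
      a₀₀≢0 a≡0 = 0≢1 (trans (sym (trans (cong (_* b zero zero) a≡0) (zeroˡ _))) (ab₀ zero))

      b₀≡0 : ∀ j → b zero (suc j) ≡ 0#
      b₀≡0 j = let c , ac≡1 = inverse (a zero zero) a₀₀≢0 in begin
        b zero (suc j)                       ≡⟨ sym (*-identityˡ _) ⟩
        1# * b zero (suc j)                  ≡⟨ cong (_* b zero (suc j)) (sym (trans (*-comm c _) ac≡1)) ⟩
        c * a zero zero * b zero (suc j)     ≡⟨ *-assoc c _ _ ⟩
        c * (a zero zero * b zero (suc j))   ≡⟨ trans (cong (c *_) (ab₀ (suc j))) (zeroʳ c) ⟩
        0#                                   ∎

      ab′ : minor a zero ⊛ minor b zero ≗₂ δ F
      ab′ i j = trans (sym (+-identityˡ _)) (trans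
        (cong (_+ (minor a zero ⊛ minor b zero) i j) (sym (trans (cong (a (suc i) zero *_) (b₀≡0 j)) (zeroʳ _))))
        (trans (ab (suc i) (suc j)) (δ-suc i j)))

      ba′ : minor b zero ⊛ minor a zero ≗₂ δ F
      ba′ i j = trans (sym (+-identityˡ _)) (trans
        (cong (_+ (minor b zero ⊛ minor a zero) i j) (sym (trans (cong (b (suc i) zero *_) (a₀≡0 j)) (zeroʳ _))))
        (trans (ba (suc i) (suc j)) (δ-suc i j)))

    lower-block-inverse : a zero zero ≢ 0# → HasInverse (minor a zero) → HasInverse a
    lower-block-inverse a₀₀≢0 (d , Dd , dD) = b , ab , ba
      where
      D = minor a zero
      x = a zero zero
      y = proj₁ (inverse x a₀₀≢0)
      xy≡1 : x * y ≡ 1#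
      xy≡1 = proj₂ (inverse x a₀₀≢0)
      c : Fin n → K
      c i = a (suc i) zero
      e : Fin n → K
      e i = sum λ k → d i k * c k

      D*e : ∀ i → sum (λ k → D i k * e k) ≡ c i
      D*e i = begin
        sum (λ k → D i k * e k)       ≡⟨ sum-*-assoc (D i) d c ⟩
        sum (λ l → (D ⊛ d) i l * c l) ≡⟨ sum-cong-≗ (λ l → cong (_* c l) (Dd i l)) ⟩
        sum (λ l → δ F i l * c l)     ≡⟨ ⊛-identityˡ (λ l _ → c l) i i ⟩
        c i                           ∎

      -- The blocks x, 0, c, D of a lead to the blocks 1 / x, 0, - D⁻¹ c / x, D⁻¹ of its inverse.
      b : Entries (suc n)
      b zero    zero    = y
      b zero    (suc j) = 0#
      b (suc i) zero    = e i * - y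
      b (suc i) (suc j) = d i j

      ab : a ⊛ b ≗₂ δ F
      ab zero zero = trans (cong₂ _+_ xy≡1 (sum-zero λ k → trans (cong (_* b (suc k) zero) (a₀≡0 k)) (zeroˡ _))) (+-identityʳ 1#)
      ab zero (suc j) = trans (cong₂ _+_ (zeroʳ x) (sum-zero λ k → trans (cong (_* d k j) (a₀≡0 k)) (zeroˡ _))) (+-identityʳ 0#)
      ab (suc i) zero = begin
        c i * y + sum (λ k → D i k * (e k * - y))
          ≡⟨ cong (c i * y +_) (sum-cong-≗ λ k → sym (*-assoc (D i k) (e k) (- y))) ⟩
        c i * y + sum (λ k → D i k * e k * - y)
          ≡⟨ cong (c i * y +_) (sym (*-distribʳ-sum (- y) (λ k → D i k * e k))) ⟩
        c i * y + sum (λ k → D i k * e k) * - y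
          ≡⟨ cong (λ z → c i * y + z * - y) (D*e i) ⟩
        c i * y + c i * - y
          ≡⟨ sym (distribˡ (c i) y (- y)) ⟩
        c i * (y + - y)
          ≡⟨ trans (cong (c i *_) (-‿inverseʳ y)) (zeroʳ (c i)) ⟩
        0# ∎
      ab (suc i) (suc j) = trans (cong (_+ (D ⊛ d) i j) (zeroʳ (c i)))
        (trans (+-identityˡ _) (trans (Dd i j) (sym (δ-suc i j))))

      ba : b ⊛ a ≗₂ δ F
      ba zero zero = trans (cong₂ _+_ (trans (*-comm y x) xy≡1) (sum-zero λ k → zeroˡ (c k))) (+-identityʳ 1#)
      ba zero (suc j) = trans (cong₂ _+_ (trans (cong (y *_) (a₀≡0 j)) (zeroʳ y)) (sum-zero λ k → zeroˡ (D k j))) (+-identityʳ 0#)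
      ba (suc i) zero = begin
        e i * - y * x + e i           ≡⟨ cong (_+ e i) (*-assoc (e i) (- y) x) ⟩
        e i * (- y * x) + e i         ≡⟨ cong (λ z → e i * z + e i) (trans (sym (-‿distribˡ-* y x)) (cong -_ (trans (*-comm y x) xy≡1))) ⟩
        e i * - 1# + e i              ≡⟨ cong (e i * - 1# +_) (sym (*-identityʳ (e i))) ⟩
        e i * - 1# + e i * 1#         ≡⟨ sym (distribˡ (e i) (- 1#) 1#) ⟩
        e i * (- 1# + 1#)             ≡⟨ trans (cong (e i *_) (-‿inverseˡ 1#)) (zeroʳ (e i)) ⟩
        0#                            ∎
      ba (suc i) (suc j) = trans (cong (_+ (d ⊛ D) i j) (trans (cong (e i * - y *_) (a₀≡0 j)) (zeroʳ _)))
        (trans (+-identityˡ _) (trans (dD i j) (sym (δ-suc i j))))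

  0ᵛ : ∀ {n} → Vec K n
  0ᵛ {n} = replicate n 0#

  lowerBlock : ∀ {n} → K → Vec K n → Mat F n → Mat F (suc n)
  lowerBlock a c D = (a ∷ 0ᵛ) ∷ zipWith _∷_ c D

  module _ {n} (a : K) (c : Vec K n) (D : Mat F n) where
    private
      A = lowerBlock a c D

      first-row : ∀ j → entry F A zero (suc j) ≡ 0#
      first-row j = VecP.lookup-replicate j 0#

      minor-entries : minor (entry F A) zero ≗₂ entry F D
      minor-entries i j = cong (flip lookup (suc j)) (VecP.lookup-zipWith _∷_ i c D)

    det-lowerBlock : det F A ≡ a * det F D
    det-lowerBlock = trans (det-lower-block (entry F A) first-row) (cong (a *_) (det-cong minor-entries))

    tr-lowerBlock : tr F A ≡ a + tr F D
    tr-lowerBlock = cong (a +_) (sum-cong-≗ λ i → minor-entries i i)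

    lowerBlock-invertible⁻ : Invertible F A → a ≢ 0# × Invertible F D
    lowerBlock-invertible⁻ inv =
      let a≢0 , D⁻¹ = lower-block-inverse⁻ (entry F A) first-row (invertible⇒hasInverse A inv)
      in a≢0 , hasInverse⇒invertible D (hasInverse-cong minor-entries D⁻¹)

    lowerBlock-invertible : a ≢ 0# → Invertible F D → Invertible F A
    lowerBlock-invertible a≢0 inv = hasInverse⇒invertible A
      (lower-block-inverse (entry F A) first-row a≢0
        (hasInverse-cong (λ i j → sym (minor-entries i j)) (invertible⇒hasInverse D inv)))

  -- Only the first column changes, and it meets the diagonal in a single entry.
  tr-addEntry : ∀ {n} (k : Fin n) (t : K) (A : Mat F (suc n)) →
    tr F (Vec.map (addEntry zero (suc k) t) A) ≡ tr F A + t * entry F A zero (suc k)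
  tr-addEntry {n} k t A@((a ∷ b) ∷ M) = begin
    (a + t * lookup b k) + sum (λ i → entry F (Vec.map (addEntry zero (suc k) t) A) (suc i) (suc i))
      ≡⟨ cong ((a + t * lookup b k) +_) (sum-cong-≗ diagonal) ⟩
    (a + t * lookup b k) + sum (λ i → entry F A (suc i) (suc i))
      ≡⟨ +-CS.xy∙z≈xz∙y a (t * lookup b k) _ ⟩
    (a + sum (λ i → entry F A (suc i) (suc i))) + t * lookup b k ∎
    where
    diagonal : ∀ (i : Fin n) → entry F (Vec.map (addEntry zero (suc k) t) A) (suc i) (suc i) ≡ entry F A (suc i) (suc i)
    diagonal i = trans (cong (flip lookup (suc i)) (VecP.lookup-map i (addEntry zero (suc k) t) M))
                       (VecP.lookup∘updateAt′ (suc i) zero (λ ()) (lookup M i))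

  -- Reduction of the first row by column operations

  nonzero-entry : ∀ {n} (v : Vec K n) → v ≢ 0ᵛ → ∃[ k ] lookup v k ≢ 0#
  nonzero-entry []      v≢0 = contradiction refl v≢0
  nonzero-entry (x ∷ v) v≢0 with x ≟ 0#
  ... | no x≢0   = zero , x≢0
  ... | yes refl = let k , vk≢0 = nonzero-entry v (v≢0 ∘ cong (0# ∷_)) in suc k , vk≢0

  -- Every vector arises from `0ᵛ` by changes of single entries, and each such change can be undone
  -- by one column operation once a pivot is available.
  vec-induction : ∀ {n} (P : Vec K n → Set) → P 0ᵛ → (∀ v i s → P v → P (updateAt v i (s +_))) → ∀ v → P v
  vec-induction P P0 step []      = P0
  vec-induction P P0 step (x ∷ v) = subst (λ y → P (y ∷ v)) (+-identityʳ x)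
    (step (0# ∷ v) zero x (vec-induction (P ∘ (0# ∷_)) P0 (λ w i s → step (0# ∷ w) (suc i) s) v))

  -- Column operations carry every nonzero row to some (a , 0 , ... , 0) with a ≠ 0. A property that
  -- can be pulled back along them therefore needs a proof only for such rows.
  row-reduction : ∀ {n} (P : Vec K (suc n) → Set) →
    (∀ a → a ≢ 0# → P (a ∷ 0ᵛ)) →
    (∀ i j → i ≢ j → ∀ t r → P (addEntry i j t r) → P r) →
    ∀ r → r ≢ 0ᵛ → P r
  row-reduction {n} P base step = reduce
    where
    pivot : ∀ a → a ≢ 0# → ∀ b → P (a ∷ b)
    pivot a a≢0 = vec-induction (P ∘ (a ∷_)) (base a a≢0) λ v i s Pv →
      let c , ac≡1 = inverse a a≢0 in
      -- The multiple - s / a of the pivot column cancels the s that was added to entry i.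
      step (suc i) zero (λ ()) (- s * c) (a ∷ updateAt v i (s +_))
        (subst (P ∘ (a ∷_)) (sym (begin
          updateAt (updateAt v i (s +_)) i (_+ - s * c * a)
            ≡⟨ VecP.updateAt-updateAt i v ⟩
          updateAt v i (λ x → (s + x) + - s * c * a)
            ≡⟨ VecP.updateAt-cong i (λ x → begin
                 (s + x) + - s * c * a     ≡⟨ cong ((s + x) +_) (trans (*-assoc (- s) c a) (trans (cong (- s *_) (trans (*-comm c a) ac≡1)) (*-identityʳ (- s)))) ⟩
                 (s + x) + - s             ≡⟨ +-CS.xy∙z≈y∙xz s x (- s) ⟩
                 x + (s + - s)             ≡⟨ trans (cong (x +_) (-‿inverseʳ s)) (+-identityʳ x) ⟩
                 x                         ∎) v ⟩
          updateAt v i id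
            ≡⟨ VecP.updateAt-id i v ⟩
          v ∎)) Pv)

    reduce : ∀ r → r ≢ 0ᵛ → P r
    reduce (a ∷ b) r≢0 with a ≟ 0#
    ... | no a≢0   = pivot a a≢0 b
    -- With a zero in front, adding the column of a nonzero entry to the first column creates the
    -- pivot.
    ... | yes refl = let k , bk≢0 = nonzero-entry b (r≢0 ∘ cong (0# ∷_)) in
      step zero (suc k) (λ ()) 1# (0# ∷ b)
        (pivot (0# + 1# * lookup b k) (bk≢0 ∘ trans (sym (trans (+-identityˡ _) (*-identityˡ _)))) b)

  idMat-invertible : ∀ n → Invertible F (idMat F {n})
  idMat-invertible n = hasInverse⇒invertible (idMat F) (hasInverse-cong (λ i j → sym (entry-fromEntries (δ F) i j))
    (δ F , ⊛-identityˡ (δ F) , ⊛-identityˡ (δ F)))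

  invertible⇒row≢0 : ∀ {n} (r : Vec K (suc n)) (M : Vec (Vec K (suc n)) n) → Invertible F (r ∷ M) → r ≢ 0ᵛ
  invertible⇒row≢0 r M inv r≡0 = let b , ab , _ = invertible⇒hasInverse (r ∷ M) inv in
    0≢1 (begin
      0#                               ≡⟨ sum-zero (λ k → trans (cong (_* b k zero) (trans (cong (flip lookup k) r≡0) (VecP.lookup-replicate k 0#))) (zeroˡ _)) ⟨
      sum (λ k → lookup r k * b k zero) ≡⟨ ab zero zero ⟩
      1#                               ∎)

  unzip-columns : ∀ {m n} (M : Vec (Vec K (suc n)) m) → zipWith _∷_ (Vec.map Vec.head M) (Vec.map Vec.tail M) ≡ M
  unzip-columns []            = refl
  unzip-columns ((x ∷ v) ∷ M) = cong ((x ∷ v) ∷_) (unzip-columns M)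

  -- The determinant survives the reduction of the first row to (a , 0 , ... , 0), where it is a
  -- times the determinant of an invertible smaller matrix. This keeps χ away from its junk value.
  det-nonzero : ∀ {n} (A : Mat F n) → Invertible F A → det F A ≢ 0#
  det-nonzero []      inv = 0≢1 ∘ sym
  det-nonzero {suc n} (r ∷ M) inv = row-reduction P base step r (invertible⇒row≢0 r M inv) M inv
    where
    P : Vec K (suc n) → Set
    -- The lower rows are quantified because a column operation changes them together with r.
    P r = ∀ M → Invertible F (r ∷ M) → det F (r ∷ M) ≢ 0#

    base : ∀ a → a ≢ 0# → P (a ∷ 0ᵛ)
    base a a≢0 M = subst (λ M → Invertible F ((a ∷ 0ᵛ) ∷ M) → det F ((a ∷ 0ᵛ) ∷ M) ≢ 0#) (unzip-columns M)
      λ inv → subst (_≢ 0#) (sym (det-lowerBlock a c D))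
        (proj₂ ((a , a≢0) *ᵘ (det F D , det-nonzero D (proj₂ (lowerBlock-invertible⁻ a c D inv)))))
      where
      c = Vec.map Vec.head M
      D = Vec.map Vec.tail M

    step : ∀ i j → i ≢ j → ∀ t r → P (addEntry i j t r) → P r
    step i j i≢j t r Pr M inv = subst (_≢ 0#) (det-addEntry i j i≢j t (r ∷ M))
      (Pr (Vec.map (addEntry i j t) M) (addEntry-invertible i j i≢j t (r ∷ M) inv))

  scaleRow : ∀ {n} → K → Mat F (suc n) → Mat F (suc n)
  scaleRow x (r ∷ M) = Vec.map (x *_) r ∷ M

  det-scaleRow : ∀ {n} (x : K) (A : Mat F (suc n)) → det F (scaleRow x A) ≡ x * det F A
  det-scaleRow {n} x A@(r ∷ M) = begin
    det F (scaleRow x A)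
      ≡⟨ alternating-cong (λ j → trans (cong (_* m j) (VecP.lookup-map j (x *_) r))
           (trans (*-assoc x _ (m j)) (sym (trans (cong (x * (lookup r j * m j) +_) (zeroˡ 0#)) (+-identityʳ _))))) ⟩
    -- The summand 0 * 0 brings the scaled expansion into the two-term form of `alternating-linear`.
    alternating F {suc n} (λ j → x * (lookup r j * m j) + 0# * 0#)
      ≡⟨ alternating-linear {suc n} x 0# (λ j → lookup r j * m j) (λ _ → 0#) ⟩
    x * det F A + 0# * alternating F {suc n} (λ _ → 0#)
      ≡⟨ trans (cong (x * det F A +_) (zeroˡ _)) (+-identityʳ _) ⟩
    x * det F A ∎
    where
    m : Fin (suc n) → K
    m j = detEntries F (minor (entry F A) j)

  -- Scaling the first row is left multiplication by the diagonal matrix with entries x, 1, ..., 1,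
  -- which is itself a lower block matrix.
  scaleRow-invertible : ∀ {n} (x : K) → x ≢ 0# → (A : Mat F (suc n)) → Invertible F A → Invertible F (scaleRow x A)
  scaleRow-invertible {n} x x≢0 A@(r ∷ M) inv = hasInverse⇒invertible (scaleRow x A)
    (hasInverse-cong entries (⊛-hasInverse (entry F E) (entry F A) (invertible⇒hasInverse E E-invertible) (invertible⇒hasInverse A inv)))
    where
    E : Mat F (suc n)
    E = lowerBlock x 0ᵛ (idMat F)

    E-invertible : Invertible F E
    E-invertible = lowerBlock-invertible x 0ᵛ (idMat F) x≢0 (idMat-invertible n)

    entries : entry F E ⊛ entry F A ≗₂ entry F (scaleRow x A)
    entries zero j = begin
      x * lookup r j + sum (λ k → lookup 0ᵛ k * lookup (lookup M k) j)
        ≡⟨ cong (x * lookup r j +_) (sum-zero λ k → trans (cong (_* lookup (lookup M k) j) (VecP.lookup-replicate k 0#)) (zeroˡ _)) ⟩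
      x * lookup r j + 0#
        ≡⟨ +-identityʳ _ ⟩
      x * lookup r j
        ≡⟨ VecP.lookup-map j (x *_) r ⟨
      lookup (Vec.map (x *_) r) j ∎
    entries (suc i) j = begin
      entry F E (suc i) zero * lookup r j + sum (λ k → entry F E (suc i) (suc k) * lookup (lookup M k) j)
        ≡⟨ cong₂ _+_
             (trans (cong (_* lookup r j) (trans (cong (flip lookup zero) row) (VecP.lookup-replicate i 0#))) (zeroˡ _))
             (sum-cong-≗ λ k → cong (_* lookup (lookup M k) j) (trans (cong (flip lookup (suc k)) row) (entry-fromEntries (δ F) i k))) ⟩
      0# + sum (λ k → δ F i k * lookup (lookup M k) j)
        ≡⟨ +-identityˡ _ ⟩
      sum (λ k → δ F i k * lookup (lookup M k) j)
        ≡⟨ trans (sum-point i _ λ k k≢i → trans (cong (_* lookup (lookup M k) j) (δ-≢ (k≢i ∘ sym))) (zeroˡ _))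
             (trans (cong (_* lookup (lookup M i) j) (δ-refl i)) (*-identityˡ _)) ⟩
      lookup (lookup M i) j ∎
      where
      row : lookup (zipWith _∷_ 0ᵛ (idMat F)) i ≡ lookup 0ᵛ i ∷ lookup (idMat F) i
      row = VecP.lookup-zipWith _∷_ i 0ᵛ (idMat F)

  scaleRow-inverse : ∀ {n} {x y : K} → x * y ≡ 1# → (A : Mat F (suc n)) → scaleRow x (scaleRow y A) ≡ A
  scaleRow-inverse {x = x} {y} xy≡1 (r ∷ M) = cong (_∷ M)
    (trans (sym (VecP.map-∘ (x *_) (y *_) r))
      (trans (VecP.map-cong (λ z → trans (sym (*-assoc x y z)) (trans (cong (_* z) xy≡1) (*-identityˡ z))) r) (VecP.map-id r)))

-- Sums over invertible matrices

length-cartesianProductWith : {A B C : Set} (f : A → B → C) (xs : List A) (ys : List B) →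
  length (cartesianProductWith f xs ys) ≡ length xs ℕ.* length ys
length-cartesianProductWith f []       ys = ≡.refl
length-cartesianProductWith f (x ∷ xs) ys = ≡.trans (ListP.length-++ (List.map (f x) ys))
  (≡.cong₂ ℕ._+_ (ListP.length-map (f x) ys) (length-cartesianProductWith f xs ys))

module MatrixSums {q} (F : FiniteField q) (R : CommutativeRing 0ℓ 0ℓ) where
  open FiniteField F using (elements; enumeration; inverse; 0#; 1#; _≟_; Unit; _*ᵘ_; 1ᵘ; toUnit) renaming (Carrier to K; _+_ to _+ᴷ_; _*_ to _*ᴷ_; -_ to -ᴷ_)
  private
    module F = Matrices F
    module K = CommutativeRing (FiniteField.commutativeRing F)
  open F using (0ᵛ; addEntry; lowerBlock; scaleRow)
  open CommutativeRing R hiding (zero) renaming (0# to 0ᴿ; 1# to 1ᴿ)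
  open FiniteSums R
  open SetoidReasoning setoid
  open RingProperties ring using (+-cancelʳ)
  private module *-CS = CommutativeSemigroupProperties *-commutativeSemigroup

  elements-enumeration : IsEnumeration elements
  elements-enumeration = map-enumeration (Inverse.to enumeration) (Inverse.from enumeration)
    (Inverse.strictlyInverseʳ enumeration) (Inverse.strictlyInverseˡ enumeration)
    (enumerates (Unique.allFin⁺ q) ∈-allFin)

  allVecs-enumeration : {A : Set} {xs : List A} → IsEnumeration xs → ∀ n → IsEnumeration (allVecs F xs n)
  allVecs-enumeration {xs = xs} xs! n = enumerates (vecs! n) (∈-allVecs F (complete xs!))
    where
    vecs! : ∀ n → Unique (allVecs F xs n)
    vecs! zero    = [] ∷ []
    vecs! (suc n) = Unique.cartesianProductWith⁺ _∷_ VecP.∷-injective (unique xs!) (vecs! n)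

  vectors : ∀ n → List (Vec K n)
  vectors = allVecs F elements

  vectors-enumeration : ∀ n → IsEnumeration (vectors n)
  vectors-enumeration = allVecs-enumeration elements-enumeration

  lowerRows : ∀ n → List (Vec (Vec K (suc n)) n)
  lowerRows n = allVecs F (vectors (suc n)) n

  lowerRows-enumeration : ∀ n → IsEnumeration (lowerRows n)
  lowerRows-enumeration n = allVecs-enumeration (vectors-enumeration (suc n)) n

  matrices-enumeration : ∀ n → IsEnumeration (matrices F n)
  matrices-enumeration n = allVecs-enumeration (vectors-enumeration n) n

  length-vectors : ∀ n → length (vectors n) ≡ q ^ n
  length-vectors zero    = ≡.refl
  length-vectors (suc n) = ≡.trans (length-cartesianProductWith _∷_ elements (vectors n))
    (≡.cong₂ ℕ._*_ (≡.trans (ListP.length-map _ (allFin q)) (ListP.length-tabulate {n = q} λ i → i)) (length-vectors n))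

  Σ-vectors-const : ∀ n c → Σ⟨ vectors n ⟩ (λ _ → c) ≈ ι (q ^ n) * c
  Σ-vectors-const n c = trans (Σ-const (vectors n) c) (*-congʳ (reflexive (≡.cong ι (length-vectors n))))

  Σ-first-row : ∀ n (f : Mat F (suc n) → Carrier) →
    Σ⟨ matrices F (suc n) ⟩ f ≈ Σ⟨ vectors (suc n) ⟩ λ r → Σ⟨ lowerRows n ⟩ λ M → f (r ∷ M)
  Σ-first-row n = Σ-cartesianProductWith _∷_ (vectors (suc n)) (lowerRows n)

  -- Cutting off the first column of the lower rows is inverse to `zipWith _∷_`. The two
  -- enumerations follow different orders, which the reindexing absorbs.
  Σ-first-column : ∀ n (f : Vec (Vec K (suc n)) n → Carrier) →
    Σ⟨ lowerRows n ⟩ f ≈ Σ⟨ vectors n ⟩ λ c → Σ⟨ matrices F n ⟩ λ D → f (zipWith _∷_ c D)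
  Σ-first-column n f = sym (begin
    (Σ⟨ vectors n ⟩ λ c → Σ⟨ matrices F n ⟩ λ D → f (zipWith _∷_ c D))
      ≈⟨ Σ-cartesianProductWith _,_ (vectors n) (matrices F n) (f ∘ uncurry (zipWith _∷_)) ⟨
    Σ⟨ cartesianProduct (vectors n) (matrices F n) ⟩ (f ∘ uncurry (zipWith _∷_))
      ≈⟨ Σ-reindex (uncurry (zipWith _∷_)) (λ M → Vec.map Vec.head M , Vec.map Vec.tail M)
           (λ (c , D) → ≡.cong₂ _,_ (heads c D) (tails c D)) F.unzip-columns
           pairs (lowerRows-enumeration n) f ⟩
    Σ⟨ lowerRows n ⟩ f ∎)
    where
    heads : ∀ {m p} (c : Vec K m) (D : Vec (Vec K p) m) → Vec.map Vec.head (zipWith _∷_ c D) ≡ c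
    heads []      []      = ≡.refl
    heads (x ∷ c) (v ∷ D) = ≡.cong (x ∷_) (heads c D)

    tails : ∀ {m p} (c : Vec K m) (D : Vec (Vec K p) m) → Vec.map Vec.tail (zipWith _∷_ c D) ≡ D
    tails []      []      = ≡.refl
    tails (x ∷ c) (v ∷ D) = ≡.cong (v ∷_) (tails c D)

    pairs : IsEnumeration (cartesianProduct (vectors n) (matrices F n))
    pairs = enumerates
      (Unique.cartesianProduct⁺ (unique (vectors-enumeration n)) (unique (matrices-enumeration n)))
      (λ (c , D) → ∈-cartesianProduct⁺ (complete (vectors-enumeration n) c)
                                        (complete (matrices-enumeration n) D))

  Σ-addEntry : ∀ {m n} (i j : Fin n) → i ≢ j → (t : K) (f : Vec (Vec K n) m → Carrier) →
    Σ⟨ allVecs F (vectors n) m ⟩ (f ∘ Vec.map (addEntry i j t)) ≈ Σ⟨ allVecs F (vectors n) m ⟩ f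
  Σ-addEntry {m} {n} i j i≢j t = Σ-reindex (Vec.map (addEntry i j t)) (Vec.map (addEntry i j (-ᴷ t)))
    (F.map-addEntry-inverse i j i≢j (K.-‿inverseˡ t)) (F.map-addEntry-inverse i j i≢j (K.-‿inverseʳ t))
    rows! rows!
    where
    rows! = allVecs-enumeration (vectors-enumeration n) m

  -- The order of GL(n,q) as an element of R, in a form that can be summed row by row.
  order : ℕ → Carrier
  order n = Σ⟨ matrices F n ⟩ λ A → [ invertible? F A ] 1ᴿ

  order≈length : ∀ n → order n ≈ ι (length (GL F n))
  order≈length n = begin
    order n                          ≈⟨ Σ-filter (invertible? F) (matrices F n) (λ _ → 1ᴿ) ⟨
    Σ⟨ GL F n ⟩ (λ _ → 1ᴿ)           ≈⟨ Σ-const (GL F n) 1ᴿ ⟩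
    ι (length (GL F n)) * 1ᴿ         ≈⟨ *-identityʳ _ ⟩
    ι (length (GL F n))              ∎

  order-zero : order 0 ≈ 1ᴿ
  order-zero = trans (+-identityʳ _) (reflexive ([]-yes (invertible? F []) (F.idMat-invertible 0)))

  rowCount : ∀ n → Vec K (suc n) → Carrier
  rowCount n r = Σ⟨ lowerRows n ⟩ λ M → [ invertible? F (r ∷ M) ] 1ᴿ

  -- A column operation permutes the possible lower rows and preserves invertibility, so the count
  -- is unchanged by row reduction. Below (a , 0 , ... , 0) the first column is free, which gives q
  -- ^ n choices, and the rest must be invertible.
  rowCount-≢0 : ∀ {n} (r : Vec K (suc n)) → r ≢ 0ᵛ → rowCount n r ≈ ι (q ^ n) * order n
  rowCount-≢0 {n} = F.row-reduction (λ r → rowCount n r ≈ ι (q ^ n) * order n) base step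
    where
    base : ∀ a → a ≢ 0# → rowCount n (a ∷ 0ᵛ) ≈ ι (q ^ n) * order n
    base a a≢0 = begin
      rowCount n (a ∷ 0ᵛ)
        ≈⟨ Σ-first-column n (λ M → [ invertible? F ((a ∷ 0ᵛ) ∷ M) ] 1ᴿ) ⟩
      (Σ⟨ vectors n ⟩ λ c → Σ⟨ matrices F n ⟩ λ D → [ invertible? F (lowerBlock a c D) ] 1ᴿ)
        ≈⟨ Σ-cong (vectors n) (λ c → Σ-cong (matrices F n) λ D →
             []-cong (invertible? F (lowerBlock a c D)) (invertible? F D)
               (proj₂ ∘ F.lowerBlock-invertible⁻ a c D) (F.lowerBlock-invertible a c D a≢0) (λ _ → refl)) ⟩
      Σ⟨ vectors n ⟩ (λ _ → order n)
        ≈⟨ Σ-vectors-const n (order n) ⟩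
      ι (q ^ n) * order n ∎

    step : ∀ i j → i ≢ j → ∀ t r → rowCount n (addEntry i j t r) ≈ ι (q ^ n) * order n → rowCount n r ≈ ι (q ^ n) * order n
    step i j i≢j t r = trans (begin
      rowCount n r
        ≈⟨ Σ-cong (lowerRows n) (λ M → []-cong (invertible? F (r ∷ M)) (invertible? F (Vec.map (addEntry i j t) (r ∷ M)))
             (F.addEntry-invertible i j i≢j t (r ∷ M)) (F.addEntry-invertible⁻ i j i≢j t (r ∷ M)) (λ _ → refl)) ⟩
      Σ⟨ lowerRows n ⟩ (λ M → [ invertible? F (Vec.map (addEntry i j t) (r ∷ M)) ] 1ᴿ)
        ≈⟨ Σ-addEntry i j i≢j t (λ M → [ invertible? F (addEntry i j t r ∷ M) ] 1ᴿ) ⟩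
      rowCount n (addEntry i j t r) ∎)

  -- All nonzero first rows occur equally often; the second summand on the left is the
  -- same number for the zero row, which does not occur.
  order-suc : ∀ n → order (suc n) + ι (q ^ n) * order n ≈ ι (q ^ suc n) * (ι (q ^ n) * order n)
  order-suc n = begin
    order (suc n) + c
      ≈⟨ +-cong (Σ-first-row n _) (sym point) ⟩
    Σ⟨ vectors (suc n) ⟩ (rowCount n) + Σ⟨ vectors (suc n) ⟩ (λ r → [ r ≟0 ] c)
      ≈⟨ Σ-+ (vectors (suc n)) (rowCount n) (λ r → [ r ≟0 ] c) ⟩
    Σ⟨ vectors (suc n) ⟩ (λ r → rowCount n r + [ r ≟0 ] c)
      ≈⟨ Σ-cong (vectors (suc n)) total ⟩
    Σ⟨ vectors (suc n) ⟩ (λ _ → c)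
      ≈⟨ Σ-vectors-const (suc n) c ⟩
    ι (q ^ suc n) * c ∎
    where
    c = ι (q ^ n) * order n

    _≟0 : (r : Vec K (suc n)) → Dec (r ≡ 0ᵛ)
    r ≟0 = VecP.≡-dec _≟_ r 0ᵛ

    point : Σ⟨ vectors (suc n) ⟩ (λ r → [ r ≟0 ] c) ≈ c
    point = trans (Σ-point (vectors-enumeration (suc n)) 0ᵛ _ λ r r≢0 → reflexive ([]-no (r ≟0) r≢0))
      (reflexive ([]-yes (0ᵛ ≟0) ≡.refl))

    total : ∀ r → rowCount n r + [ r ≟0 ] c ≈ c
    total r with r ≟0
    ... | yes r≡0 = trans (+-congʳ (Σ-zero (lowerRows n) λ M _ → reflexive
                      ([]-no (invertible? F (r ∷ M)) λ inv → F.invertible⇒row≢0 r M inv r≡0))) (+-identityˡ c)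
    ... | no r≢0  = trans (+-identityʳ _) (rowCount-≢0 r r≢0)

  -- Character sums over invertible matrices

  module Characters
    (χ : Unit → Carrier) (χ-* : ∀ x y → χ (x *ᵘ y) ≈ χ x * χ y) (χ-1 : χ 1ᵘ ≈ 1ᴿ)
    (X : K → Carrier) (X-0 : X 0# ≈ 0ᴿ) (X-unit : ∀ a a≢0 → X a ≈ χ (a , a≢0))
    (ψ : K → Carrier) (ψ-+ : ∀ a b → ψ (a +ᴷ b) ≈ ψ a * ψ b) (ψ-0 : ψ 0# ≈ 1ᴿ)
    where

    X-1 : X 1# ≈ 1ᴿ
    X-1 = trans (X-unit 1# (proj₂ 1ᵘ)) χ-1

    -- The value 0 at 0 makes the extension X of χ multiplicative on the whole field, so that
    -- determinants can be factored before anything is known about their invertibility.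
    X-* : ∀ a b → X (a *ᴷ b) ≈ X a * X b
    X-* a b with a ≟ 0# | b ≟ 0#
    ... | yes ≡.refl | _ = trans (reflexive (≡.cong X (K.zeroˡ b))) (trans X-0 (sym (trans (*-congʳ X-0) (zeroˡ _))))
    ... | no _ | yes ≡.refl = trans (reflexive (≡.cong X (K.zeroʳ a))) (trans X-0 (sym (trans (*-congˡ X-0) (zeroʳ _))))
    ... | no a≢0 | no b≢0 = begin
      X (a *ᴷ b)                      ≈⟨ X-unit (a *ᴷ b) (proj₂ ((a , a≢0) *ᵘ (b , b≢0))) ⟩
      χ ((a , a≢0) *ᵘ (b , b≢0))      ≈⟨ χ-* (a , a≢0) (b , b≢0) ⟩
      χ (a , a≢0) * χ (b , b≢0)       ≈⟨ *-cong (X-unit a a≢0) (X-unit b b≢0) ⟨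
      X a * X b                       ∎

    value : ∀ {n} → Mat F n → Carrier
    value A = X (det F A) * ψ (tr F A)

    total : ℕ → Carrier
    total n = Σ⟨ matrices F n ⟩ λ A → [ invertible? F A ] value A

    -- As X vanishes at 0, the Gauss sum may run over the whole field, like the corner entry of a
    -- matrix.
    gauss : Carrier
    gauss = Σ⟨ elements ⟩ λ a → X a * ψ a

    Σ-units : (xs : List K) → Σ⟨ mapMaybe toUnit xs ⟩ (λ x → χ x * ψ (proj₁ x)) ≈ Σ⟨ xs ⟩ (λ a → X a * ψ a)
    Σ-units []       = refl
    Σ-units (a ∷ xs) with a ≟ 0#
    ... | yes ≡.refl = trans (Σ-units xs) (sym (trans (+-congʳ (trans (*-congʳ X-0) (zeroˡ _))) (+-identityˡ _)))
    ... | no a≢0     = +-cong (*-congʳ (sym (X-unit a a≢0))) (Σ-units xs)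

    total≈Σ-GL : ∀ n → Σ⟨ GL F n ⟩ value ≈ total n
    total≈Σ-GL n = Σ-filter (invertible? F) (matrices F n) value

    total-zero : total 0 ≈ 1ᴿ
    total-zero = trans (+-identityʳ _) (trans (reflexive ([]-yes (invertible? F []) (F.idMat-invertible 0)))
      (trans (*-cong X-1 ψ-0) (*-identityˡ 1ᴿ)))

    -- The determinant splits into a product and the trace into a sum. For a = 0 the matrix is
    -- singular while X a vanishes, so the identity is valid for every a and can be summed.
    value-lowerBlock : ∀ {n} a (c : Vec K n) D →
      [ invertible? F (lowerBlock a c D) ] value (lowerBlock a c D) ≈ X a * ψ a * [ invertible? F D ] value D
    value-lowerBlock a c D with a ≟ 0#
    ... | no a≢0 = begin
      [ invertible? F A ] value A
        ≈⟨ []-cong (invertible? F A) (invertible? F D)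
             (proj₂ ∘ F.lowerBlock-invertible⁻ a c D) (F.lowerBlock-invertible a c D a≢0) (λ _ → begin
             X (det F A) * ψ (tr F A)
               ≈⟨ *-cong (trans (reflexive (≡.cong X (F.det-lowerBlock a c D))) (X-* a (det F D)))
                         (trans (reflexive (≡.cong ψ (F.tr-lowerBlock a c D))) (ψ-+ a (tr F D))) ⟩
             X a * X (det F D) * (ψ a * ψ (tr F D))
               ≈⟨ *-CS.interchange (X a) _ (ψ a) _ ⟩
             X a * ψ a * value D ∎) ⟩
      [ invertible? F D ] (X a * ψ a * value D)
        ≈⟨ []-*ˡ (invertible? F D) (X a * ψ a) (value D) ⟨
      X a * ψ a * [ invertible? F D ] value D ∎
      where
      A = lowerBlock a c D
    ... | yes ≡.refl = begin
      [ invertible? F A ] value A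
        ≈⟨ reflexive ([]-no (invertible? F A) λ inv → proj₁ (F.lowerBlock-invertible⁻ 0# c D inv) ≡.refl) ⟩
      0ᴿ
        ≈⟨ trans (*-congʳ (trans (*-congʳ X-0) (zeroˡ _))) (zeroˡ _) ⟨
      X 0# * ψ 0# * [ invertible? F D ] value D ∎
      where
      A = lowerBlock 0# c D

    -- This form of nontriviality asks for no particular x with ψ x different from 1;
    -- `nontrivial-cancel` provides it for complex characters.
    module _ (ψ-nontrivial : ∀ z → (∀ x → ψ x * z ≈ z) → z ≈ 0ᴿ) where

      -- The corner entry a is summed together with the lower rows, since adding to the first column
      -- changes it as well; only b stays fixed.
      firstRowTotal : ∀ n → Vec K n → Carrier
      firstRowTotal n b = Σ⟨ elements ⟩ λ a → Σ⟨ lowerRows n ⟩ λ M → [ invertible? F ((a ∷ b) ∷ M) ] value ((a ∷ b) ∷ M)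

      -- Adding a multiple of column k + 1 to the first column fixes the determinant and
      -- moves the trace by an arbitrary amount.
      firstRowTotal-≢0 : ∀ {n} (b : Vec K n) → b ≢ 0ᵛ → firstRowTotal n b ≈ 0ᴿ
      firstRowTotal-≢0 {n} b b≢0 = ψ-nontrivial (firstRowTotal n b) invariant
        where
        k = proj₁ (F.nonzero-entry b b≢0)
        bₖ⁻¹ = inverse (lookup b k) (proj₂ (F.nonzero-entry b b≢0))

        w : Mat F (suc n) → Carrier
        w A = [ invertible? F A ] value A

        invariant : ∀ x → ψ x * firstRowTotal n b ≈ firstRowTotal n b
        invariant x = begin
          ψ x * firstRowTotal n b
            ≈⟨ trans (Σ-*ˡ elements (ψ x) _) (Σ-cong elements λ a → Σ-*ˡ (lowerRows n) (ψ x) _) ⟩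
          (Σ⟨ elements ⟩ λ a → Σ⟨ lowerRows n ⟩ λ M → ψ x * w ((a ∷ b) ∷ M))
            ≈⟨ Σ-cong elements (λ a → Σ-cong (lowerRows n) λ M → shift a M) ⟩
          (Σ⟨ elements ⟩ λ a → Σ⟨ lowerRows n ⟩ λ M → w (Vec.map op ((a ∷ b) ∷ M)))
            ≈⟨ Σ-cong elements (λ a → Σ-addEntry zero (suc k) (λ ()) t (λ M → w ((a +ᴷ t *ᴷ lookup b k ∷ b) ∷ M))) ⟩
          (Σ⟨ elements ⟩ λ a → Σ⟨ lowerRows n ⟩ λ M → w ((a +ᴷ t *ᴷ lookup b k ∷ b) ∷ M))
            ≈⟨ Σ-reindex (_+ᴷ t *ᴷ lookup b k) (_+ᴷ -ᴷ (t *ᴷ lookup b k))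
                 (λ a → ≡.trans (K.+-assoc a _ _) (≡.trans (≡.cong (a +ᴷ_) (K.-‿inverseʳ _)) (K.+-identityʳ a)))
                 (λ a → ≡.trans (K.+-assoc a _ _) (≡.trans (≡.cong (a +ᴷ_) (K.-‿inverseˡ _)) (K.+-identityʳ a)))
                 elements-enumeration elements-enumeration (λ a → Σ⟨ lowerRows n ⟩ λ M → w ((a ∷ b) ∷ M)) ⟩
          firstRowTotal n b ∎
          where
          t = x *ᴷ proj₁ bₖ⁻¹
          op = addEntry zero (suc k) t

          t*bₖ≡x : t *ᴷ lookup b k ≡ x
          t*bₖ≡x = ≡.trans (K.*-assoc x _ _) (≡.trans (≡.cong (x *ᴷ_) (≡.trans (K.*-comm _ _) (proj₂ bₖ⁻¹))) (K.*-identityʳ x))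

          shift : ∀ a M → ψ x * w ((a ∷ b) ∷ M) ≈ w (Vec.map op ((a ∷ b) ∷ M))
          shift a M = trans ([]-*ˡ (invertible? F A) (ψ x) (value A))
            ([]-cong (invertible? F A) (invertible? F (Vec.map op A))
              (F.addEntry-invertible zero (suc k) (λ ()) t A) (F.addEntry-invertible⁻ zero (suc k) (λ ()) t A)
              λ _ → begin
              ψ x * (X (det F A) * ψ (tr F A))    ≈⟨ *-CS.x∙yz≈y∙xz (ψ x) _ _ ⟩
              X (det F A) * (ψ x * ψ (tr F A))    ≈⟨ *-cong (reflexive (≡.cong X (F.det-addEntry zero (suc k) (λ ()) t A)))
                                                      (trans (reflexive (≡.cong ψ (F.tr-addEntry k t A)))
                                                      (trans (ψ-+ _ _) (trans (*-comm _ _) (*-congʳ (reflexive (≡.cong ψ t*bₖ≡x)))))) ⟨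
              value (Vec.map op A)                ∎)
            where
            A = (a ∷ b) ∷ M

      -- After only b = 0 survives, the three parts of the matrix separate: the corner entry sums to
      -- the Gauss sum, the free column below it counts q ^ n, and the lower right block gives the
      -- smaller total.
      total-suc : ∀ n → total (suc n) ≈ ι (q ^ n) * (gauss * total n)
      total-suc n = begin
        total (suc n)
          ≈⟨ Σ-first-row n _ ⟩
        (Σ⟨ vectors (suc n) ⟩ λ r → Σ⟨ lowerRows n ⟩ λ M → w (r ∷ M))
          ≈⟨ Σ-cartesianProductWith _∷_ elements (vectors n) _ ⟩
        (Σ⟨ elements ⟩ λ a → Σ⟨ vectors n ⟩ λ b → Σ⟨ lowerRows n ⟩ λ M → w ((a ∷ b) ∷ M))
          ≈⟨ Σ-comm elements (vectors n) _ ⟩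
        Σ⟨ vectors n ⟩ (firstRowTotal n)
          ≈⟨ Σ-point (vectors-enumeration n) 0ᵛ (firstRowTotal n) firstRowTotal-≢0 ⟩
        firstRowTotal n 0ᵛ
          ≈⟨ Σ-cong elements (λ a → Σ-first-column n λ M → w ((a ∷ 0ᵛ) ∷ M)) ⟩
        (Σ⟨ elements ⟩ λ a → Σ⟨ vectors n ⟩ λ c → Σ⟨ matrices F n ⟩ λ D → w (lowerBlock a c D))
          ≈⟨ Σ-cong elements (λ a → Σ-cong (vectors n) λ c →
               trans (Σ-cong (matrices F n) (value-lowerBlock a c)) (sym (Σ-*ˡ (matrices F n) (X a * ψ a) w))) ⟩
        (Σ⟨ elements ⟩ λ a → Σ⟨ vectors n ⟩ λ c → X a * ψ a * total n)
          ≈⟨ Σ-cong elements (λ a → Σ-vectors-const n (X a * ψ a * total n)) ⟩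
        (Σ⟨ elements ⟩ λ a → ι (q ^ n) * (X a * ψ a * total n))
          ≈⟨ Σ-*ˡ elements (ι (q ^ n)) _ ⟨
        ι (q ^ n) * Σ⟨ elements ⟩ (λ a → X a * ψ a * total n)
          ≈⟨ *-congˡ (Σ-*ʳ elements (λ a → X a * ψ a) (total n)) ⟨
        ι (q ^ n) * (gauss * total n) ∎
        where
        w : ∀ {m} → Mat F m → Carrier
        w A = [ invertible? F A ] value A

      -- The factor q ^ n in `total-suc` cancels against the one in the order of the group. The
      -- reciprocals r and r′ are known only by their defining equations, and D stands for q ^ (n +
      -- 1) - 1.
      coefficient-suc : ∀ n {c c′ r r′ G D} →
        c ≈ r * total n → c′ ≈ r′ * total (suc n) → G ≈ gauss →
        r * order n ≈ 1ᴿ → r′ * order (suc n) ≈ 1ᴿ → D + 1ᴿ ≈ ι (q ^ suc n) → c * G ≈ c′ * D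
      coefficient-suc n {c} {c′} {r} {r′} {G} {D} c≈ c′≈ G≈ r*order r′*order D+1≈ = sym (begin
        c′ * D                                        ≈⟨ *-congʳ (trans c′≈ (*-congˡ (total-suc n))) ⟩
        r′ * (A * (gauss * total n)) * D              ≈⟨ *-congʳ (*-assoc r′ A (gauss * total n)) ⟨
        r′ * A * (gauss * total n) * D                ≈⟨ *-CS.xy∙z≈xz∙y (r′ * A) (gauss * total n) D ⟩
        r′ * A * D * (gauss * total n)                ≈⟨ *-cong ratio (*-comm gauss (total n)) ⟩
        r * (total n * gauss)                         ≈⟨ *-assoc r (total n) gauss ⟨
        r * total n * gauss                           ≈⟨ *-cong c≈ G≈ ⟨
        c * G                                         ∎)
        where
        A = ι (q ^ n)

        order′ : order (suc n) ≈ D * (A * order n)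
        order′ = +-cancelʳ (A * order n) _ _ (begin
          order (suc n) + A * order n                 ≈⟨ order-suc n ⟩
          ι (q ^ suc n) * (A * order n)               ≈⟨ *-congʳ D+1≈ ⟨
          (D + 1ᴿ) * (A * order n)                    ≈⟨ distribʳ (A * order n) D 1ᴿ ⟩
          D * (A * order n) + 1ᴿ * (A * order n)      ≈⟨ +-congˡ (*-identityˡ (A * order n)) ⟩
          D * (A * order n) + A * order n             ∎)

        ratio : r′ * A * D ≈ r
        ratio = begin
          r′ * A * D                                  ≈⟨ *-identityʳ (r′ * A * D) ⟨
          r′ * A * D * 1ᴿ                             ≈⟨ *-congˡ (trans (*-comm (order n) r) r*order) ⟨
          r′ * A * D * (order n * r)                  ≈⟨ *-assoc (r′ * A * D) (order n) r ⟨
          r′ * A * D * order n * r                    ≈⟨ *-congʳ (*-assoc (r′ * A) D (order n)) ⟩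
          r′ * A * (D * order n) * r                  ≈⟨ *-congʳ (*-assoc r′ A (D * order n)) ⟩
          r′ * (A * (D * order n)) * r                ≈⟨ *-congʳ (*-congˡ (*-CS.x∙yz≈y∙xz A D (order n))) ⟩
          r′ * (D * (A * order n)) * r                ≈⟨ *-congʳ (*-congˡ order′) ⟨
          r′ * order (suc n) * r                      ≈⟨ *-congʳ r′*order ⟩
          1ᴿ * r                                      ≈⟨ *-identityˡ r ⟩
          r                                           ∎

    total-trivial : (∀ a → a ≢ 0# → X a ≈ 1ᴿ) → (∀ a → ψ a ≈ 1ᴿ) → ∀ n → total n ≈ order n
    total-trivial X≈1 ψ≈1 n = Σ-cong (matrices F n) λ A → []-cong (invertible? F A) (invertible? F A)
      (λ inv → inv) (λ inv → inv)
      λ inv → trans (*-cong (X≈1 (det F A) (F.det-nonzero A inv)) (ψ≈1 (tr F A))) (*-identityˡ 1ᴿ)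

    -- Scaling the first row by x permutes the invertible matrices and multiplies determinants by x.
    -- It may change the trace, to which the trivial ψ is insensitive.
    total-invariant : (∀ a → ψ a ≈ 1ᴿ) → ∀ n x → x ≢ 0# → X x * total (suc n) ≈ total (suc n)
    total-invariant ψ≈1 n x x≢0 = begin
      X x * total (suc n)
        ≈⟨ Σ-*ˡ (matrices F (suc n)) (X x) w ⟩
      Σ⟨ matrices F (suc n) ⟩ (λ A → X x * w A)
        ≈⟨ Σ-cong (matrices F (suc n)) (λ A → trans ([]-*ˡ (invertible? F A) (X x) (value A))
             ([]-cong (invertible? F A) (invertible? F (scaleRow x A))
               (F.scaleRow-invertible x x≢0 A)
               (≡.subst (Invertible F) (F.scaleRow-inverse (≡.trans (K.*-comm y x) xy≡1) A) ∘ F.scaleRow-invertible y y≢0 (scaleRow x A))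
               λ _ → begin
               X x * (X (det F A) * ψ (tr F A))   ≈⟨ *-assoc _ _ _ ⟨
               X x * X (det F A) * ψ (tr F A)     ≈⟨ *-cong (X-* x (det F A)) (trans (ψ≈1 _) (sym (ψ≈1 _))) ⟨
               X (x *ᴷ det F A) * ψ (tr F (scaleRow x A)) ≈⟨ *-congʳ (reflexive (≡.cong X (F.det-scaleRow x A))) ⟨
               value (scaleRow x A)               ∎)) ⟩
      Σ⟨ matrices F (suc n) ⟩ (w ∘ scaleRow x)
        ≈⟨ Σ-reindex (scaleRow x) (scaleRow y)
             (F.scaleRow-inverse (≡.trans (K.*-comm y x) xy≡1)) (F.scaleRow-inverse xy≡1)
             (matrices-enumeration (suc n)) (matrices-enumeration (suc n)) w ⟩
      total (suc n) ∎
      where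
      w : Mat F (suc n) → Carrier
      w A = [ invertible? F A ] value A

      y = proj₁ (inverse x x≢0)

      xy≡1 : x *ᴷ y ≡ 1#
      xy≡1 = proj₂ (inverse x x≢0)

      y≢0 : y ≢ 0#
      y≢0 y≡0 = FiniteField.0≢1 F (≡.trans (≡.sym (K.zeroʳ x)) (≡.trans (≡.cong (x *ᴷ_) (≡.sym y≡0)) xy≡1))

    total-vanishes : (∀ a → ψ a ≈ 1ᴿ) → (∀ z → (∀ x → χ x * z ≈ z) → z ≈ 0ᴿ) → ∀ n → total (suc n) ≈ 0ᴿ
    total-vanishes ψ≈1 χ-nontrivial n = χ-nontrivial (total (suc n)) λ (x , x≢0) →
      trans (*-congʳ (sym (X-unit x x≢0))) (total-invariant ψ≈1 n x x≢0)

open ℤ using (+_; -[1+_])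
open ≡ using (refl; sym; trans; cong; cong₂; subst; subst₂)

-- Real and complex numbers

eventually-× : {P Q : ℕ → Set} → Eventually P → Eventually Q → Eventually (λ n → P n × Q n)
eventually-× (M , p) (N , q) = M ℕ.⊔ N , λ n n≥ → p n (ℕP.m⊔n≤o⇒m≤o M N n≥) , q n (ℕP.m⊔n≤o⇒n≤o M N n≥)

eventually-map : {P Q : ℕ → Set} → (∀ n → P n → Q n) → Eventually P → Eventually Q
eventually-map f (N , p) = N , λ n n≥ → f n (p n n≥)

≈ᴿ-pointwise : ∀ {x y} → (∀ n → seq x n ≡ seq y n) → x ≈ᴿ y
≈ᴿ-pointwise {x} {y} x≗y ε ε>0 = 0 , λ n _ →
  subst (ℚ._< ε) (sym (cong ℚ.∣_∣ (trans (cong (ℚ._- seq y n) (x≗y n)) (ℚP.+-inverseʳ (seq y n))))) ε>0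

≈ᴿ-refl : ∀ {x} → x ≈ᴿ x
≈ᴿ-refl {x} = ≈ᴿ-pointwise {x} {x} λ _ → refl

≈ᴿ-sym : ∀ {x y} → x ≈ᴿ y → y ≈ᴿ x
≈ᴿ-sym {x} {y} x≈y ε ε>0 = eventually-map
  (λ n → subst (ℚ._< ε) (trans (sym (ℚP.∣-p∣≡∣p∣ _)) (cong ℚ.∣_∣ (+-*-Solver.solve 2
    (λ a b → :- (a :- b) := b :- a) refl (seq x n) (seq y n))))) (x≈y ε ε>0)
  where open +-*-Solver

half-bound : ∀ {a b c ε} → a ≡ b ℚ.+ c → ℚ.∣ b ∣ ℚ.< ½ ℚ.* ε → ℚ.∣ c ∣ ℚ.< ½ ℚ.* ε → ℚ.∣ a ∣ ℚ.< ε
half-bound {a} {b} {c} {ε} a≡b+c b< c< = begin-strict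
  ℚ.∣ a ∣                  ≡⟨ cong ℚ.∣_∣ a≡b+c ⟩
  ℚ.∣ b ℚ.+ c ∣            ≤⟨ ℚP.∣p+q∣≤∣p∣+∣q∣ b c ⟩
  ℚ.∣ b ∣ ℚ.+ ℚ.∣ c ∣      <⟨ ℚP.+-mono-< b< c< ⟩
  ½ ℚ.* ε ℚ.+ ½ ℚ.* ε      ≡⟨ half+half ε ⟩
  ε                        ∎
  where open ℚP.≤-Reasoning

≈ᴿ-trans : ∀ {x y z} → x ≈ᴿ y → y ≈ᴿ z → x ≈ᴿ z
≈ᴿ-trans {x} {y} {z} x≈y y≈z ε ε>0 = eventually-map
  (λ n (p , q) → half-bound (+-*-Solver.solve 3 (λ a b c → a :- c := (a :- b) :+ (b :- c)) refl (seq x n) (seq y n) (seq z n)) p q)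
  (eventually-× (x≈y _ (half-pos ε>0)) (y≈z _ (half-pos ε>0)))
  where open +-*-Solver

+ᴿ-cong : ∀ {x x′ y y′} → x ≈ᴿ x′ → y ≈ᴿ y′ → x +ᴿ y ≈ᴿ x′ +ᴿ y′
+ᴿ-cong {x} {x′} {y} {y′} x≈ y≈ ε ε>0 = eventually-map
  (λ n (p , q) → half-bound (+-difference (seq x n) (seq y n) (seq x′ n) (seq y′ n)) p q)
  (eventually-× (x≈ _ (half-pos ε>0)) (y≈ _ (half-pos ε>0)))

-ᴿ-cong : ∀ {x x′} → x ≈ᴿ x′ → -ᴿ x ≈ᴿ -ᴿ x′
-ᴿ-cong {x} {x′} x≈ ε ε>0 = eventually-map
  (λ n → subst (ℚ._< ε) (cong ℚ.∣_∣ (neg-difference (seq x′ n) (seq x n)))) (≈ᴿ-sym {x} {x′} x≈ ε ε>0)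

pos*pos : ∀ {p r} → 0ℚ ℚ.< p → 0ℚ ℚ.< r → 0ℚ ℚ.< p ℚ.* r
pos*pos {p} {r} p>0 r>0 = ℚP.positive⁻¹ (p ℚ.* r) {{ℚP.pos*pos⇒pos p {{ℚ.positive p>0}} r {{ℚ.positive r>0}}}}

quotient : ∀ {p r} → 0ℚ ℚ.< p → 0ℚ ℚ.< r → ∃[ d ] 0ℚ ℚ.< d × p ℚ.* d ≡ r
quotient {p} {r} p>0 r>0 = ℚ.1/ p ℚ.* r
  , pos*pos (ℚP.positive⁻¹ (ℚ.1/ p) {{ℚP.1/pos⇒pos p}}) r>0
  , trans (sym (ℚP.*-assoc p (ℚ.1/ p) r)) (trans (cong (ℚ._* r) (ℚP.*-inverseʳ p)) (ℚP.*-identityˡ r))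
  where
  instance
    p-pos : ℚ.Positive p
    p-pos = ℚ.positive p>0
    p-nonZero : ℚ.NonZero p
    p-nonZero = ℚP.pos⇒nonZero p

∣*∣-mono-≤ : ∀ {a b c d} → ℚ.∣ a ∣ ℚ.≤ c → ℚ.∣ b ∣ ℚ.≤ d → ℚ.∣ a ℚ.* b ∣ ℚ.≤ c ℚ.* d
∣*∣-mono-≤ {a} {b} {c} {d} a≤c b≤d = begin
  ℚ.∣ a ℚ.* b ∣         ≡⟨ ℚP.∣p*q∣≡∣p∣*∣q∣ a b ⟩
  ℚ.∣ a ∣ ℚ.* ℚ.∣ b ∣   ≤⟨ ℚP.*-monoʳ-≤-nonNeg ℚ.∣ b ∣ {{ℚ.nonNegative (ℚP.0≤∣p∣ b)}} a≤c ⟩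
  c ℚ.* ℚ.∣ b ∣         ≤⟨ ℚP.*-monoˡ-≤-nonNeg c {{ℚ.nonNegative (ℚP.≤-trans (ℚP.0≤∣p∣ a) a≤c)}} b≤d ⟩
  c ℚ.* d               ∎
  where open ℚP.≤-Reasoning

bounded*small : ∀ {B a b ε δ} → 0ℚ ℚ.< B → B ℚ.* δ ≡ ε → ℚ.∣ a ∣ ℚ.≤ B → ℚ.∣ b ∣ ℚ.< δ → ℚ.∣ a ℚ.* b ∣ ℚ.< ε
bounded*small {B} {a} {b} {ε} {δ} B>0 Bδ≡ε a≤ b< = begin-strict
  ℚ.∣ a ℚ.* b ∣     ≤⟨ ∣*∣-mono-≤ {a} {b} a≤ ℚP.≤-refl ⟩
  B ℚ.* ℚ.∣ b ∣     <⟨ ℚP.*-monoʳ-<-pos B {{ℚ.positive B>0}} b< ⟩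
  B ℚ.* δ           ≡⟨ Bδ≡ε ⟩
  ε                 ∎
  where open ℚP.≤-Reasoning

*ᴿ-cong : ∀ {x x′ y y′} → x ≈ᴿ x′ → y ≈ᴿ y′ → x *ᴿ y ≈ᴿ x′ *ᴿ y′
*ᴿ-cong {x} {x′} {y} {y′} x≈ y≈ ε ε>0
  with eventually-bounded (seq x) (cauchy x) | eventually-bounded (seq y′) (cauchy y′)
... | B , B>0 , x≤B | C , C>0 , y≤C with quotient B>0 (half-pos ε>0) | quotient C>0 (half-pos ε>0)
... | δ , δ>0 , Bδ | η , η>0 , Cη = eventually-map
  (λ n ((x≤ , y≤) , (y< , x<)) → half-bound (*-difference (seq x n) (seq y n) (seq x′ n) (seq y′ n))
    (bounded*small B>0 Bδ x≤ y<) (bounded*small C>0 Cη y≤ x<))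
  (eventually-× (eventually-× x≤B y≤C) (eventually-× (y≈ δ δ>0) (x≈ η η>0)))

≈ᶜ-pointwise : ∀ {z w} → (∀ n → seq (re z) n ≡ seq (re w) n) → (∀ n → seq (im z) n ≡ seq (im w) n) → z ≈ᶜ w
≈ᶜ-pointwise {z} {w} re≗ im≗ = ≈ᴿ-pointwise {re z} {re w} re≗ , ≈ᴿ-pointwise {im z} {im w} im≗

-- The algebraic laws hold term by term in the Cauchy sequences, as polynomial identities between
-- rationals. Only the equivalence and congruence laws need estimates.
ℂ-commutativeRing : CommutativeRing 0ℓ 0ℓ
ℂ-commutativeRing = record
  { Carrier = ℂ ; _≈_ = _≈ᶜ_ ; _+_ = _+ᶜ_ ; _*_ = _*ᶜ_ ; -_ = -ᶜ_ ; 0# = 0ᶜ ; 1# = 1ᶜ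
  ; isCommutativeRing = record
    { isRing = record
      { +-isAbelianGroup = record
        { isGroup = record
          { isMonoid = record
            { isSemigroup = record
              { isMagma = record
                { isEquivalence = record
                  { refl  = λ {z} → ≈ᴿ-refl {re z} , ≈ᴿ-refl {im z}
                  ; sym   = λ {z} {w} (p , p′) → ≈ᴿ-sym {re z} {re w} p , ≈ᴿ-sym {im z} {im w} p′
                  ; trans = λ {z} {w} {v} (p , p′) (r , r′) →
                      ≈ᴿ-trans {re z} {re w} {re v} p r , ≈ᴿ-trans {im z} {im w} {im v} p′ r′
                  }
                ; ∙-cong = λ {z} {z′} {w} {w′} (p , p′) (r , r′) →
                    +ᴿ-cong {re z} {re z′} {re w} {re w′} p r , +ᴿ-cong {im z} {im z′} {im w} {im w′} p′ r′
                }
              ; assoc = λ z w v → ≈ᶜ-pointwise {(z +ᶜ w) +ᶜ v} {z +ᶜ (w +ᶜ v)}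
                  (λ n → ℚP.+-assoc (seq (re z) n) (seq (re w) n) (seq (re v) n))
                  (λ n → ℚP.+-assoc (seq (im z) n) (seq (im w) n) (seq (im v) n))
              }
            ; identity = (λ z → ≈ᶜ-pointwise {0ᶜ +ᶜ z} {z} (λ n → ℚP.+-identityˡ (seq (re z) n)) (λ n → ℚP.+-identityˡ (seq (im z) n)))
                       , (λ z → ≈ᶜ-pointwise {z +ᶜ 0ᶜ} {z} (λ n → ℚP.+-identityʳ (seq (re z) n)) (λ n → ℚP.+-identityʳ (seq (im z) n)))
            }
          ; inverse = (λ z → ≈ᶜ-pointwise { -ᶜ z +ᶜ z} {0ᶜ} (λ n → ℚP.+-inverseˡ (seq (re z) n)) (λ n → ℚP.+-inverseˡ (seq (im z) n)))
                    , (λ z → ≈ᶜ-pointwise {z +ᶜ (-ᶜ z)} {0ᶜ} (λ n → ℚP.+-inverseʳ (seq (re z) n)) (λ n → ℚP.+-inverseʳ (seq (im z) n)))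
          ; ⁻¹-cong = λ {z} {w} (p , p′) → -ᴿ-cong {re z} {re w} p , -ᴿ-cong {im z} {im w} p′
          }
        ; comm = λ z w → ≈ᶜ-pointwise {z +ᶜ w} {w +ᶜ z}
            (λ n → ℚP.+-comm (seq (re z) n) (seq (re w) n)) (λ n → ℚP.+-comm (seq (im z) n) (seq (im w) n))
        }
      ; *-cong = λ {z} {z′} {w} {w′} (p , p′) (r , r′) →
            +ᴿ-cong {re z *ᴿ re w} {re z′ *ᴿ re w′} { -ᴿ (im z *ᴿ im w)} { -ᴿ (im z′ *ᴿ im w′)}
              (*ᴿ-cong {re z} {re z′} {re w} {re w′} p r)
              (-ᴿ-cong {im z *ᴿ im w} {im z′ *ᴿ im w′} (*ᴿ-cong {im z} {im z′} {im w} {im w′} p′ r′))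
          , +ᴿ-cong {re z *ᴿ im w} {re z′ *ᴿ im w′} {im z *ᴿ re w} {im z′ *ᴿ re w′}
              (*ᴿ-cong {re z} {re z′} {im w} {im w′} p r′)
              (*ᴿ-cong {im z} {im z′} {re w} {re w′} p′ r)
      ; *-assoc = λ z w v → ≈ᶜ-pointwise {(z *ᶜ w) *ᶜ v} {z *ᶜ (w *ᶜ v)}
          (λ n → solve 6 (λ a a′ b b′ c c′ →
              (a :* b :+ :- (a′ :* b′)) :* c :+ :- ((a :* b′ :+ a′ :* b) :* c′)
                := a :* (b :* c :+ :- (b′ :* c′)) :+ :- (a′ :* (b :* c′ :+ b′ :* c))) refl
            (seq (re z) n) (seq (im z) n) (seq (re w) n) (seq (im w) n) (seq (re v) n) (seq (im v) n))
          (λ n → solve 6 (λ a a′ b b′ c c′ →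
              (a :* b :+ :- (a′ :* b′)) :* c′ :+ (a :* b′ :+ a′ :* b) :* c
                := a :* (b :* c′ :+ b′ :* c) :+ a′ :* (b :* c :+ :- (b′ :* c′))) refl
            (seq (re z) n) (seq (im z) n) (seq (re w) n) (seq (im w) n) (seq (re v) n) (seq (im v) n))
      ; *-identity = (λ z → ≈ᶜ-pointwise {1ᶜ *ᶜ z} {z}
              (λ n → solve 2 (λ a a′ → con 1ℚ :* a :+ :- (con 0ℚ :* a′) := a) refl (seq (re z) n) (seq (im z) n))
              (λ n → solve 2 (λ a a′ → con 1ℚ :* a′ :+ con 0ℚ :* a := a′) refl (seq (re z) n) (seq (im z) n)))
          , (λ z → ≈ᶜ-pointwise {z *ᶜ 1ᶜ} {z}
              (λ n → solve 2 (λ a a′ → a :* con 1ℚ :+ :- (a′ :* con 0ℚ) := a) refl (seq (re z) n) (seq (im z) n))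
              (λ n → solve 2 (λ a a′ → a :* con 0ℚ :+ a′ :* con 1ℚ := a′) refl (seq (re z) n) (seq (im z) n)))
      ; distrib = (λ z w v → ≈ᶜ-pointwise {z *ᶜ (w +ᶜ v)} {z *ᶜ w +ᶜ z *ᶜ v}
          (λ n → solve 6 (λ a a′ b b′ c c′ →
              a :* (b :+ c) :+ :- (a′ :* (b′ :+ c′)) := (a :* b :+ :- (a′ :* b′)) :+ (a :* c :+ :- (a′ :* c′))) refl
            (seq (re z) n) (seq (im z) n) (seq (re w) n) (seq (im w) n) (seq (re v) n) (seq (im v) n))
          (λ n → solve 6 (λ a a′ b b′ c c′ →
              a :* (b′ :+ c′) :+ a′ :* (b :+ c) := (a :* b′ :+ a′ :* b) :+ (a :* c′ :+ a′ :* c)) refl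
            (seq (re z) n) (seq (im z) n) (seq (re w) n) (seq (im w) n) (seq (re v) n) (seq (im v) n)))
        , (λ z w v → ≈ᶜ-pointwise {(w +ᶜ v) *ᶜ z} {w *ᶜ z +ᶜ v *ᶜ z}
          (λ n → solve 6 (λ a a′ b b′ c c′ →
              (b :+ c) :* a :+ :- ((b′ :+ c′) :* a′) := (b :* a :+ :- (b′ :* a′)) :+ (c :* a :+ :- (c′ :* a′))) refl
            (seq (re z) n) (seq (im z) n) (seq (re w) n) (seq (im w) n) (seq (re v) n) (seq (im v) n))
          (λ n → solve 6 (λ a a′ b b′ c c′ →
              (b :+ c) :* a′ :+ (b′ :+ c′) :* a := (b :* a′ :+ b′ :* a) :+ (c :* a′ :+ c′ :* a)) refl
            (seq (re z) n) (seq (im z) n) (seq (re w) n) (seq (im w) n) (seq (re v) n) (seq (im v) n)))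
      }
    ; *-comm = λ z w → ≈ᶜ-pointwise {z *ᶜ w} {w *ᶜ z}
        (λ n → solve 4 (λ a a′ b b′ → a :* b :+ :- (a′ :* b′) := b :* a :+ :- (b′ :* a′)) refl
          (seq (re z) n) (seq (im z) n) (seq (re w) n) (seq (im w) n))
        (λ n → solve 4 (λ a a′ b b′ → a :* b′ :+ a′ :* b := b :* a′ :+ b′ :* a) refl
          (seq (re z) n) (seq (im z) n) (seq (re w) n) (seq (im w) n))
    }
  }
  where open +-*-Solver

-- The positive form of being nonzero: terms eventually bounded away from 0. Being ≈ 0 is exactly
-- its negation, and the bounds of two factors multiply.
Apart0 : ℝ → Set
Apart0 x = ∃[ c ] 0ℚ ℚ.< c × Eventually (λ n → c ℚ.≤ ℚ.∣ seq x n ∣)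

0ᴿ : ℝ
0ᴿ = fromℚ 0ℚ

≈0⇒¬apart : ∀ {x} → x ≈ᴿ 0ᴿ → ¬ Apart0 x
≈0⇒¬apart {x} x≈0 (c , c>0 , c≤) with eventually-× (x≈0 c c>0) c≤
... | N , p = ℚP.<-irrefl refl (ℚP.≤-<-trans (proj₂ (p N ℕP.≤-refl))
  (subst (λ y → ℚ.∣ y ∣ ℚ.< c) (ℚP.+-identityʳ (seq x N)) (proj₁ (p N ℕP.≤-refl))))

-- The Cauchy modulus at ε/4 and one comparison of rationals decide between ∣ x ∣ < ε and apartness.
¬apart⇒≈0 : ∀ {x} → ¬ Apart0 x → x ≈ᴿ 0ᴿ
¬apart⇒≈0 {x} ¬apart ε ε>0 with cauchy x (½ ℚ.* (½ ℚ.* ε)) (half-pos (half-pos ε>0))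
... | N , close with ℚ.∣ seq x N ∣ ℚP.<? ½ ℚ.* ε
... | yes xN< = N , λ n n≥ → half-bound
        (solve 2 (λ a b → a :- con 0ℚ := (a :- b) :+ b) refl (seq x n) (seq x N))
        (ℚP.<-trans (close n N n≥ ℕP.≤-refl) quarter<half) xN<
  where
  open +-*-Solver
  quarter<half : ½ ℚ.* (½ ℚ.* ε) ℚ.< ½ ℚ.* ε
  quarter<half = subst₂ ℚ._<_ (ℚP.+-identityʳ _) (half+half (½ ℚ.* ε)) (ℚP.+-monoʳ-< (½ ℚ.* (½ ℚ.* ε)) (half-pos (half-pos ε>0)))
... | no xN≮ = contradiction (c , half-pos (half-pos ε>0) , N , far) ¬apart
  where
  c = ½ ℚ.* (½ ℚ.* ε)
  far : ∀ n → N ℕ.≤ n → c ℚ.≤ ℚ.∣ seq x n ∣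
  far n n≥ = ℚP.≮⇒≥ λ x< → xN≮ (half-bound
    (+-*-Solver.solve 2 (λ a b → b := (b :- a) :+ a) refl (seq x n) (seq x N))
    (close N n ℕP.≤-refl n≥) x<)
    where open +-*-Solver

-- Hence ≈ᴿ 0ᴿ is a negative statement, on which one may argue by contradiction.
≈0-stable : ∀ {x} → ¬ ¬ (x ≈ᴿ 0ᴿ) → x ≈ᴿ 0ᴿ
≈0-stable {x} ¬¬x≈0 = ¬apart⇒≈0 {x} λ apart → ¬¬x≈0 λ x≈0 → ≈0⇒¬apart {x} x≈0 apart

apart-* : ∀ {x y} → Apart0 x → Apart0 y → Apart0 (x *ᴿ y)
apart-* {x} {y} (c , c>0 , c≤) (d , d>0 , d≤) = c ℚ.* d , pos*pos c>0 d>0 , eventually-map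
  (λ n (p , r) → begin
    c ℚ.* d                          ≤⟨ ℚP.*-monoʳ-≤-nonNeg d {{ℚ.nonNegative (ℚP.<⇒≤ d>0)}} p ⟩
    ℚ.∣ seq x n ∣ ℚ.* d              ≤⟨ ℚP.*-monoˡ-≤-nonNeg ℚ.∣ seq x n ∣ {{ℚ.nonNegative (ℚP.0≤∣p∣ (seq x n))}} r ⟩
    ℚ.∣ seq x n ∣ ℚ.* ℚ.∣ seq y n ∣  ≡⟨ ℚP.∣p*q∣≡∣p∣*∣q∣ (seq x n) (seq y n) ⟨
    ℚ.∣ seq x n ℚ.* seq y n ∣        ∎)
  (eventually-× c≤ d≤)
  where open ℚP.≤-Reasoning

-- The assumption on y is a mere negation and yields no bound. But both x ≈ 0 and y ≈ 0 may be
-- proved by refuting apartness, and if both factors were apart from 0, so would be their product.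
*ᴿ-zero-divisor : ∀ {x y} → x *ᴿ y ≈ᴿ 0ᴿ → ¬ y ≈ᴿ 0ᴿ → x ≈ᴿ 0ᴿ
*ᴿ-zero-divisor {x} {y} xy≈0 y≉0 = ¬apart⇒≈0 {x} λ x# → y≉0 (¬apart⇒≈0 {y} λ y# →
  ≈0⇒¬apart {x *ᴿ y} xy≈0 (apart-* {x} {y} x# y#))

p*p≡∣p∣*∣p∣ : ∀ p → p ℚ.* p ≡ ℚ.∣ p ∣ ℚ.* ℚ.∣ p ∣
p*p≡∣p∣*∣p∣ p with ℚP.∣p∣≡p∨∣p∣≡-p p
... | inj₁ ∣p∣≡p  = sym (cong₂ ℚ._*_ ∣p∣≡p ∣p∣≡p)
... | inj₂ ∣p∣≡-p = trans (+-*-Solver.solve 1 (λ a → a :* a := (:- a) :* (:- a)) refl p) (sym (cong₂ ℚ._*_ ∣p∣≡-p ∣p∣≡-p))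
  where open +-*-Solver

0≤p*p : ∀ p → 0ℚ ℚ.≤ p ℚ.* p
0≤p*p p = subst (0ℚ ℚ.≤_) (trans (ℚP.∣p*q∣≡∣p∣*∣q∣ p p) (sym (p*p≡∣p∣*∣p∣ p))) (ℚP.0≤∣p∣ (p ℚ.* p))

square-mono : ∀ {c p} → 0ℚ ℚ.≤ c → c ℚ.≤ ℚ.∣ p ∣ → c ℚ.* c ℚ.≤ p ℚ.* p
square-mono {c} {p} c≥0 c≤ = begin
  c ℚ.* c               ≤⟨ ℚP.*-monoʳ-≤-nonNeg c {{ℚ.nonNegative c≥0}} c≤ ⟩
  ℚ.∣ p ∣ ℚ.* c         ≤⟨ ℚP.*-monoˡ-≤-nonNeg ℚ.∣ p ∣ {{ℚ.nonNegative (ℚP.0≤∣p∣ p)}} c≤ ⟩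
  ℚ.∣ p ∣ ℚ.* ℚ.∣ p ∣   ≡⟨ p*p≡∣p∣*∣p∣ p ⟨
  p ℚ.* p               ∎
  where open ℚP.≤-Reasoning

≤⇒≤∣∣ : ∀ {c p} → c ℚ.≤ p → c ℚ.≤ ℚ.∣ p ∣
≤⇒≤∣∣ {c} {p} c≤p = ℚP.≤-trans c≤p (p≤∣p∣ (ℚP.∣p∣≡p∨∣p∣≡-p p) (0ℚ ℚP.≤? p))
  where
  p≤∣p∣ : ℚ.∣ p ∣ ≡ p ⊎ ℚ.∣ p ∣ ≡ ℚ.- p → Dec (0ℚ ℚ.≤ p) → p ℚ.≤ ℚ.∣ p ∣
  p≤∣p∣ (inj₁ ∣p∣≡p) _ = ℚP.≤-reflexive (sym ∣p∣≡p)
  p≤∣p∣ (inj₂ _) (yes 0≤p) = ℚP.≤-reflexive (sym (ℚP.0≤p⇒∣p∣≡p 0≤p))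
  p≤∣p∣ (inj₂ _) (no 0≰p)  = ℚP.≤-trans (ℚP.<⇒≤ (ℚP.≰⇒> 0≰p)) (ℚP.0≤∣p∣ p)

-- A lower bound c for one of the two parts would give the lower bound c² for the squared modulus.
∣∣²-≈0 : ∀ {z} → ∣ z ∣² ≈ᴿ 0ᴿ → z ≈ᶜ 0ᶜ
∣∣²-≈0 {z} z²≈0 =
    ¬apart⇒≈0 {re z} (λ (c , c>0 , c≤) → ≈0⇒¬apart {∣ z ∣²} z²≈0 (c ℚ.* c , pos*pos c>0 c>0 , eventually-map
      (λ n p → ≤⇒≤∣∣ (ℚP.≤-trans (square-mono (ℚP.<⇒≤ c>0) p)
        (subst (ℚ._≤ seq ∣ z ∣² n) (ℚP.+-identityʳ _) (ℚP.+-monoʳ-≤ (seq (re z) n ℚ.* seq (re z) n) (0≤p*p (seq (im z) n)))))) c≤))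
  , ¬apart⇒≈0 {im z} (λ (c , c>0 , c≤) → ≈0⇒¬apart {∣ z ∣²} z²≈0 (c ℚ.* c , pos*pos c>0 c>0 , eventually-map
      (λ n p → ≤⇒≤∣∣ (ℚP.≤-trans (square-mono (ℚP.<⇒≤ c>0) p)
        (subst (ℚ._≤ seq ∣ z ∣² n) (ℚP.+-identityˡ _) (ℚP.+-monoˡ-≤ (seq (im z) n ℚ.* seq (im z) n) (0≤p*p (seq (re z) n)))))) c≤))

≈ᶜ0-stable : ∀ {z} → ¬ ¬ (z ≈ᶜ 0ᶜ) → z ≈ᶜ 0ᶜ
≈ᶜ0-stable {z} ¬¬z≈0 =
    ≈0-stable {re z} (λ re≉0 → ¬¬z≈0 λ z≈0 → re≉0 (proj₁ z≈0))
  , ≈0-stable {im z} (λ im≉0 → ¬¬z≈0 λ z≈0 → im≉0 (proj₂ z≈0))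

-- Multiply by the conjugate of w.
*ᶜ-zero-divisor : ∀ {z w} → z *ᶜ w ≈ᶜ 0ᶜ → ¬ w ≈ᶜ 0ᶜ → z ≈ᶜ 0ᶜ
*ᶜ-zero-divisor {z} {w} zw≈0 w≉0 = real-zero (re z) re-eq , real-zero (im z) im-eq
  where
  open CommutativeRing ℂ-commutativeRing using () renaming (trans to ≈-trans; sym to ≈-sym; *-congʳ to ≈-*-congʳ; zeroˡ to ≈-zeroˡ)

  real-zero : ∀ x → x *ᴿ ∣ w ∣² ≈ᴿ 0ᴿ → x ≈ᴿ 0ᴿ
  real-zero x xw²≈0 = *ᴿ-zero-divisor {x} {∣ w ∣²} xw²≈0 λ w²≈0 → w≉0 (∣∣²-≈0 {w} w²≈0)

  conj : ℂ
  conj = re w +i (-ᴿ im w)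

  z|w|²≈0 : (z *ᶜ w) *ᶜ conj ≈ᶜ 0ᶜ
  z|w|²≈0 = ≈-trans {(z *ᶜ w) *ᶜ conj} {0ᶜ *ᶜ conj} {0ᶜ} (≈-*-congʳ {conj} {z *ᶜ w} {0ᶜ} zw≈0) (≈-zeroˡ conj)

  open +-*-Solver

  re-eq : re z *ᴿ ∣ w ∣² ≈ᴿ 0ᴿ
  re-eq = ≈ᴿ-trans {re z *ᴿ ∣ w ∣²} {re ((z *ᶜ w) *ᶜ conj)} {0ᴿ}
    (≈ᴿ-pointwise {re z *ᴿ ∣ w ∣²} {re ((z *ᶜ w) *ᶜ conj)} λ n → solve 4 (λ a a′ b b′ →
      a :* (b :* b :+ b′ :* b′) := (a :* b :+ :- (a′ :* b′)) :* b :+ :- ((a :* b′ :+ a′ :* b) :* (:- b′))) refl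
      (seq (re z) n) (seq (im z) n) (seq (re w) n) (seq (im w) n))
    (proj₁ z|w|²≈0)

  im-eq : im z *ᴿ ∣ w ∣² ≈ᴿ 0ᴿ
  im-eq = ≈ᴿ-trans {im z *ᴿ ∣ w ∣²} {im ((z *ᶜ w) *ᶜ conj)} {0ᴿ}
    (≈ᴿ-pointwise {im z *ᴿ ∣ w ∣²} {im ((z *ᶜ w) *ᶜ conj)} λ n → solve 4 (λ a a′ b b′ →
      a′ :* (b :* b :+ b′ :* b′) := (a :* b :+ :- (a′ :* b′)) :* (:- b′) :+ (a :* b′ :+ a′ :* b) :* b) refl
      (seq (re z) n) (seq (im z) n) (seq (re w) n) (seq (im w) n))
    (proj₂ z|w|²≈0)

module ℂᵣ = CommutativeRing ℂ-commutativeRing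

-- From φ x z ≈ z one gets (φ x - 1) z ≈ 0 for all x at once. If z were nonzero, every φ x would be
-- 1, against nontriviality; by stability this proves z ≈ 0 with no x ever chosen.
nontrivial-cancel : {A : Set} (φ : A → ℂ) → ¬ IsTrivial φ → ∀ z → (∀ x → φ x *ᶜ z ≈ᶜ z) → z ≈ᶜ 0ᶜ
nontrivial-cancel φ φ≉1 z φz≈z = ≈ᶜ0-stable {z} λ z≉0 → φ≉1 λ x →
  x∙y⁻¹≈ε⇒x≈y (φ x) 1ᶜ (*ᶜ-zero-divisor {φ x -ᶜ 1ᶜ} {z} (begin
    (φ x -ᶜ 1ᶜ) *ᶜ z       ≈⟨ [y-z]x≈yx-zx z (φ x) 1ᶜ ⟩
    φ x *ᶜ z -ᶜ 1ᶜ *ᶜ z    ≈⟨ ℂᵣ.+-cong {φ x *ᶜ z} {z} { -ᶜ (1ᶜ *ᶜ z)} { -ᶜ z} (φz≈z x)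
                                (ℂᵣ.-‿cong {1ᶜ *ᶜ z} {z} (ℂᵣ.*-identityˡ z)) ⟩
    z -ᶜ z                 ≈⟨ ℂᵣ.-‿inverseʳ z ⟩
    0ᶜ                     ∎) z≉0)
  where
  open RingProperties ℂᵣ.ring using ([y-z]x≈yx-zx)
  open GroupProperties ℂᵣ.+-group using (x∙y⁻¹≈ε⇒x≈y)
  open SetoidReasoning ℂᵣ.setoid

ℚ→ℂ-* : ∀ p r → ℚ→ℂ (p ℚ.* r) ≈ᶜ ℚ→ℂ p *ᶜ ℚ→ℂ r
ℚ→ℂ-* p r = ≈ᶜ-pointwise {ℚ→ℂ (p ℚ.* r)} {ℚ→ℂ p *ᶜ ℚ→ℂ r}
  (λ _ → solve 2 (λ a b → a :* b := a :* b :+ :- (con 0ℚ :* con 0ℚ)) refl p r)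
  (λ _ → solve 2 (λ a b → con 0ℚ := a :* con 0ℚ :+ con 0ℚ :* b) refl p r)
  where open +-*-Solver

ℚ→ℂ-+ : ∀ p r → ℚ→ℂ (p ℚ.+ r) ≈ᶜ ℚ→ℂ p +ᶜ ℚ→ℂ r
ℚ→ℂ-+ p r = ≈ᶜ-pointwise {ℚ→ℂ (p ℚ.+ r)} {ℚ→ℂ p +ᶜ ℚ→ℂ r} (λ _ → refl) (λ _ → sym (ℚP.+-identityʳ 0ℚ))

-- Natural numbers among the rationals

natℚ : ℕ → ℚ
natℚ zero    = 0ℚ
natℚ (suc n) = 1ℚ ℚ.+ natℚ n

natℚ-+ : ∀ m n → natℚ (m ℕ.+ n) ≡ natℚ m ℚ.+ natℚ n
natℚ-+ zero    n = sym (ℚP.+-identityˡ (natℚ n))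
natℚ-+ (suc m) n = trans (cong (1ℚ ℚ.+_) (natℚ-+ m n)) (sym (ℚP.+-assoc 1ℚ (natℚ m) (natℚ n)))

natℚ-* : ∀ m n → natℚ (m ℕ.* n) ≡ natℚ m ℚ.* natℚ n
natℚ-* zero    n = sym (ℚP.*-zeroˡ (natℚ n))
natℚ-* (suc m) n = trans (natℚ-+ n (m ℕ.* n)) (trans
  (cong₂ ℚ._+_ (sym (ℚP.*-identityˡ (natℚ n))) (natℚ-* m n))
  (sym (ℚP.*-distribʳ-+ (natℚ n) 1ℚ (natℚ m))))

0≤natℚ : ∀ n → 0ℚ ℚ.≤ natℚ n
0≤natℚ zero    = ℚP.≤-refl
0≤natℚ (suc n) = ℚP.+-mono-≤ (ℚP.<⇒≤ (ℚP.positive⁻¹ 1ℚ)) (0≤natℚ n)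

natℚ-mono : ∀ {m n} → m ℕ.≤ n → natℚ m ℚ.≤ natℚ n
natℚ-mono {n = n} ℕ.z≤n = 0≤natℚ n
natℚ-mono (ℕ.s≤s m≤n)   = ℚP.+-monoʳ-≤ 1ℚ (natℚ-mono m≤n)

toℚᵘ-natℚ : ∀ n → ℚ.toℚᵘ (natℚ n) ℚᵘ.≃ ℚᵘ.mkℚᵘ (+ n) 0
toℚᵘ-natℚ zero    = ℚᵘP.≃-refl
toℚᵘ-natℚ (suc n) = ℚᵘP.≃-trans (ℚP.toℚᵘ-homo-+ 1ℚ (natℚ n)) (ℚᵘP.≃-trans
  (ℚᵘP.+-congʳ (ℚ.toℚᵘ 1ℚ) (toℚᵘ-natℚ n))
  (ℚᵘ.*≡* (cong (λ i → (+ 1 ℤ.+ i) ℤ.* + 1) (ℤP.*-identityʳ (+ n)))))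

-- Unnormalised fractions are compared by cross multiplication, which avoids the common divisors
-- hidden in `ℚ`.
1/n*natℚ : ∀ n .{{_ : ℕ.NonZero n}} → (+ 1 ℚ./ n) ℚ.* natℚ n ≡ 1ℚ
1/n*natℚ (suc n) = ℚP.toℚᵘ-injective (ℚᵘP.≃-trans (ℚP.toℚᵘ-homo-* (+ 1 ℚ./ suc n) (natℚ (suc n)))
  (ℚᵘP.≃-trans (ℚᵘP.*-cong (ℚP.toℚᵘ-fromℚᵘ (ℚᵘ.mkℚᵘ (+ 1) n)) (toℚᵘ-natℚ (suc n)))
    (ℚᵘ.*≡* (trans (ℤP.*-identityʳ _) (trans (ℤP.*-identityˡ (+ suc n)) (sym (trans (ℤP.*-identityˡ _) (cong +_ (ℕP.*-identityʳ (suc n))))))))))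

-- The denominator is at least 1, so the absolute value of the numerator is a bound.
archimedean : ∀ p → ∃[ m ] p ℚ.≤ natℚ m
archimedean p@(ℚ.mkℚ i d _) = ℤ.∣ i ∣ , ℚP.toℚᵘ-cancel-≤ (ℚᵘP.≤-respʳ-≃ (ℚᵘP.≃-sym (toℚᵘ-natℚ ℤ.∣ i ∣))
  (ℚᵘ.*≤* (subst (ℤ._≤ + ℤ.∣ i ∣ ℤ.* + suc d) (sym (ℤP.*-identityʳ i)) (bound i))))
  where
  bound : ∀ i → i ℤ.≤ + ℤ.∣ i ∣ ℤ.* + suc d
  bound (+ m)    = subst (+ m ℤ.≤_) (ℤP.pos-* m (suc d)) (ℤ.+≤+ (ℕP.m≤m*n m (suc d)))
  bound -[1+ m ] = subst (-[1+ m ] ℤ.≤_) (ℤP.pos-* (suc m) (suc d)) ℤ.-≤+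

recip-nonZero : ∀ n .{{_ : ℕ.NonZero n}} → recip n ≡ ℚ→ℂ (+ 1 ℚ./ n)
recip-nonZero (suc n) = refl

-- The Euler product

∣∣²-cong : ∀ {z w} → z ≈ᶜ w → ∣ z ∣² ≈ᴿ ∣ w ∣²
∣∣²-cong {z} {w} (p , p′) = +ᴿ-cong {re z *ᴿ re z} {re w *ᴿ re w} {im z *ᴿ im z} {im w *ᴿ im w}
  (*ᴿ-cong {re z} {re w} {re z} {re w} p p) (*ᴿ-cong {im z} {im w} {im z} {im w} p′ p′)

-- For rational b the squared distance of c b from c is ∣ c ∣² (b - 1)², which is governed by any
-- bound B for ∣ c ∣².
scaled-limit : ∀ (z : ℕ → ℂ) c (b : ℕ → ℚ) → (∀ N → z N ≈ᶜ c *ᶜ ℚ→ℂ (b N)) →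
  (∀ δ → 0ℚ ℚ.< δ → Eventually (λ N → ℚ.∣ b N ℚ.- 1ℚ ∣ ℚ.≤ δ)) → z ⟶ c
scaled-limit z c b z≈cb b→1 ε ε>0 =
  let B , B>0 , c²≤B = eventually-bounded (seq ∣ c ∣²) (cauchy ∣ c ∣²)
      -- Since B ≤ (B + 1)², the choice δ = ε / (B + 1) gives B δ² ≤ ε² without a square root of B.
      δ , δ>0 , [B+1]δ≡ε = quotient {B ℚ.+ 1ℚ} (ℚP.+-mono-< B>0 (ℚP.positive⁻¹ 1ℚ)) ε>0
  in eventually-map (Bounded.close B B>0 c²≤B δ δ>0 [B+1]δ≡ε) (b→1 δ δ>0)
  where
  module Bounded (B : ℚ) (B>0 : 0ℚ ℚ.< B) (c²≤B : Eventually (λ k → ℚ.∣ seq ∣ c ∣² k ∣ ℚ.≤ B))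
                 (δ : ℚ) (δ>0 : 0ℚ ℚ.< δ) ([B+1]δ≡ε : (B ℚ.+ 1ℚ) ℚ.* δ ≡ ε) where
    open ℚP.≤-Reasoning

    B[δδ]≤εε : B ℚ.* (δ ℚ.* δ) ℚ.≤ ε ℚ.* ε
    B[δδ]≤εε = begin
      B ℚ.* (δ ℚ.* δ)
        ≡⟨ sym (ℚP.+-identityʳ _) ⟩
      B ℚ.* (δ ℚ.* δ) ℚ.+ 0ℚ
        ≤⟨ ℚP.+-monoʳ-≤ (B ℚ.* (δ ℚ.* δ)) (ℚP.<⇒≤ (ℚP.+-mono-< (pos*pos (ℚP.+-mono-< (pos*pos B>0 B>0) B>0) (pos*pos δ>0 δ>0)) (pos*pos δ>0 δ>0))) ⟩
      B ℚ.* (δ ℚ.* δ) ℚ.+ ((B ℚ.* B ℚ.+ B) ℚ.* (δ ℚ.* δ) ℚ.+ δ ℚ.* δ)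
        ≡⟨ solve 2 (λ B d → B :* (d :* d) :+ ((B :* B :+ B) :* (d :* d) :+ d :* d) := ((B :+ con 1ℚ) :* d) :* ((B :+ con 1ℚ) :* d)) refl B δ ⟩
      ((B ℚ.+ 1ℚ) ℚ.* δ) ℚ.* ((B ℚ.+ 1ℚ) ℚ.* δ)
        ≡⟨ cong₂ ℚ._*_ [B+1]δ≡ε [B+1]δ≡ε ⟩
      ε ℚ.* ε ∎
      where open +-*-Solver

    close : ∀ N → ℚ.∣ b N ℚ.- 1ℚ ∣ ℚ.≤ δ → ∣ z N -ᶜ c ∣² ≤ᴿ fromℚ (ε ℚ.* ε)
    close N b-1≤δ η η>0 = eventually-map
      (λ k (z-c≈ , c²≤) → begin-strict
        seq ∣ z N -ᶜ c ∣² k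
          ≡⟨ solve 2 (λ x y → x := y :+ (x :- y)) refl (seq ∣ z N -ᶜ c ∣² k) (seq ∣ c *ᶜ ℚ→ℂ (b N) -ᶜ c ∣² k) ⟩
        seq ∣ c *ᶜ ℚ→ℂ (b N) -ᶜ c ∣² k ℚ.+ (seq ∣ z N -ᶜ c ∣² k ℚ.- seq ∣ c *ᶜ ℚ→ℂ (b N) -ᶜ c ∣² k)
          <⟨ ℚP.+-mono-≤-< (bound k c²≤) (ℚP.≤-<-trans (≤⇒≤∣∣ ℚP.≤-refl) z-c≈) ⟩
        ε ℚ.* ε ℚ.+ η ∎)
      (eventually-× (∣∣²-cong {z N -ᶜ c} {c *ᶜ ℚ→ℂ (b N) -ᶜ c} (ℂᵣ.+-congʳ { -ᶜ c} {z N} {c *ᶜ ℚ→ℂ (b N)} (z≈cb N)) η η>0) c²≤B)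
      where
      open +-*-Solver

      bound : ∀ k → ℚ.∣ seq ∣ c ∣² k ∣ ℚ.≤ B → seq ∣ c *ᶜ ℚ→ℂ (b N) -ᶜ c ∣² k ℚ.≤ ε ℚ.* ε
      bound k c²≤ = begin
        seq ∣ c *ᶜ ℚ→ℂ (b N) -ᶜ c ∣² k
          ≡⟨ solve 3 (λ x y b →
               ((x :* b :+ :- (y :* con 0ℚ)) :+ :- x) :* ((x :* b :+ :- (y :* con 0ℚ)) :+ :- x)
               :+ ((x :* con 0ℚ :+ y :* b) :+ :- y) :* ((x :* con 0ℚ :+ y :* b) :+ :- y)
               := (x :* x :+ y :* y) :* ((b :- con 1ℚ) :* (b :- con 1ℚ))) refl (seq (re c) k) (seq (im c) k) (b N) ⟩
        seq ∣ c ∣² k ℚ.* ((b N ℚ.- 1ℚ) ℚ.* (b N ℚ.- 1ℚ))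
          ≤⟨ ≤⇒≤∣∣ ℚP.≤-refl ⟩
        ℚ.∣ seq ∣ c ∣² k ℚ.* ((b N ℚ.- 1ℚ) ℚ.* (b N ℚ.- 1ℚ)) ∣
          ≤⟨ ∣*∣-mono-≤ {seq ∣ c ∣² k} c²≤ (∣*∣-mono-≤ {b N ℚ.- 1ℚ} b-1≤δ b-1≤δ) ⟩
        B ℚ.* (δ ℚ.* δ)
          ≤⟨ B[δδ]≤εε ⟩
        ε ℚ.* ε ∎

-- Multiplication of power series by linear factors

module Convolution (R : CommutativeRing 0ℓ 0ℓ) where
  open CommutativeRing R renaming (Carrier to A; trans to ≈-trans; sym to ≈-sym; refl to ≈-refl) hiding (zero)
  open RawMonoidDefs +-rawMonoid using (sum)
  open RingProperties ring using (-0#≈0#)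

  conv : (ℕ → A) → (ℕ → A) → ℕ → A
  conv f g n = sum (λ (k : Fin (suc n)) → f (toℕ k) * g (n ∸ toℕ k))

  module _ {x : A} {g : ℕ → A} (g₀ : g 0 ≈ 1#) (g₁ : g 1 ≈ x) (g₂ : ∀ k → g (suc (suc k)) ≈ 0#) where

    conv-linear-zero : ∀ f → conv f g 0 ≈ f 0
    conv-linear-zero f = ≈-trans (+-identityʳ _) (≈-trans (*-congˡ g₀) (*-identityʳ (f 0)))

    -- The nonzero coefficients of g = 1 + x u meet the last two terms of the sum. Dropping the
    -- first term shifts f, hence the induction with f general.
    conv-linear-suc : ∀ f n → conv f g (suc n) ≈ f (suc n) + f n * x
    conv-linear-suc f zero    = ≈-trans (+-cong (*-congˡ g₁) (conv-linear-zero (f ∘ suc))) (+-comm _ _)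
    conv-linear-suc f (suc n) = ≈-trans
      (+-cong (≈-trans (*-congˡ (g₂ n)) (zeroʳ (f 0))) (conv-linear-suc (f ∘ suc) n)) (+-identityˡ _)

    conv-suc : ∀ f n → conv g f (suc n) ≈ f (suc n) + x * f n
    conv-suc f n = +-cong (≈-trans (*-congʳ g₀) (*-identityˡ _))
      (≈-trans (+-cong (*-congʳ g₁) (sum-zero n λ k → ≈-trans (*-congʳ (g₂ (toℕ k))) (zeroˡ _))) (+-identityʳ _))
      where
      sum-zero : ∀ m {h : Fin m → A} → (∀ k → h k ≈ 0#) → sum h ≈ 0#
      sum-zero zero    h≈0 = ≈-refl
      sum-zero (suc m) h≈0 = ≈-trans (+-cong (h≈0 zero) (sum-zero m (h≈0 ∘ suc))) (+-identityˡ 0#)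

  geometric-zero : ∀ {g f} → g 0 ≈ 1# → (∀ n → f n ≈ 1#) → conv g f 0 ≈ 1#
  geometric-zero g₀ f≈1 = ≈-trans (+-identityʳ _) (≈-trans (*-cong g₀ (f≈1 0)) (*-identityˡ 1#))

  geometric-suc : ∀ {g f} → g 0 ≈ 1# → g 1 ≈ - 1# → (∀ k → g (suc (suc k)) ≈ 0#) →
    (∀ n → f n ≈ 1#) → ∀ n → conv g f (suc n) ≈ 0#
  geometric-suc {g} {f} g₀ g₁ g₂ f≈1 n = ≈-trans (conv-suc { - 1#} {g} g₀ g₁ g₂ f n)
    (≈-trans (+-cong (f≈1 (suc n)) (≈-trans (*-congˡ (f≈1 n)) (*-identityʳ (- 1#)))) (-‿inverseʳ 1#))

  -- The algebra of one induction step in `partial-product`: the recurrence c G ≈ c′ Q trades the G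
  -- of the new factor for Q, after which c′ can be taken out.
  combine : ∀ {P′ c′ b′ P c b G r Q t b″} → P′ ≈ c′ * b′ → P ≈ c * b → c * G ≈ c′ * Q → r ≈ G * t →
    b′ + Q * (b * t) ≈ b″ → P′ + P * r ≈ c′ * b″
  combine {P′} {c′} {b′} {P} {c} {b} {G} {r} {Q} {t} {b″} P′≈ P≈ cG≈ r≈ b″≈ = begin
    P′ + P * r                      ≈⟨ +-cong P′≈ (*-cong P≈ r≈) ⟩
    c′ * b′ + c * b * (G * t)       ≈⟨ +-congˡ (interchange c b G t) ⟩
    c′ * b′ + c * G * (b * t)       ≈⟨ +-congˡ (≈-trans (*-congʳ cG≈) (*-assoc c′ Q (b * t))) ⟩
    c′ * b′ + c′ * (Q * (b * t))    ≈⟨ distribˡ c′ b′ (Q * (b * t)) ⟨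
    c′ * (b′ + Q * (b * t))         ≈⟨ *-congˡ b″≈ ⟩
    c′ * b″                         ∎
    where
    open SetoidReasoning setoid
    open CommutativeSemigroupProperties *-commutativeSemigroup using (interchange)

  -- These evaluate the coefficients of 1 + x u, and the two after them those of 1 - u, in the form
  -- in which the series operations produce them.
  linear-0 : ∀ x → 1# + x * 0# ≈ 1#
  linear-0 x = ≈-trans (+-congˡ (zeroʳ x)) (+-identityʳ 1#)

  linear-1 : ∀ x → 0# + x * 1# ≈ x
  linear-1 x = ≈-trans (+-identityˡ _) (*-identityʳ x)

  linear-2 : ∀ x → 0# + x * 0# ≈ 0#
  linear-2 x = ≈-trans (+-identityˡ _) (zeroʳ x)

  1-0 : 1# - 0# ≈ 1#
  1-0 = ≈-trans (+-congˡ -0#≈0#) (+-identityʳ 1#)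

  0-1 : 0# - 1# ≈ - 1#
  0-1 = +-identityˡ (- 1#)

module Conv = Convolution ℂ-commutativeRing

*ᵖ-linear-zero : ∀ x (f : PowerSeries) → (f *ᵖ (1ᵖ +ᵖ (x ·ᵖ u))) zero ≈ᶜ f zero
*ᵖ-linear-zero x = Conv.conv-linear-zero {x} {1ᵖ +ᵖ (x ·ᵖ u)} (Conv.linear-0 x) (Conv.linear-1 x) (λ _ → Conv.linear-2 x)

*ᵖ-linear-suc : ∀ x (f : PowerSeries) n → (f *ᵖ (1ᵖ +ᵖ (x ·ᵖ u))) (suc n) ≈ᶜ f (suc n) +ᶜ f n *ᶜ x
*ᵖ-linear-suc x = Conv.conv-linear-suc {x} {1ᵖ +ᵖ (x ·ᵖ u)} (Conv.linear-0 x) (Conv.linear-1 x) (λ _ → Conv.linear-2 x)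

∏-suc : ∀ p N → ∏[1⋯ N ] p *ᵖ p (suc N) ≡ ∏[1⋯ suc N ] p
∏-suc p N = refl

module _ (x : ℕ → ℂ) (p : ℕ → PowerSeries) (p≡ : ∀ i → 1ᵖ +ᵖ (x i ·ᵖ u) ≡ p i) where

  ∏-linear-zero : ∀ N → ∏[1⋯ suc N ] p 0 ≈ᶜ ∏[1⋯ N ] p 0
  ∏-linear-zero N = subst (λ h → h 0 ≈ᶜ ∏[1⋯ N ] p 0) (∏-suc p N)
    (subst (λ g → (∏[1⋯ N ] p *ᵖ g) 0 ≈ᶜ ∏[1⋯ N ] p 0) (p≡ (suc N)) (*ᵖ-linear-zero (x (suc N)) (∏[1⋯ N ] p)))

  ∏-linear-suc : ∀ N n → ∏[1⋯ suc N ] p (suc n) ≈ᶜ ∏[1⋯ N ] p (suc n) +ᶜ ∏[1⋯ N ] p n *ᶜ x (suc N)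
  ∏-linear-suc N n = subst (λ h → h (suc n) ≈ᶜ ∏[1⋯ N ] p (suc n) +ᶜ ∏[1⋯ N ] p n *ᶜ x (suc N)) (∏-suc p N)
    (subst (λ g → (∏[1⋯ N ] p *ᵖ g) (suc n) ≈ᶜ ∏[1⋯ N ] p (suc n) +ᶜ ∏[1⋯ N ] p n *ᶜ x (suc N)) (p≡ (suc N))
      (*ᵖ-linear-suc (x (suc N)) (∏[1⋯ N ] p) n))

ℚ→ℂ-combine : ∀ x y z w {v} → x ℚ.+ y ℚ.* (z ℚ.* w) ≡ v → ℚ→ℂ x +ᶜ ℚ→ℂ y *ᶜ (ℚ→ℂ z *ᶜ ℚ→ℂ w) ≈ᶜ ℚ→ℂ v
ℚ→ℂ-combine x y z w refl = ≈ᶜ-pointwise {ℚ→ℂ x +ᶜ ℚ→ℂ y *ᶜ (ℚ→ℂ z *ᶜ ℚ→ℂ w)} {ℚ→ℂ (x ℚ.+ y ℚ.* (z ℚ.* w))}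
  (λ _ → solve 4 (λ x y z w → x :+ (y :* (z :* w :+ :- (con 0ℚ :* con 0ℚ)) :+ :- (con 0ℚ :* (z :* con 0ℚ :+ con 0ℚ :* w)))
                    := x :+ y :* (z :* w)) refl x y z w)
  (λ _ → solve 4 (λ x y z w → con 0ℚ :+ (y :* (z :* con 0ℚ :+ con 0ℚ :* w) :+ con 0ℚ :* (z :* w :+ :- (con 0ℚ :* con 0ℚ)))
                    := con 0ℚ) refl x y z w)
  where open +-*-Solver

module EulerProduct (q : ℕ) (q≥2 : 2 ℕ.≤ q) where

  instance
    q-nonZero : ℕ.NonZero q
    q-nonZero = ℕ.>-nonZero (ℕP.<⇒≤ q≥2)

  q^-nonZero : ∀ n → ℕ.NonZero (q ^ n)
  q^-nonZero n = ℕP.m^n≢0 q n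

  -- Abstract because unfolding a normalised quotient is very expensive.
  abstract
    s : ℕ → ℚ
    s N = ℚ._/_ (+ 1) (q ^ N) {{q^-nonZero N}}

    s≥0 : ∀ N → 0ℚ ℚ.≤ s N
    s≥0 N = ℚP.nonNegative⁻¹ (s N) {{ℚP.normalize-nonNeg 1 (q ^ N) {{q^-nonZero N}}}}

    s*q^ : ∀ N → s N ℚ.* natℚ (q ^ N) ≡ 1ℚ
    s*q^ N = 1/n*natℚ (q ^ N) {{q^-nonZero N}}

    recip≡s : ∀ N → recip (q ^ N) ≡ ℚ→ℂ (s N)
    recip≡s N = recip-nonZero (q ^ N) {{q^-nonZero N}}

  natℚ-q^0 : natℚ (q ^ 0) ≡ 1ℚ
  natℚ-q^0 = ℚP.+-identityʳ 1ℚ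

  s₀≡1 : s 0 ≡ 1ℚ
  s₀≡1 = cancel (s 0) (natℚ (q ^ 0)) natℚ-q^0 (s*q^ 0)
    where
    cancel : ∀ a b → b ≡ 1ℚ → a ℚ.* b ≡ 1ℚ → a ≡ 1ℚ
    cancel a b refl ab≡1 = trans (sym (ℚP.*-identityʳ a)) ab≡1

  s-step : ∀ N → s N ≡ natℚ q ℚ.* s (suc N)
  s-step N = begin
    s N                                                                 ≡⟨ sym (ℚP.*-identityʳ (s N)) ⟩
    s N ℚ.* 1ℚ                                                          ≡⟨ cong (s N ℚ.*_) (sym (s*q^ (suc N))) ⟩
    s N ℚ.* (s (suc N) ℚ.* natℚ (q ^ suc N))                            ≡⟨ cong (λ x → s N ℚ.* (s (suc N) ℚ.* x)) (natℚ-* q (q ^ N)) ⟩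
    s N ℚ.* (s (suc N) ℚ.* (natℚ q ℚ.* natℚ (q ^ N)))                   ≡⟨ solve 4 (λ a b c d → a :* (b :* (c :* d)) := (a :* d) :* (c :* b)) refl (s N) (s (suc N)) (natℚ q) (natℚ (q ^ N)) ⟩
    (s N ℚ.* natℚ (q ^ N)) ℚ.* (natℚ q ℚ.* s (suc N))                   ≡⟨ trans (cong (ℚ._* (natℚ q ℚ.* s (suc N))) (s*q^ N)) (ℚP.*-identityˡ _) ⟩
    natℚ q ℚ.* s (suc N)                                                ∎
    where
    open ≡.≡-Reasoning
    open +-*-Solver

  -- The q-Pochhammer product (x ; q)ₙ.
  poch : ℕ → ℚ → ℚ
  poch zero    x = 1ℚ
  poch (suc n) x = poch n x ℚ.* (1ℚ ℚ.- natℚ (q ^ n) ℚ.* x)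

  -- Splits off the factor at the front instead of the back. For x = `s (suc N)` the remaining
  -- argument q x is `s N`, which links consecutive partial products.
  poch-shift : ∀ n x → poch (suc n) x ≡ (1ℚ ℚ.- x) ℚ.* poch n (natℚ q ℚ.* x)
  poch-shift zero x = trans (cong (λ y → 1ℚ ℚ.* (1ℚ ℚ.- y ℚ.* x)) natℚ-q^0)
    (solve 1 (λ x → con 1ℚ :* (con 1ℚ :- con 1ℚ :* x) := (con 1ℚ :- x) :* con 1ℚ) refl x)
    where open +-*-Solver
  poch-shift (suc n) x = begin
    poch (suc n) x ℚ.* (1ℚ ℚ.- natℚ (q ^ suc n) ℚ.* x)
      ≡⟨ cong₂ (λ y z → y ℚ.* (1ℚ ℚ.- z ℚ.* x)) (poch-shift n x) (natℚ-* q (q ^ n)) ⟩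
    ((1ℚ ℚ.- x) ℚ.* poch n (natℚ q ℚ.* x)) ℚ.* (1ℚ ℚ.- (natℚ q ℚ.* natℚ (q ^ n)) ℚ.* x)
      ≡⟨ solve 4 (λ x p a b → ((con 1ℚ :- x) :* p) :* (con 1ℚ :- (a :* b) :* x) := (con 1ℚ :- x) :* (p :* (con 1ℚ :- b :* (a :* x)))) refl
           x (poch n (natℚ q ℚ.* x)) (natℚ q) (natℚ (q ^ n)) ⟩
    (1ℚ ℚ.- x) ℚ.* (poch n (natℚ q ℚ.* x) ℚ.* (1ℚ ℚ.- natℚ (q ^ n) ℚ.* (natℚ q ℚ.* x))) ∎
    where
    open ≡.≡-Reasoning
    open +-*-Solver

  -- With p the product of n factors and Q = q ^ n, the next difference is (p - 1) - p Q x, and ∣ p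
  -- ∣ ≤ C + 1 for ∣ x ∣ ≤ 1. This gives the new constant C + (C + 1) Q.
  poch-1 : ∀ n → ∃[ C ] 0ℚ ℚ.≤ C × (∀ x → ℚ.∣ x ∣ ℚ.≤ 1ℚ → ℚ.∣ poch n x ℚ.- 1ℚ ∣ ℚ.≤ C ℚ.* ℚ.∣ x ∣)
  poch-1 zero = 0ℚ , ℚP.≤-refl , λ x _ → ℚP.≤-reflexive (sym (ℚP.*-zeroˡ ℚ.∣ x ∣))
  poch-1 (suc n) with poch-1 n
  ... | C , C≥0 , ih = C ℚ.+ (C ℚ.+ 1ℚ) ℚ.* Q , C′≥0 , bound
    where
    open ℚP.≤-Reasoning
    open +-*-Solver
    Q = natℚ (q ^ n)

    C+1≥0 : 0ℚ ℚ.≤ C ℚ.+ 1ℚ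
    C+1≥0 = ℚP.+-mono-≤ C≥0 (ℚP.<⇒≤ (ℚP.positive⁻¹ 1ℚ))

    C′≥0 : 0ℚ ℚ.≤ C ℚ.+ (C ℚ.+ 1ℚ) ℚ.* Q
    C′≥0 = ℚP.+-mono-≤ C≥0 (subst (ℚ._≤ (C ℚ.+ 1ℚ) ℚ.* Q) (ℚP.*-zeroˡ Q)
      (ℚP.*-monoʳ-≤-nonNeg Q {{ℚ.nonNegative (0≤natℚ (q ^ n))}} C+1≥0))

    module _ (x : ℚ) (x≤1 : ℚ.∣ x ∣ ℚ.≤ 1ℚ) where
      p = poch n x

      p≤C+1 : ℚ.∣ p ∣ ℚ.≤ C ℚ.+ 1ℚ
      p≤C+1 = begin
        ℚ.∣ p ∣                           ≡⟨ cong ℚ.∣_∣ (solve 1 (λ p → p := (p :- con 1ℚ) :+ con 1ℚ) refl p) ⟩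
        ℚ.∣ (p ℚ.- 1ℚ) ℚ.+ 1ℚ ∣           ≤⟨ ℚP.∣p+q∣≤∣p∣+∣q∣ (p ℚ.- 1ℚ) 1ℚ ⟩
        ℚ.∣ p ℚ.- 1ℚ ∣ ℚ.+ 1ℚ             ≤⟨ ℚP.+-monoˡ-≤ 1ℚ (ih x x≤1) ⟩
        C ℚ.* ℚ.∣ x ∣ ℚ.+ 1ℚ              ≤⟨ ℚP.+-monoˡ-≤ 1ℚ (ℚP.*-monoˡ-≤-nonNeg C {{ℚ.nonNegative C≥0}} x≤1) ⟩
        C ℚ.* 1ℚ ℚ.+ 1ℚ                   ≡⟨ cong (ℚ._+ 1ℚ) (ℚP.*-identityʳ C) ⟩
        C ℚ.+ 1ℚ                          ∎

      bound : ℚ.∣ poch (suc n) x ℚ.- 1ℚ ∣ ℚ.≤ (C ℚ.+ (C ℚ.+ 1ℚ) ℚ.* Q) ℚ.* ℚ.∣ x ∣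
      bound = begin
        ℚ.∣ p ℚ.* (1ℚ ℚ.- Q ℚ.* x) ℚ.- 1ℚ ∣
          ≡⟨ cong ℚ.∣_∣ (solve 3 (λ p Q x → p :* (con 1ℚ :- Q :* x) :- con 1ℚ := (p :- con 1ℚ) :+ :- ((p :* Q) :* x)) refl p Q x) ⟩
        ℚ.∣ (p ℚ.- 1ℚ) ℚ.+ ℚ.- ((p ℚ.* Q) ℚ.* x) ∣
          ≤⟨ ℚP.∣p+q∣≤∣p∣+∣q∣ (p ℚ.- 1ℚ) (ℚ.- ((p ℚ.* Q) ℚ.* x)) ⟩
        ℚ.∣ p ℚ.- 1ℚ ∣ ℚ.+ ℚ.∣ ℚ.- ((p ℚ.* Q) ℚ.* x) ∣
          ≡⟨ cong (ℚ.∣ p ℚ.- 1ℚ ∣ ℚ.+_) (ℚP.∣-p∣≡∣p∣ ((p ℚ.* Q) ℚ.* x)) ⟩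
        ℚ.∣ p ℚ.- 1ℚ ∣ ℚ.+ ℚ.∣ (p ℚ.* Q) ℚ.* x ∣
          ≤⟨ ℚP.+-mono-≤ (ih x x≤1) (∣*∣-mono-≤ {p ℚ.* Q} {x} (∣*∣-mono-≤ {p} {Q} p≤C+1 (ℚP.≤-reflexive (ℚP.0≤p⇒∣p∣≡p (0≤natℚ (q ^ n))))) ℚP.≤-refl) ⟩
        C ℚ.* ℚ.∣ x ∣ ℚ.+ ((C ℚ.+ 1ℚ) ℚ.* Q) ℚ.* ℚ.∣ x ∣
          ≡⟨ sym (ℚP.*-distribʳ-+ ℚ.∣ x ∣ C ((C ℚ.+ 1ℚ) ℚ.* Q)) ⟩
        (C ℚ.+ (C ℚ.+ 1ℚ) ℚ.* Q) ℚ.* ℚ.∣ x ∣ ∎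

  n≤q^n : ∀ n → n ℕ.≤ q ^ n
  n≤q^n zero    = ℕ.z≤n
  n≤q^n (suc n) = begin
    suc n                  ≡⟨ ℕP.+-comm 1 n ⟩
    n ℕ.+ 1                ≤⟨ ℕP.+-mono-≤ (n≤q^n n) (ℕP.m^n>0 q n) ⟩
    q ^ n ℕ.+ q ^ n        ≡⟨ cong (q ^ n ℕ.+_) (sym (ℕP.+-identityʳ (q ^ n))) ⟩
    2 ℕ.* q ^ n            ≤⟨ ℕP.*-monoˡ-≤ (q ^ n) q≥2 ⟩
    q ℕ.* q ^ n            ∎
    where open ℕP.≤-Reasoning

  -- Any N above C / δ works: q ^ N ≥ N ≥ C / δ, hence C s = δ s (C / δ) ≤ δ s q ^ N = δ for s =
  -- `s N`.
  C*s-small : ∀ C δ → 0ℚ ℚ.≤ C → 0ℚ ℚ.< δ → Eventually (λ N → C ℚ.* s N ℚ.≤ δ)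
  C*s-small C δ C≥0 δ>0 with quotient δ>0 (ℚP.positive⁻¹ 1ℚ)
  ... | d , d>0 , δd≡1 with archimedean (C ℚ.* d)
  ... | M , Cd≤M = M , λ N M≤N → begin
    C ℚ.* s N
      ≡⟨ trans (cong (ℚ._* (C ℚ.* s N)) δd≡1) (ℚP.*-identityˡ _) ⟨
    (δ ℚ.* d) ℚ.* (C ℚ.* s N)
      ≡⟨ solve 4 (λ e d C s → (e :* d) :* (C :* s) := (e :* s) :* (C :* d)) refl δ d C (s N) ⟩
    (δ ℚ.* s N) ℚ.* (C ℚ.* d)
      ≤⟨ ℚP.*-monoˡ-≤-nonNeg (δ ℚ.* s N) {{δs N}} (ℚP.≤-trans Cd≤M (natℚ-mono (ℕP.≤-trans M≤N (n≤q^n N)))) ⟩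
    (δ ℚ.* s N) ℚ.* natℚ (q ^ N)
      ≡⟨ trans (ℚP.*-assoc δ (s N) _) (trans (cong (δ ℚ.*_) (s*q^ N)) (ℚP.*-identityʳ δ)) ⟩
    δ ∎
    where
    open ℚP.≤-Reasoning
    open +-*-Solver
    δs : ∀ N → ℚ.NonNegative (δ ℚ.* s N)
    δs N = ℚ.nonNegative (subst (ℚ._≤ δ ℚ.* s N) (ℚP.*-zeroʳ δ) (ℚP.*-monoˡ-≤-nonNeg δ {{ℚ.nonNegative (ℚP.<⇒≤ δ>0)}} (s≥0 N)))

  poch-limit : ∀ n δ → 0ℚ ℚ.< δ → Eventually (λ N → ℚ.∣ poch n (s N) ℚ.- 1ℚ ∣ ℚ.≤ δ)
  poch-limit n δ δ>0 with poch-1 n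
  ... | C , C≥0 , bound = eventually-map
    (λ N (s≤1 , Cs≤δ) → let ∣s∣≡s = ℚP.0≤p⇒∣p∣≡p (s≥0 N) in
      ℚP.≤-trans (bound (s N) (subst (ℚ._≤ 1ℚ) (trans (ℚP.*-identityˡ (s N)) (sym ∣s∣≡s)) s≤1))
                 (subst (λ x → C ℚ.* x ℚ.≤ δ) (sym ∣s∣≡s) Cs≤δ))
    -- The instance with both constants 1 provides the condition ∣ x ∣ ≤ 1 of `poch-1`.
    (eventually-× (C*s-small 1ℚ 1ℚ (ℚP.<⇒≤ (ℚP.positive⁻¹ 1ℚ)) (ℚP.positive⁻¹ 1ℚ)) (C*s-small C δ C≥0 δ>0))

  -- The first factor is 1 - `s 0` = 0, in accordance with the empty product having no terms of
  -- positive degree.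
  poch-s₀ : ∀ n → poch (suc n) (s 0) ≡ 0ℚ
  poch-s₀ n = vanish (1ℚ ℚ.- s 0) (poch n (natℚ q ℚ.* s 0)) (poch-shift n (s 0)) (trans (cong (λ x → 1ℚ ℚ.- x) s₀≡1) (ℚP.+-inverseʳ 1ℚ))
    where
    vanish : ∀ {p} x y → p ≡ x ℚ.* y → x ≡ 0ℚ → p ≡ 0ℚ
    vanish x y p≡xy refl = trans p≡xy (ℚP.*-zeroˡ y)

  -- What one more factor of the product does to coefficient n + 1, with c (n + 1) divided out. For
  -- t = `s (suc N)` the terms with q ^ (n + 1) t cancel, leaving (1 - t) `poch n (s N)`.
  poch-step : ∀ n N → poch (suc n) (s N) ℚ.+ (natℚ (q ^ suc n) ℚ.- 1ℚ) ℚ.* (poch n (s N) ℚ.* s (suc N)) ≡ poch (suc n) (s (suc N))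
  poch-step n N = step (poch n (s N)) (s (suc N)) (natℚ q) (natℚ (q ^ n)) (s-step N) (natℚ-* q (q ^ n))
    (trans (poch-shift n (s (suc N))) (cong (λ x → (1ℚ ℚ.- s (suc N)) ℚ.* poch n x) (sym (s-step N))))
    where
    step : ∀ {S Q R} b t a e → S ≡ a ℚ.* t → Q ≡ a ℚ.* e → R ≡ (1ℚ ℚ.- t) ℚ.* b →
      b ℚ.* (1ℚ ℚ.- e ℚ.* S) ℚ.+ (Q ℚ.- 1ℚ) ℚ.* (b ℚ.* t) ≡ R
    step b t a e refl refl refl =
      solve 4 (λ b t a e → b :* (con 1ℚ :- e :* (a :* t)) :+ (a :* e :- con 1ℚ) :* (b :* t) := (con 1ℚ :- t) :* b) refl b t a e
      where open +-*-Solver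

  module _ (G : ℂ) (c : PowerSeries) (c₀ : c 0 ≈ᶜ 1ᶜ)
    (c-suc : ∀ n → c n *ᶜ G ≈ᶜ c (suc n) *ᶜ ℚ→ℂ (natℚ (q ^ suc n) ℚ.- 1ℚ))
    (x : ℕ → ℂ) (x≈ : ∀ N → x N ≈ᶜ G *ᶜ ℚ→ℂ (s N))
    (p : ℕ → PowerSeries) (p≡ : ∀ i → 1ᵖ +ᵖ (x i ·ᵖ u) ≡ p i) where

    -- The finite q-binomial theorem.
    partial-product : ∀ N n → ∏[1⋯ N ] p n ≈ᶜ c n *ᶜ ℚ→ℂ (poch n (s N))
    partial-product zero    zero    = ℂᵣ.trans {1ᶜ} {c 0} {c 0 *ᶜ 1ᶜ} (ℂᵣ.sym {c 0} {1ᶜ} c₀) (ℂᵣ.sym {c 0 *ᶜ 1ᶜ} {c 0} (ℂᵣ.*-identityʳ (c 0)))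
    partial-product zero    (suc n) = subst (λ y → 0ᶜ ≈ᶜ c (suc n) *ᶜ ℚ→ℂ y) (sym (poch-s₀ n))
      (ℂᵣ.sym {c (suc n) *ᶜ 0ᶜ} {0ᶜ} (ℂᵣ.zeroʳ (c (suc n))))
    partial-product (suc N) zero    = ℂᵣ.trans {∏[1⋯ suc N ] p 0} {∏[1⋯ N ] p 0} {c 0 *ᶜ 1ᶜ}
      (∏-linear-zero x p p≡ N) (partial-product N zero)
    partial-product (suc N) (suc n) = ℂᵣ.trans
      {∏[1⋯ suc N ] p (suc n)}
      {∏[1⋯ N ] p (suc n) +ᶜ ∏[1⋯ N ] p n *ᶜ x (suc N)}
      {c (suc n) *ᶜ ℚ→ℂ (poch (suc n) (s (suc N)))}
      (∏-linear-suc x p p≡ N n)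
      (Conv.combine {∏[1⋯ N ] p (suc n)} {c (suc n)} {ℚ→ℂ (poch (suc n) (s N))} {∏[1⋯ N ] p n} {c n} {ℚ→ℂ (poch n (s N))}
        {G} {x (suc N)} {ℚ→ℂ (natℚ (q ^ suc n) ℚ.- 1ℚ)} {ℚ→ℂ (s (suc N))} {ℚ→ℂ (poch (suc n) (s (suc N)))}
        (partial-product N (suc n)) (partial-product N n) (c-suc n) (x≈ (suc N))
        (ℚ→ℂ-combine (poch (suc n) (s N)) (natℚ (q ^ suc n) ℚ.- 1ℚ) (poch n (s N)) (s (suc N)) {poch (suc n) (s (suc N))} (poch-step n N)))

    euler-product : c ≈∏ p
    euler-product n = scaled-limit (λ N → ∏[1⋯ N ] p n) (c n) (λ N → poch n (s N))
      (λ N → partial-product N n) (poch-limit n)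

-- The generating series

private module Σᶜ = FiniteSums ℂ-commutativeRing

ι≈natℚ : ∀ n → Σᶜ.ι n ≈ᶜ ℚ→ℂ (natℚ n)
ι≈natℚ zero    = ℂᵣ.refl {0ᶜ}
ι≈natℚ (suc n) = ℂᵣ.trans {1ᶜ +ᶜ Σᶜ.ι n} {1ᶜ +ᶜ ℚ→ℂ (natℚ n)} {ℚ→ℂ (natℚ (suc n))}
  (ℂᵣ.+-congˡ {1ᶜ} {Σᶜ.ι n} {ℚ→ℂ (natℚ n)} (ι≈natℚ n))
  (ℂᵣ.sym {ℚ→ℂ (1ℚ ℚ.+ natℚ n)} {1ᶜ +ᶜ ℚ→ℂ (natℚ n)} (ℚ→ℂ-+ 1ℚ (natℚ n)))

ι-pred : ∀ n → ℚ→ℂ (natℚ n ℚ.- 1ℚ) +ᶜ 1ᶜ ≈ᶜ Σᶜ.ι n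
ι-pred n = ℂᵣ.trans {ℚ→ℂ (natℚ n ℚ.- 1ℚ) +ᶜ 1ᶜ} {ℚ→ℂ (natℚ n)} {Σᶜ.ι n}
  (≈ᶜ-pointwise {ℚ→ℂ (natℚ n ℚ.- 1ℚ) +ᶜ 1ᶜ} {ℚ→ℂ (natℚ n)} (λ _ → [p-q]+q≡p (natℚ n) 1ℚ) (λ _ → ℚP.+-identityʳ 0ℚ))
  (ℂᵣ.sym {Σᶜ.ι n} {ℚ→ℂ (natℚ n)} (ι≈natℚ n))

recip*ι : ∀ n .{{_ : ℕ.NonZero n}} → recip n *ᶜ Σᶜ.ι n ≈ᶜ 1ᶜ
recip*ι n = subst (λ r → r *ᶜ Σᶜ.ι n ≈ᶜ 1ᶜ) (sym (recip-nonZero n))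
  (ℂᵣ.trans {ℚ→ℂ 1/n *ᶜ Σᶜ.ι n} {ℚ→ℂ 1/n *ᶜ ℚ→ℂ (natℚ n)} {1ᶜ}
    (ℂᵣ.*-congˡ {ℚ→ℂ 1/n} {Σᶜ.ι n} {ℚ→ℂ (natℚ n)} (ι≈natℚ n))
    (subst (λ r → ℚ→ℂ 1/n *ᶜ ℚ→ℂ (natℚ n) ≈ᶜ ℚ→ℂ r) (1/n*natℚ n)
      (ℂᵣ.sym {ℚ→ℂ (1/n ℚ.* natℚ n)} {ℚ→ℂ 1/n *ᶜ ℚ→ℂ (natℚ n)} (ℚ→ℂ-* 1/n (natℚ n)))))
  where
  1/n = + 1 ℚ./ n

prime-power≥2 : ∀ {q} → IsPrimePower q → 2 ℕ.≤ q
prime-power≥2 (p , k , p-prime , refl) = ℕP.≤-trans p≥2 (ℕP.m≤m*n p (p ^ k) {{ℕP.m^n≢0 p k {{ℕ.>-nonZero (ℕP.<⇒≤ p≥2)}}}})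
  where
  p≥2 : 2 ℕ.≤ p
  p≥2 = ℕ.nonTrivial⇒n>1 p {{prime⇒nonTrivial p-prime}}

module _ {q} (q≥2 : 2 ℕ.≤ q) (F : FiniteField q)
  (χ : FiniteField.Unit F → ℂ) (χ-hom : IsMultiplicativeCharacter F χ)
  (ψ : FiniteField.Carrier F → ℂ) (ψ-hom : IsAdditiveCharacter F ψ) where

  open FiniteField F using (Unit; Carrier; 0#; _≟_; elements)
  private
    module χ = MonoidMorphisms.IsMonoidHomomorphism χ-hom
    module ψ = MonoidMorphisms.IsMonoidHomomorphism ψ-hom
    module S = MatrixSums F ℂ-commutativeRing

  onElement-0 : onElement F χ 0# ≈ᶜ 0ᶜ
  onElement-0 with 0# ≟ 0#
  ... | yes _  = ℂᵣ.refl {0ᶜ}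
  ... | no 0≢0 = contradiction refl 0≢0

  onElement-unit : ∀ a a≢0 → onElement F χ a ≈ᶜ χ (a , a≢0)
  onElement-unit a a≢0 with a ≟ 0#
  ... | yes a≡0 = contradiction a≡0 a≢0
  ... | no _    = ℂᵣ.refl {χ (a , a≢0)}

  private
    module C = S.Characters χ χ.homo χ.ε-homo (onElement F χ) onElement-0 onElement-unit ψ ψ.homo ψ.ε-homo

  -- The identity matrix keeps `recip` away from its junk value at 0.
  GL-nonempty : ∀ n → ℕ.NonZero (length (GL F n))
  GL-nonempty n = ℕ.>-nonZero (∈-length (∈-filter⁺ (invertible? F) (∈-matrices F (idMat F)) (Matrices.idMat-invertible F n)))

  recip*order : ∀ n → recip (length (GL F n)) *ᶜ S.order n ≈ᶜ 1ᶜ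
  recip*order n = ℂᵣ.trans {recip (length (GL F n)) *ᶜ S.order n} {recip (length (GL F n)) *ᶜ Σᶜ.ι (length (GL F n))} {1ᶜ}
    (ℂᵣ.*-congˡ {recip (length (GL F n))} {S.order n} {Σᶜ.ι (length (GL F n))} (S.order≈length n))
    (recip*ι (length (GL F n)) {{GL-nonempty n}})

  glSeries-suc : ∀ n → glSeries F χ ψ (suc n) ≈ᶜ recip (length (GL F (suc n))) *ᶜ C.total (suc n)
  glSeries-suc n = ℂᵣ.*-congˡ {recip (length (GL F (suc n)))} {glSum F χ ψ (suc n)} {C.total (suc n)} (C.total≈Σ-GL (suc n))

  glSeries≈ : ∀ n → glSeries F χ ψ n ≈ᶜ recip (length (GL F n)) *ᶜ C.total n
  -- The constant term 1 fits the general formula: GL(0,q) consists of the empty matrix, of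
  -- determinant 1 and trace 0.
  glSeries≈ zero = ℂᵣ.trans {1ᶜ} {r *ᶜ S.order 0} {r *ᶜ C.total 0}
    (ℂᵣ.sym {r *ᶜ S.order 0} {1ᶜ} (recip*order 0))
    (ℂᵣ.*-congˡ {r} {S.order 0} {C.total 0}
      (ℂᵣ.trans {S.order 0} {1ᶜ} {C.total 0} S.order-zero (ℂᵣ.sym {C.total 0} {1ᶜ} C.total-zero)))
    where
    r = recip (length (GL F 0))
  glSeries≈ (suc n) = glSeries-suc n

  glSeries-trivial : IsTrivial ψ → IsTrivial χ → ∀ n → glSeries F χ ψ n ≈ᶜ 1ᶜ
  glSeries-trivial ψ≈1 χ≈1 n = ℂᵣ.trans {glSeries F χ ψ n} {r *ᶜ C.total n} {1ᶜ} (glSeries≈ n)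
    (ℂᵣ.trans {r *ᶜ C.total n} {r *ᶜ S.order n} {1ᶜ}
      (ℂᵣ.*-congˡ {r} {C.total n} {S.order n} (C.total-trivial X≈1 ψ≈1 n)) (recip*order n))
    where
    r = recip (length (GL F n))

    X≈1 : ∀ a → a ≢ 0# → onElement F χ a ≈ᶜ 1ᶜ
    X≈1 a a≢0 = ℂᵣ.trans {onElement F χ a} {χ (a , a≢0)} {1ᶜ} (onElement-unit a a≢0) (χ≈1 (a , a≢0))

  case-trivial : IsTrivial ψ → IsTrivial χ → glSeries F χ ψ ≈1/ (1ᵖ -ᵖ u)
  case-trivial ψ≈1 χ≈1 zero    = Conv.geometric-zero {1ᵖ -ᵖ u} {glSeries F χ ψ} Conv.1-0 (glSeries-trivial ψ≈1 χ≈1)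
  case-trivial ψ≈1 χ≈1 (suc n) = Conv.geometric-suc {1ᵖ -ᵖ u} {glSeries F χ ψ} Conv.1-0 Conv.0-1 (λ _ → ℂᵣ.-‿inverseʳ 0ᶜ)
    (glSeries-trivial ψ≈1 χ≈1) n

  case-χ-nontrivial : IsTrivial ψ → ¬ IsTrivial χ → glSeries F χ ψ ≈ᵖ 1ᵖ
  case-χ-nontrivial ψ≈1 χ≉1 zero    = ℂᵣ.refl {1ᶜ}
  case-χ-nontrivial ψ≈1 χ≉1 (suc n) = ℂᵣ.trans {glSeries F χ ψ (suc n)} {r *ᶜ C.total (suc n)} {0ᶜ} (glSeries-suc n)
    (ℂᵣ.trans {r *ᶜ C.total (suc n)} {r *ᶜ 0ᶜ} {0ᶜ}
      (ℂᵣ.*-congˡ {r} {C.total (suc n)} {0ᶜ} (C.total-vanishes ψ≈1 (nontrivial-cancel χ χ≉1) n)) (ℂᵣ.zeroʳ r))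
    where
    r = recip (length (GL F (suc n)))

  case-ψ-nontrivial : ¬ IsTrivial ψ → glSeries F χ ψ ≈∏ (λ i → 1ᵖ +ᵖ (gaussSum F χ ψ *ᶜ recip (q ^ i)) ·ᵖ u)
  case-ψ-nontrivial ψ≉1 = euler-product (gaussSum F χ ψ) (glSeries F χ ψ) (ℂᵣ.refl {1ᶜ}) recurrence
    (λ i → gaussSum F χ ψ *ᶜ recip (q ^ i))
    (λ N → ℂᵣ.*-congˡ {gaussSum F χ ψ} {recip (q ^ N)} {ℚ→ℂ (s N)} (ℂᵣ.reflexive {recip (q ^ N)} {ℚ→ℂ (s N)} (recip≡s N)))
    _ (λ _ → refl)
    where
    open EulerProduct q q≥2

    recurrence : ∀ n → glSeries F χ ψ n *ᶜ gaussSum F χ ψ ≈ᶜ glSeries F χ ψ (suc n) *ᶜ ℚ→ℂ (natℚ (q ^ suc n) ℚ.- 1ℚ)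
    recurrence n = C.coefficient-suc (nontrivial-cancel ψ ψ≉1) n
      {glSeries F χ ψ n} {glSeries F χ ψ (suc n)} {recip (length (GL F n))} {recip (length (GL F (suc n)))}
      {gaussSum F χ ψ} {ℚ→ℂ (natℚ (q ^ suc n) ℚ.- 1ℚ)}
      (glSeries≈ n) (glSeries-suc n) (C.Σ-units elements) (recip*order n) (recip*order (suc n)) (ι-pred (q ^ suc n))

theorem1 : (q : ℕ) → IsPrimePower q → (F : FiniteField q) →
    (χ : FiniteField.Unit F → ℂ) → IsMultiplicativeCharacter F χ →
    (ψ : FiniteField.Carrier F → ℂ) → IsAdditiveCharacter F ψ →
    (IsTrivial ψ × IsTrivial χ → glSeries F χ ψ ≈1/ (1ᵖ -ᵖ u))
    × (IsTrivial ψ × ¬ IsTrivial χ → glSeries F χ ψ ≈ᵖ 1ᵖ)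
    × (¬ IsTrivial ψ →
    glSeries F χ ψ ≈∏ (λ i → 1ᵖ +ᵖ (gaussSum F χ ψ *ᶜ recip (q ^ i)) ·ᵖ u))
theorem1 q q-prime-power F χ χ-hom ψ ψ-hom =
    (λ (ψ≈1 , χ≈1) → case-trivial q≥2 F χ χ-hom ψ ψ-hom ψ≈1 χ≈1)
  , (λ (ψ≈1 , χ≉1) → case-χ-nontrivial q≥2 F χ χ-hom ψ ψ-hom ψ≈1 χ≉1)
  , case-ψ-nontrivial q≥2 F χ χ-hom ψ ψ-hom
  where
  q≥2 = prime-power≥2 q-prime-power
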